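{- Let $\mathsf{M}$ be a loopless polymatroid and $\mathcal{G}$ a building set on $\mathcal{L}(\mathsf{M})$. In the incidence algebra $\mathcal{I}$ of $\mathcal{L}(\mathsf{M})$, the $\mathcal{G}$-Chow function and the $\mathcal{G}$-reduced characteristic function are inverse up to sign: $\mathrm{H}^{\mathcal{G}}=-\left(\overline{\chi}^{\mathcal{G}}\right)^{ -1}$.
   Context: A polymatroid $\mathsf{M}=(E,\operatorname{rk})$: finite $E$, $\operatorname{rk}:2^E\to\mathbb{Z}_{\ge0}$ with $\operatorname{rk}(\varnothing)=0$, monotone, submodular. Flats: $F$ with $\operatorname{rk}(F\cup\{e\})>\operatorname{rk}(F)$ for $e\notin F$; lattice $\mathcal L(\mathsf{M})$ with join $\vee$; loopless: $\varnothing$ is a flat. $f(\mathcal{G})$ = inclusion-maximal elements of a set $\mathcal{G}$ of flats; $\mathcal{G}_{\le F}=\{G\in\mathcal{G}:G\subseteq F\}$. A building set is $\mathcal{G}\subseteq\mathcal L(\mathsf{M})\setminus\{\varnothing\}$ such that for every flat $F$ the map $\prod_{G\in f(\mathcal{G}_{\le F})}[\varnothing,G]\to[\varnothing,F]$, $(F_G)\mapsto\bigvee F_G$, is a lattice isomorphism and $\operatorname{rk}(F)=\sum_{G\in f(\mathcal{G}_{\le F})}\operatorname{rk}(G)$. For flats $F\subsetneq G$, the minor $\mathsf{M}|_G/F$ is the polymatroid on $G\setminus F$ with rank $A\mapsto\operatorname{rk}(A\cup F)-\operatorname{rk}(F)$, lattice of flats identified with $[F,G]$, with induced building set $\mathcal{G}|_G/F=\{H\vee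 F:H\in\mathcal{G},H\subseteq G,H\not\subseteq F\}$. Characteristic polynomial: $\chi_\mathsf{N}(x)=\sum_{F\in\mathcal L(\mathsf{N})}\mu(\varnothing,F)x^{\operatorname{rk}(\text{ground set})-\operatorname{rk}(F)}$. The Chow ring $D(\mathsf{N},\mathcal{B})$ of a polymatroid $\mathsf{N}$ with building set $\mathcal{B}$ is $\mathbb{Q}[x_B:B\in\mathcal{B}]$ (degree-1 generators) modulo the ideal generated by $\big(\prod_{i=1}^m x_{B_i}\big)\big(\sum_{H\in\mathcal{B},H\supseteq B}x_H\big)^{\operatorname{rk}(B)-\operatorname{rk}(\sup(S,B))}$ for each subset $S=\{B_1,\dots,B_m\}\subseteq\mathcal{B}$ and $B\in\mathcal{B}$, with $\sup(S,B)=\bigvee_{B'\in S,B'\subsetneq B}B'$; $\mathrm{H}^{\mathcal{B}}_\mathsf{N}(x)$ is its Hilbert series. The incidence algebra $\mathcal{I}$ consists of functions $a$ assigning to each pair of flats $F\subseteq G$ an element $a_{FG}\in\mathbb{Q}(x)$, with product $(a\cdot b)_{FG}=\sum_{H\in[F,G]}a_{FH}b_{HG}$ and identity $\delta$ ($\delta_{FF}=1$, $\delta_{FG}=0$ for $F\ne G$). Define $\overline{\chi}^{\mathcal{G}}_{FF}=-1$, $\overline{\chi}^{\mathcal{G}}_{FG}=-\chi_{\mathsf{M}|_G/F}(x)/(1-x)^{|f(\mathcal{G}|_G/F)|}$ for $F\subsetneq G$; and $\mathrm{H}^{\mathcal{G}}_{FF}=1$, $\mathrm{H}^{\mathcal{G}}_{FG}=\mathrm{H}^{\mathcal{G}|_G/F}_{\mathsf{M}|_G/F}(x)$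 for $F\subsetneq G$. -}

module Defs where

open import Data.Nat as ℕ using (ℕ; zero; suc; _≤_; _<_; _+_; _∸_; _≤ᵇ_; _≡ᵇ_)
open import Data.Nat.Properties using (_<?_)
open import Data.Integer as ℤ using (ℤ; +_; -_)
open import Data.Rational as ℚ using (ℚ)
open import Data.Bool using (Bool; true; false; if_then_else_; T)
import Data.Bool as Bool
open import Data.Fin using (Fin)
import Data.Fin as Fin
open import Data.Fin.Subset using (Subset; ⊥; ⊤; ⁅_⁆; _∈_; _∉_; _⊆_; _∩_; _∪_; ∣_∣)
open import Data.Fin.Subset.Properties using (_⊆?_; _∈?_)
open import Data.Fin.Properties using (all?)
open import Data.List using (List; []; _∷_; [_]; map; filter; foldr; concatMap; length; upTo; allFin; lookup; _++_)
import Data.List as List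
open import Data.List.Relation.Unary.All using (All)
open import Data.List.Relation.Unary.Any using (Any; any?)
open import Data.List.Relation.Binary.Sublist.Propositional using () renaming (_⊆_ to _⊑_)
open import Data.Vec as V using (Vec)
open import Data.Vec.Properties using (≡-dec)
open import Data.Product using (Σ; ∃; _×_; _,_; proj₁; proj₂)
open import Relation.Nullary using (Dec; yes; no; ¬_; ¬?; does)
open import Relation.Nullary.Decidable using (_×-dec_; _→-dec_; T?)
open import Relation.Binary.PropositionalEquality using (_≡_; _≢_)

allSubsets : (n : ℕ) → List (Subset n)
allSubsets zero = [ V.[] ]
allSubsets (suc n) = concatMap (λ s → (false V.∷ s) ∷ (true V.∷ s) ∷ []) (allSubsets n)

_≟ₛ_ : ∀ {n} (A B : Subset n) → Dec (A ≡ B)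
_≟ₛ_ = ≡-dec Bool._≟_

_⊊_ : ∀ {n} → Subset n → Subset n → Set
A ⊊ B = A ⊆ B × A ≢ B

_⊊?_ : ∀ {n} (A B : Subset n) → Dec (A ⊊ B)
A ⊊? B = (A ⊆? B) ×-dec ¬? (A ≟ₛ B)

sumℤ : List ℤ → ℤ
sumℤ = foldr ℤ._+_ (+ 0)

sumℚ : List ℚ → ℚ
sumℚ = foldr ℚ._+_ ℚ.0ℚ

-- Formal power series with integer coefficients (ℕ → ℤ), coefficientwise.

PS : Set
PS = ℕ → ℤ

constPS : ℤ → PS
constPS c d = if d ≡ᵇ 0 then c else + 0

_*ₚ_ : PS → PS → PS
(a *ₚ b) d = sumℤ (map (λ i → a i ℤ.* b (d ∸ i)) (upTo (suc d)))

invOneMinusXPow : ℕ → PS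
invOneMinusXPow zero = constPS (+ 1)
invOneMinusXPow (suc k) d = sumℤ (map (invOneMinusXPow k) (upTo (suc d)))

-- Polynomials over ℚ in m variables (list of terms coefficient × exponent vector)

Poly : ℕ → Set
Poly m = List (ℚ × Vec ℕ m)

coeffP : ∀ {m} → Poly m → Vec ℕ m → ℚ
coeffP p e = sumℚ (map proj₁ (filter (λ t → ≡-dec ℕ._≟_ (proj₂ t) e) p))

monoP : ∀ {m} → Vec ℕ m → Poly m
monoP e = [ (ℚ.1ℚ , e) ]

varP : ∀ {m} → Fin m → Poly m
varP {m} i = monoP (V.replicate m 0 V.[ i ]≔ 1)

_*P_ : ∀ {m} → Poly m → Poly m → Poly m
p *P q = concatMap (λ t → map (λ u → (proj₁ t ℚ.* proj₁ u , V.zipWith _+_ (proj₂ t) (proj₂ u))) q) p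

oneP : ∀ {m} → Poly m
oneP {m} = monoP (V.replicate m 0)

sumP : ∀ {m} → List (Poly m) → Poly m
sumP = foldr _++_ []

prodP : ∀ {m} → List (Poly m) → Poly m
prodP = foldr _*P_ oneP

_^P_ : ∀ {m} → Poly m → ℕ → Poly m
p ^P zero = oneP
p ^P suc k = p *P (p ^P k)

monos : (m d : ℕ) → List (Vec ℕ m)
monos zero zero = [ V.[] ]
monos zero (suc d) = []
monos (suc m) d = concatMap (λ k → map (k V.∷_) (monos m (d ∸ k))) (upTo (suc d))

lincomb : ∀ {m} → List ℚ → List (Poly m) → Vec ℕ m → ℚ
lincomb cs ps e = sumℚ (List.zipWith (λ c p → c ℚ.* coeffP p e) cs ps)

LinIndependent : ∀ {m} → List (Poly m) → Set
LinIndependent ps = ∀ (cs : List ℚ) → length cs ≡ length ps →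
  (∀ e → lincomb cs ps e ≡ ℚ.0ℚ) → All (_≡ ℚ.0ℚ) cs

IsRank : ∀ {m} → List (Poly m) → ℕ → Set
IsRank ps r =
  (∃ λ qs → qs ⊑ ps × length qs ≡ r × LinIndependent qs)
  × (∀ qs → qs ⊑ ps → LinIndependent qs → length qs ≤ r)

record Polymatroid (n : ℕ) : Set where
  field
    rk : Subset n → ℕ
    rk-⊥ : rk ⊥ ≡ 0
    rk-mono : ∀ {A B} → A ⊆ B → rk A ≤ rk B
    rk-submod : ∀ A B → rk (A ∪ B) + rk (A ∩ B) ≤ rk A + rk B

module _ {n : ℕ} (M : Polymatroid n) where
  open Polymatroid M

  IsFlat : Subset n → Set
  IsFlat F = ∀ e → e ∉ F → rk F < rk (F ∪ ⁅ e ⁆)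

  isFlat? : ∀ F → Dec (IsFlat F)
  isFlat? F = all? (λ e → ¬? (e ∈? F) →-dec (rk F <? rk (F ∪ ⁅ e ⁆)))

  Loopless : Set
  Loopless = IsFlat ⊥

  flats : List (Subset n)
  flats = filter isFlat? (allSubsets n)

  _∨_ : Subset n → Subset n → Subset n
  F ∨ G = foldr _∩_ ⊤ (filter (λ K → (F ∪ G) ⊆? K) flats)

  bigJoin : Subset n → List (Subset n) → Subset n
  bigJoin b = foldr _∨_ b

  maximals : List (Subset n) → List (Subset n)
  maximals L = filter (λ G → ¬? (any? (λ K → G ⊊? K) L)) L

  interval : Subset n → Subset n → List (Subset n)
  interval F G = filter (λ H → (F ⊆? H) ×-dec (H ⊆? G)) flats

  𝒢≤ : (Subset n → Bool) → Subset n → List (Subset n)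
  𝒢≤ 𝒢 F = filter (λ G → T? (𝒢 G) ×-dec (G ⊆? F)) (allSubsets n)

  -- tuples (F_G)_{G ∈ ms} in ∏ [∅, G], represented as functions
  ValidTuple : List (Subset n) → (Subset n → Subset n) → Set
  ValidTuple ms t = All (λ G → IsFlat (t G) × t G ⊆ G) ms

  joinTuple : List (Subset n) → (Subset n → Subset n) → Subset n
  joinTuple ms t = bigJoin ⊥ (map t ms)

  record IsBuildingSet (𝒢 : Subset n → Bool) : Set where
    field
      members-flat : ∀ G → T (𝒢 G) → IsFlat G
      members-nonempty : ∀ G → T (𝒢 G) → G ≢ ⊥
      -- the join map ∏_{G ∈ f(𝒢≤F)} [∅,G] → [∅,F] is onto ...
      join-surj : ∀ F → IsFlat F → ∀ H → IsFlat H → H ⊆ F →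
        ∃ λ t → ValidTuple (maximals (𝒢≤ 𝒢 F)) t × joinTuple (maximals (𝒢≤ 𝒢 F)) t ≡ H
      -- ... and an order embedding (hence a lattice isomorphism)
      join-order : ∀ F → IsFlat F → ∀ t t' →
        ValidTuple (maximals (𝒢≤ 𝒢 F)) t → ValidTuple (maximals (𝒢≤ 𝒢 F)) t' →
        (joinTuple (maximals (𝒢≤ 𝒢 F)) t ⊆ joinTuple (maximals (𝒢≤ 𝒢 F)) t'
          → All (λ G → t G ⊆ t' G) (maximals (𝒢≤ 𝒢 F)))
        × (All (λ G → t G ⊆ t' G) (maximals (𝒢≤ 𝒢 F))
          → joinTuple (maximals (𝒢≤ 𝒢 F)) t ⊆ joinTuple (maximals (𝒢≤ 𝒢 F)) t')
      rank-sum : ∀ F → IsFlat F → rk F ≡ foldr _+_ 0 (map rk (maximals (𝒢≤ 𝒢 F)))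

  -- Möbius function of the lattice of flats (recursive definition; fuel suc n
  -- exceeds the length of every chain of subsets of Fin n)
  mobiusFuel : ℕ → Subset n → Subset n → ℤ
  mobiusFuel zero F H = + 0
  mobiusFuel (suc k) F H with F ≟ₛ H
  ... | yes _ = + 1
  ... | no _ = - sumℤ (map (mobiusFuel k F) (filter (λ K → K ⊊? H) (interval F H)))

  μ : Subset n → Subset n → ℤ
  μ = mobiusFuel (suc n)

  -- characteristic polynomial of the minor M|_G/F (flats identified with [F,G],
  -- rank of the ground set rk G - rk F, rank of H equal to rk H - rk F)
  charPoly : Subset n → Subset n → PS
  charPoly F G d = sumℤ (map (λ H → if (rk G ∸ rk H) ≡ᵇ d then μ F H else + 0) (interval F G))

  InInduced : (Subset n → Bool) → Subset n → Subset n → Subset n → Set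
  InInduced 𝒢 F G K = Any (λ H → T (𝒢 H) × H ⊆ G × ¬ (H ⊆ F) × (H ∨ F) ≡ K) (allSubsets n)

  inInduced? : ∀ 𝒢 F G K → Dec (InInduced 𝒢 F G K)
  inInduced? 𝒢 F G K =
    any? (λ H → T? (𝒢 H) ×-dec (H ⊆? G) ×-dec ¬? (H ⊆? F) ×-dec ((H ∨ F) ≟ₛ K)) (allSubsets n)

  induced : (Subset n → Bool) → Subset n → Subset n → List (Subset n)
  induced 𝒢 F G = filter (inInduced? 𝒢 F G) (interval F G)

  χ̄ : (Subset n → Bool) → Subset n → Subset n → PS
  χ̄ 𝒢 F G = if does (F ≟ₛ G) then constPS (- (+ 1))
    else (λ d → - ((charPoly F G *ₚ invOneMinusXPow (length (maximals (induced 𝒢 F G)))) d))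

  -- Chow ring D(M|_G/F, 𝒢|_G/F): variables x_i indexed by Fin m, m = |𝒢|_G/F|
  module _ (𝒢 : Subset n → Bool) (F G : Subset n) where
    nvars : ℕ
    nvars = length (induced 𝒢 F G)

    Bel : Fin nvars → Subset n
    Bel = lookup (induced 𝒢 F G)

    -- sup(S, B) in the minor (its bottom element is F)
    supSB : Subset nvars → Fin nvars → Subset n
    supSB S b = bigJoin F (map Bel (filter (λ i → (i ∈? S) ×-dec (Bel i ⊊? Bel b)) (allFin nvars)))

    -- rk_minor(B) - rk_minor(sup(S,B)) = rk B - rk sup(S,B)
    expo : Subset nvars → Fin nvars → ℕ
    expo S b = rk (Bel b) ∸ rk (supSB S b)

    linForm : Fin nvars → Poly nvars
    linForm b = sumP (map varP (filter (λ j → Bel b ⊆? Bel j) (allFin nvars)))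

    -- generator (with its degree) attached to (S, B)
    chowGen : Subset nvars → Fin nvars → ℕ × Poly nvars
    chowGen S b = (∣ S ∣ + expo S b ,
      prodP (map varP (filter (_∈? S) (allFin nvars))) *P (linForm b ^P expo S b))

    chowGens : List (ℕ × Poly nvars)
    chowGens = concatMap (λ S → map (chowGen S) (allFin nvars)) (allSubsets nvars)

    -- spanning family of the degree-d part of the (homogeneous) ideal
    idealDeg : ℕ → List (Poly nvars)
    idealDeg d = concatMap
      (λ g → if proj₁ g ≤ᵇ d then map (λ e → monoP e *P proj₂ g) (monos nvars (d ∸ proj₁ g)) else [])
      chowGens

    -- h is the Hilbert series of D: h d = dim (degree-d polys) - dim (degree-d ideal part)
    IsChowHilbertSeries : (ℕ → ℕ) → Set
    IsChowHilbertSeries h = ∀ d → ∃ λ r → IsRank (idealDeg d) r × h d + r ≡ length (monos nvars d)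

  -- Chow function H^𝒢 from a Hilbert-series assignment h
  chowFun : (Subset n → Subset n → ℕ → ℕ) → Subset n → Subset n → PS
  chowFun h F G = if does (F ≟ₛ G) then constPS (+ 1) else (λ d → + h F G d)

  _·ᵢ_ : (Subset n → Subset n → PS) → (Subset n → Subset n → PS) → Subset n → Subset n → PS
  (a ·ᵢ b) F G d = sumℤ (map (λ H → (a F H *ₚ b H G) d) (interval F G))

  minusδ : Subset n → Subset n → PS
  minusδ F G = if does (F ≟ₛ G) then constPS (- (+ 1)) else (λ _ → + 0)

{-# OPTIONS --safe #-}
-- The dual of the Chow ring of a minor [F,G] is the space of functionals on ℚ[x_B] killed by
-- the relations. Adjoin the variables from the largest element of the building set down to the
-- smallest; T lists the elements whose variables were multiplied in. With C the next element, h the sum of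
-- the x_H, H ⊋ C, and c = rk C − rk sup(T,C), a functional φ on polynomials in x_C is a sequence
-- of functionals φ_k, and φ is killed by the relations iff φ_0 is killed by those for T, φ_k by
-- those for T ∪ {C} when k ≥ 1, and (x_C + h)^c φ = 0. Since h^c φ_0 is automatically killed by
-- the relations for T ∪ {C} (`critical`), φ_0, …, φ_{c−1} can be chosen freely. So the Hilbert
-- function counts monomials, and the count satisfies, for the list U of remaining elements,
--   Q(C ∷ U, T) = Q(U, T) + (x + ⋯ + x^{c−1}) Q(U, C ∷ T)   if c ≥ 1,  and 0 if c = 0.
-- Summing against the reduced characteristic function turns the terminal weight of this recursion
-- into ρ(J) = Σ_{K ⊇ J} χ_{KG} (1−x)^{−#{factors of G not below K}}, J the join of T. Möbius
-- inversion gives ρ(J) = (x^c − x)/(1−x) · ρ(J ∨ W) for each factor W of G, c = rk(J ∨ W) − rk J,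
-- and then the recursion collapses to 0 at the element W ∨ F.
module Submission where

open import Defs
open import Relation.Binary.PropositionalEquality using (_≡_)
open import Data.Nat as ℕ using (ℕ; suc; zero; _∸_; _≤_; _<_; z≤n; s≤s; _<ᵇ_; _≤ᵇ_; _≡ᵇ_)
open import Data.Bool using (Bool; if_then_else_; true; false; T; _∧_)
open import Data.Fin using (zero; suc; Fin)
open import Data.Fin.Subset using (Subset; _⊆_; _∩_; _∪_; ∣_∣)
open import Data.List using (List; []; _∷_; _++_; map; filter; concatMap; foldr; length; upTo; allFin)
open import Data.List.Relation.Unary.Any using (here; there; any?)
open import Data.Product using (_×_; ∃; ∃₂; _,_; proj₁; proj₂)
open import Data.Sum using (_⊎_; inj₁; inj₂; [_,_]′)
open import Data.Empty using (⊥-elim)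
open import Function using (_∘_; id)
open import Relation.Nullary using (does; yes; no; ¬_; ¬?; Dec)
open import Relation.Nullary.Decidable using (dec⇒maybe; _×-dec_; decidable-stable; _→-dec_; T?; dec-true; dec-false)
open import Level using (0ℓ)
open import Algebra.Bundles using (CommutativeRing)
open import Data.List.Relation.Unary.Unique.Propositional using (Unique)
import Data.List.Relation.Binary.Permutation.Propositional as Perm
import Data.Rational.Properties as ℚP
import Data.List.Relation.Unary.All as All
import Data.List.Relation.Binary.Permutation.Setoid.Properties as PermS
import Data.Integer.Properties as ℤP
import Data.Nat.Properties as ℕP
import Data.Fin.Properties as FinP
import Data.Vec as V
import Data.List.Relation.Unary.Any as Any
import Data.List.Relation.Unary.AllPairs as AllPairs
import Data.List.Relation.Unary.AllPairs.Properties as AllPairsP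
import Data.List.Relation.Unary.Unique.Propositional.Properties as UniqueP
import Data.List.Properties as ListP
import Data.List.Relation.Binary.Permutation.Propositional.Properties as PermP
import Data.Bool
import Data.List as List
import Data.List.Relation.Unary.All.Properties as AllP
import Data.List.Relation.Binary.Sublist.Propositional.Properties as SublistP
import Data.List.Relation.Binary.Sublist.Heterogeneous.Properties as SublistH

-- The rank of the ideal is squeezed from two sides: every standard monomial carries a functional
-- that kills the ideal, which bounds the rank above; a functional killed by the relations that
-- vanishes on all standard monomials is zero, which bounds it below. The step that is not formal is
-- `critical`, and there the building set enters: two elements above a common C have their join in
-- the list. This allows h to be traded for the sum over H ⊇ B when B is above C, and submodularity
-- then controls the exponents. On the other side put u = 1/(1 - x) and v = 1 - u. A factor W of G
-- has weight u + v[W ⊆ K], so ρ is evaluated one factor at a time, starting from Σ χ_{KG} = x^(rk G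
-- - rk J). The element W ∨ F is maximal in the induced building set, hence invisible to the
-- exponents of the elements after it in the list; the two branches of the recursion at W ∨ F then
-- differ only in their terminal weights, and for c ≥ 1 these combine with (x^c - x)/(1 - x) + x + ⋯
-- + x^(c-1) = 0. Only the product of H with χ̄ is computed; the product in the other order follows
-- in the incidence algebra.

module FiniteSums where
  open import Data.List.Membership.Propositional using (_∈_)
  open import Data.List.Relation.Binary.Permutation.Propositional using (_↭_; prep; swap)
  open import Relation.Unary using (Decidable)
  import Relation.Binary.PropositionalEquality as ≡

  module Sum (R : CommutativeRing 0ℓ 0ℓ) where
    open CommutativeRing R
    open import Relation.Binary.Reasoning.Setoid setoid
    open import Algebra.Properties.CommutativeSemigroup +-commutativeSemigroup using (interchange; x∙yz≈y∙xz)

    Σ : {A : Set} → List A → (A → Carrier) → Carrier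
    Σ xs f = foldr _+_ 0# (map f xs)

    Σ-cong-∈ : {A : Set} (xs : List A) {f g : A → Carrier} →
      (∀ {x} → x ∈ xs → f x ≈ g x) → Σ xs f ≈ Σ xs g
    Σ-cong-∈ [] p = refl
    Σ-cong-∈ (x ∷ xs) p = +-cong (p (here ≡.refl)) (Σ-cong-∈ xs (p ∘ there))

    Σ-cong : {A : Set} (xs : List A) {f g : A → Carrier} → (∀ x → f x ≈ g x) → Σ xs f ≈ Σ xs g
    Σ-cong xs p = Σ-cong-∈ xs (λ {x} _ → p x)

    Σ-0 : {A : Set} (xs : List A) → Σ xs (λ _ → 0#) ≈ 0#
    Σ-0 [] = refl
    Σ-0 (x ∷ xs) = trans (+-identityˡ _) (Σ-0 xs)

    Σ-0-∈ : {A : Set} (xs : List A) {f : A → Carrier} → (∀ {x} → x ∈ xs → f x ≈ 0#) → Σ xs f ≈ 0#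
    Σ-0-∈ xs p = trans (Σ-cong-∈ xs p) (Σ-0 xs)

    Σ-+ : {A : Set} (xs : List A) (f g : A → Carrier) → Σ xs (λ x → f x + g x) ≈ Σ xs f + Σ xs g
    Σ-+ [] f g = sym (+-identityˡ _)
    Σ-+ (x ∷ xs) f g = trans (+-congˡ (Σ-+ xs f g)) (interchange _ _ _ _)

    Σ-*ˡ : {A : Set} (xs : List A) (a : Carrier) (f : A → Carrier) → Σ xs (λ x → a * f x) ≈ a * Σ xs f
    Σ-*ˡ [] a f = sym (zeroʳ a)
    Σ-*ˡ (x ∷ xs) a f = trans (+-congˡ (Σ-*ˡ xs a f)) (sym (distribˡ _ _ _))

    Σ-*ʳ : {A : Set} (xs : List A) (a : Carrier) (f : A → Carrier) → Σ xs (λ x → f x * a) ≈ Σ xs f * a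
    Σ-*ʳ [] a f = sym (zeroˡ a)
    Σ-*ʳ (x ∷ xs) a f = trans (+-congˡ (Σ-*ʳ xs a f)) (sym (distribʳ _ _ _))

    Σ-swap : {A B : Set} (xs : List A) (ys : List B) (f : A → B → Carrier) →
      Σ xs (λ x → Σ ys (f x)) ≈ Σ ys (λ y → Σ xs (λ x → f x y))
    Σ-swap [] ys f = sym (Σ-0 ys)
    Σ-swap (x ∷ xs) ys f = trans (+-congˡ (Σ-swap xs ys f)) (sym (Σ-+ ys _ _))

    Σ-++ : {A : Set} (xs ys : List A) (f : A → Carrier) → Σ (xs ++ ys) f ≈ Σ xs f + Σ ys f
    Σ-++ [] ys f = sym (+-identityˡ _)
    Σ-++ (x ∷ xs) ys f = trans (+-congˡ (Σ-++ xs ys f)) (sym (+-assoc _ _ _))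

    Σ-map : {A B : Set} (xs : List A) (g : A → B) (f : B → Carrier) → Σ (map g xs) f ≈ Σ xs (f ∘ g)
    Σ-map [] g f = refl
    Σ-map (x ∷ xs) g f = +-congˡ (Σ-map xs g f)

    Σ-concatMap : {A B : Set} (xs : List A) (g : A → List B) (f : B → Carrier) →
      Σ (concatMap g xs) f ≈ Σ xs (λ x → Σ (g x) f)
    Σ-concatMap [] g f = refl
    Σ-concatMap (x ∷ xs) g f = trans (Σ-++ (g x) _ f) (+-congˡ (Σ-concatMap xs g f))

    Σ-filter : {A : Set} {P : A → Set} (P? : Decidable P) (xs : List A) (f : A → Carrier) →
      Σ (filter P? xs) f ≈ Σ xs (λ x → if does (P? x) then f x else 0#)
    Σ-filter P? [] f = refl
    Σ-filter P? (x ∷ xs) f with P? x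
    ... | yes _ = +-congˡ (Σ-filter P? xs f)
    ... | no _ = trans (Σ-filter P? xs f) (sym (+-identityˡ _))

    Σ-↭ : {A : Set} {xs ys : List A} (f : A → Carrier) → xs ↭ ys → Σ xs f ≈ Σ ys f
    Σ-↭ f Perm.refl = refl
    Σ-↭ f (prep x p) = +-congˡ (Σ-↭ f p)
    Σ-↭ f (swap x y p) = trans (x∙yz≈y∙xz _ _ _) (+-congˡ (+-congˡ (Σ-↭ f p)))
    Σ-↭ f (Perm.trans p q) = trans (Σ-↭ f p) (Σ-↭ f q)

-- Linear algebra over ℚ

module LinearAlgebra where
  open FiniteSums
  open import Data.Rational using (ℚ; 0ℚ; 1ℚ; _+_; _*_; -_; 1/_; ≢-nonZero)
  open import Data.List using (zipWith)
  open import Data.List.Membership.Propositional using (_∈_; _∉_)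
  open import Data.List.Relation.Unary.All using (All; []; _∷_)
  open import Data.List.Relation.Unary.AllPairs using ([]; _∷_)
  open import Data.List.Relation.Binary.Sublist.Propositional using ([]; _∷_; _∷ʳ_; minimum) renaming (_⊆_ to _⊑_)
  open import Data.List.Relation.Binary.Permutation.Propositional using (_↭_; ↭-refl; ↭-trans; ↭-sym; prep; swap)
  open import Data.List.Relation.Binary.Permutation.Propositional.Properties using (↭-length; ∈-resp-↭)
  open import Data.Nat.Properties using (suc-injective)
  open import Relation.Binary.PropositionalEquality
  open import Relation.Binary.Definitions using (DecidableEquality)
  open import Tactic.RingSolver using (solve-∀)
  open import Tactic.RingSolver.Core.AlmostCommutativeRing using (AlmostCommutativeRing; fromCommutativeRing)

  open Sum ℚP.+-*-commutativeRing public

  ℚ-ring : AlmostCommutativeRing 0ℓ 0ℓ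
  ℚ-ring = fromCommutativeRing ℚP.+-*-commutativeRing (λ x → dec⇒maybe (0ℚ ℚP.≟ x))

  lc : {P I : Set} → (P → I → ℚ) → List ℚ → List P → I → ℚ
  lc v cs qs i = sumℚ (zipWith (λ c q → c * v q i) cs qs)

  -- Vanishing is demanded only on the coordinates in `is`, so this is stronger than
  -- `LinIndependent`: rows independent on a few monomials are independent as polynomials.
  IndepOn : {P I : Set} → (P → I → ℚ) → List I → List P → Set
  IndepOn v is qs = ∀ cs → length cs ≡ length qs → (∀ {i} → i ∈ is → lc v cs qs i ≡ 0ℚ) → All (_≡ 0ℚ) cs

  *-nonzero : ∀ a b → b ≢ 0ℚ → a * b ≡ 0ℚ → a ≡ 0ℚ
  *-nonzero a b b≢0 ab≡0 = begin
    a ≡⟨ ℚP.*-identityʳ a ⟨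
    a * 1ℚ ≡⟨ cong (a *_) (ℚP.*-inverseʳ b) ⟨
    a * (b * 1/ b) ≡⟨ ℚP.*-assoc a b _ ⟨
    (a * b) * 1/ b ≡⟨ cong (_* 1/ b) ab≡0 ⟩
    0ℚ * 1/ b ≡⟨ ℚP.*-zeroˡ (1/ b) ⟩
    0ℚ ∎
    where
    open ≡-Reasoning
    instance _ = ≢-nonZero b≢0

  pivot? : {I : Set} (f : I → ℚ) (is : List I) →
    (∀ {i} → i ∈ is → f i ≡ 0ℚ) ⊎ (∃₂ λ i is′ → is ↭ (i ∷ is′) × f i ≢ 0ℚ)
  pivot? f [] = inj₁ λ ()
  pivot? f (i ∷ is) with f i ℚP.≟ 0ℚ
  ... | no fi≢0 = inj₂ (i , is , ↭-refl , fi≢0)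
  ... | yes fi≡0 with pivot? f is
  ...   | inj₁ z = inj₁ λ { (here refl) → fi≡0 ; (there m) → z m }
  ...   | inj₂ (j , is′ , p , fj≢0) = inj₂ (j , i ∷ is′ , ↭-trans (prep i p) (swap i j ↭-refl) , fj≢0)

  KernelVector : {P I : Set} → (P → I → ℚ) → List I → List P → Set
  KernelVector {I = I} v is ps = ∃ λ (φ : I → ℚ) → (∀ {x} → x ∉ is → φ x ≡ 0ℚ) ×
    (∃ λ i → i ∈ is × φ i ≢ 0ℚ) × (∀ {p} → p ∈ ps → Σ is (λ i → φ i * v p i) ≡ 0ℚ)

  FullRank : {P I : Set} → (P → I → ℚ) → List I → List P → Set
  FullRank v is ps = ∃ λ qs → qs ⊑ ps × length qs ≡ length is × IndepOn v is qs

  module _ {P I : Set} (_≟_ : DecidableEquality I) where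

    update : (I → ℚ) → I → ℚ → I → ℚ
    update φ i s x with x ≟ i
    ... | yes _ = s
    ... | no _ = φ x

    update-same : ∀ φ i s → update φ i s i ≡ s
    update-same φ i s with i ≟ i
    ... | yes _ = refl
    ... | no i≢i = ⊥-elim (i≢i refl)

    update-other : ∀ φ i s {x} → x ≢ i → update φ i s x ≡ φ x
    update-other φ i s {x} x≢i with x ≟ i
    ... | yes x≡i = ⊥-elim (x≢i x≡i)
    ... | no _ = refl

    -- Row reduction with pivot row `p` and pivot column `i`; at use `t` is the inverse of `v p i`,
    -- which makes column `i` of the result zero.
    eliminate : (P → I → ℚ) → I → ℚ → P → P → I → ℚ
    eliminate v i t p q x = v q x + - ((v q i * t) * v p x)

    lc-eliminate : ∀ v i t p cs qs x →
      lc (eliminate v i t p) cs qs x ≡ lc v cs qs x + - ((lc v cs qs i * t) * v p x)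
    lc-eliminate v i t p [] qs x = lemma t (v p x)
      where
      lemma : ∀ a b → 0ℚ ≡ 0ℚ + - ((0ℚ * a) * b)
      lemma = solve-∀ ℚ-ring
    lc-eliminate v i t p (c ∷ cs) [] x = lemma t (v p x)
      where
      lemma : ∀ a b → 0ℚ ≡ 0ℚ + - ((0ℚ * a) * b)
      lemma = solve-∀ ℚ-ring
    lc-eliminate v i t p (c ∷ cs) (q ∷ qs) x =
      trans (cong (c * eliminate v i t p q x +_) (lc-eliminate v i t p cs qs x))
        (lemma c (v q x) (v q i) t (v p x) (lc v cs qs x) (lc v cs qs i))
      where
      lemma : ∀ c a b t d e f →
        c * (a + - ((b * t) * d)) + (e + - ((f * t) * d)) ≡ (c * a + e) + - (((c * b + f) * t) * d)
      lemma = solve-∀ ℚ-ring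

    Unique-resp-↭ : {is js : List I} → is ↭ js → Unique is → Unique js
    Unique-resp-↭ p = PermS.Unique-resp-↭ (setoid I) (Perm.↭⇒↭ₛ p)
      where import Data.List.Relation.Binary.Permutation.Propositional as Perm

    kernel-↭ : ∀ {v : P → I → ℚ} {is js ps} → is ↭ js → KernelVector v js ps → KernelVector v is ps
    kernel-↭ p (φ , off , (i , i∈ , φi≢0) , kills) =
      φ , (λ x∉ → off (x∉ ∘ ∈-resp-↭ (↭-sym p))) , (i , ∈-resp-↭ (↭-sym p) i∈ , φi≢0) ,
      λ {q} q∈ → trans (Σ-↭ _ p) (kills q∈)

    -- Gaussian elimination, one row at a time: a row that vanishes on all columns is dropped;
    -- otherwise its pivot column is cleared in the later rows and removed. A kernel vector of the
    -- smaller system lifts by solving row `p` for the pivot coordinate, and rows whose reductions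
    -- are independent stay independent together with `p`. The dichotomy stands in for the
    -- rank-nullity theorem and is later applied both to a matrix and to a transpose.
    kernel⊎fullRank : (v : P → I → ℚ) (is : List I) → Unique is → (ps : List P) →
      KernelVector v is ps ⊎ FullRank v is ps
    kernel⊎fullRank v [] u ps = inj₂ ([] , minimum ps , refl , λ { [] _ _ → [] })
    kernel⊎fullRank v (i ∷ is) u [] = inj₁ (update (λ _ → 0ℚ) i 1ℚ ,
      (λ {x} x∉ → update-other _ i 1ℚ (λ x≡i → x∉ (here x≡i))) ,
      (i , here refl , λ eq → ℚP.1≢0 (trans (sym (update-same (λ _ → 0ℚ) i 1ℚ)) eq)) , λ ())
    kernel⊎fullRank v is@(_ ∷ _) u (p ∷ ps) with pivot? (v p) is
    ... | inj₁ vp≡0 with kernel⊎fullRank v is u ps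
    ...   | inj₁ (φ , off , nz , kills) = inj₁ (φ , off , nz , λ
      { (here refl) → Σ-0-∈ is (λ {x} x∈ → trans (cong (φ x *_) (vp≡0 x∈)) (ℚP.*-zeroʳ (φ x)))
      ; (there q∈) → kills q∈ })
    ...   | inj₂ (qs , qs⊑ , len , ind) = inj₂ (qs , p ∷ʳ qs⊑ , len , ind)
    kernel⊎fullRank v is@(_ ∷ _) u (p ∷ ps) | inj₂ (i , is′ , is↭ , vpi≢0)
      with Unique-resp-↭ is↭ u
    ... | i∉ ∷ u′ with kernel⊎fullRank (eliminate v i t p) is′ u′ ps
      where
      instance _ = ≢-nonZero vpi≢0
      t = 1/ v p i
    ...   | inj₁ (φ , off , (j , j∈ , φj≢0) , kills) = inj₁ (kernel-↭ is↭
      (φ′ , (λ x∉ → trans (update-other φ i s (x∉ ∘ here)) (off (x∉ ∘ there))) ,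
       (j , there j∈ , λ eq → φj≢0 (trans (sym (same j∈)) eq)) ,
       λ { (here refl) → trans (split p) kills-p ; {q} (there q∈) → trans (split q) (kills-q q (kills q∈)) }))
      where
      instance _ = ≢-nonZero vpi≢0
      t = 1/ v p i
      -- The only value at the pivot for which the lifted vector kills row `p`.
      s = - (t * Σ is′ (λ x → φ x * v p x))
      φ′ = update φ i s
      same : ∀ {x} → x ∈ is′ → φ′ x ≡ φ x
      same x∈ = update-other φ i s (λ x≡i → All.lookup i∉ x∈ (sym x≡i))
      split : ∀ q → Σ (i ∷ is′) (λ x → φ′ x * v q x) ≡ s * v q i + Σ is′ (λ x → φ x * v q x)
      split q = cong₂ _+_ (cong (_* v q i) (update-same φ i s)) (Σ-cong-∈ is′ (λ {x} x∈ → cong (_* v q x) (same x∈)))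
      kills-p : s * v p i + Σ is′ (λ x → φ x * v p x) ≡ 0ℚ
      kills-p = trans (cong (_+ S) (trans (lemma t S (v p i)) (cong (λ z → - (z * S)) (ℚP.*-inverseʳ (v p i)))))
                      (lemma₂ S)
        where
        S = Σ is′ (λ x → φ x * v p x)
        lemma : ∀ t S a → - (t * S) * a ≡ - ((a * t) * S)
        lemma = solve-∀ ℚ-ring
        lemma₂ : ∀ S → - (1ℚ * S) + S ≡ 0ℚ
        lemma₂ = solve-∀ ℚ-ring
      kills-q : ∀ q → Σ is′ (λ x → φ x * eliminate v i t p q x) ≡ 0ℚ → s * v q i + Σ is′ (λ x → φ x * v q x) ≡ 0ℚ
      kills-q q e = trans (sym eq) e
        where
        eq : Σ is′ (λ x → φ x * eliminate v i t p q x) ≡ s * v q i + Σ is′ (λ x → φ x * v q x)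
        eq = begin
          Σ is′ (λ x → φ x * eliminate v i t p q x)
            ≡⟨ Σ-cong is′ (λ x → lemma (φ x) (v q x) (v q i) t (v p x)) ⟩
          Σ is′ (λ x → φ x * v q x + - (v q i * t) * (φ x * v p x))
            ≡⟨ Σ-+ is′ _ _ ⟩
          Σ is′ (λ x → φ x * v q x) + Σ is′ (λ x → - (v q i * t) * (φ x * v p x))
            ≡⟨ cong (Σ is′ (λ x → φ x * v q x) +_) (Σ-*ˡ is′ (- (v q i * t)) (λ x → φ x * v p x)) ⟩
          Σ is′ (λ x → φ x * v q x) + - (v q i * t) * Σ is′ (λ x → φ x * v p x)
            ≡⟨ lemma₂ (Σ is′ (λ x → φ x * v q x)) (v q i) t _ ⟩
          s * v q i + Σ is′ (λ x → φ x * v q x) ∎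
          where
          open ≡-Reasoning
          lemma : ∀ a b c t d → a * (b + - ((c * t) * d)) ≡ a * b + - (c * t) * (a * d)
          lemma = solve-∀ ℚ-ring
          lemma₂ : ∀ X a t Y → X + - (a * t) * Y ≡ - (t * Y) * a + X
          lemma₂ = solve-∀ ℚ-ring
    ...   | inj₂ (qs , qs⊑ , len , ind) = inj₂ (p ∷ qs , refl ∷ qs⊑ , trans (cong suc len) (sym (↭-length is↭)) , indep)
      where
      instance _ = ≢-nonZero vpi≢0
      t = 1/ v p i
      indep : IndepOn v is (p ∷ qs)
      indep (c ∷ cs) cs-len z = c≡0 ∷ cs≡0
        where
        L = lc v cs qs i
        zi : c * v p i + L ≡ 0ℚ
        zi = z (∈-resp-↭ (↭-sym is↭) (here refl))
        elim-zero : ∀ {x} → x ∈ is′ → lc (eliminate v i t p) cs qs x ≡ 0ℚ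
        elim-zero {x} x∈ = begin
          lc (eliminate v i t p) cs qs x ≡⟨ lc-eliminate v i t p cs qs x ⟩
          -- Adding and subtracting `c` times row `p` exposes the two vanishing combinations at `x`
          -- and at `i`; the remainder has the factor `v p i * t + - 1ℚ`.
          X + - ((L * t) * v p x) ≡⟨ lemma X L t (v p x) c (v p i) ⟩
          (c * v p x + X) + - ((c * v p i + L) * t * v p x) + c * v p x * (v p i * t + - 1ℚ)
            ≡⟨ cong₂ _+_ (cong₂ (λ a b → a + - (b * t * v p x)) (z (∈-resp-↭ (↭-sym is↭) (there x∈))) zi)
                 (cong (λ a → c * v p x * (a + - 1ℚ)) (ℚP.*-inverseʳ (v p i))) ⟩
          0ℚ + - (0ℚ * t * v p x) + c * v p x * (1ℚ + - 1ℚ) ≡⟨ lemma₂ t (v p x) c ⟩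
          0ℚ ∎
          where
          open ≡-Reasoning
          X = lc v cs qs x
          lemma : ∀ X L t a c b → X + - ((L * t) * a) ≡ (c * a + X) + - ((c * b + L) * t * a) + c * a * (b * t + - 1ℚ)
          lemma = solve-∀ ℚ-ring
          lemma₂ : ∀ t a c → 0ℚ + - (0ℚ * t * a) + c * a * (1ℚ + - 1ℚ) ≡ 0ℚ
          lemma₂ = solve-∀ ℚ-ring
        cs≡0 : All (_≡ 0ℚ) cs
        cs≡0 = ind cs (suc-injective cs-len) elim-zero
        lc-zero : ∀ ds rs → All (_≡ 0ℚ) ds → lc v ds rs i ≡ 0ℚ
        lc-zero [] rs _ = refl
        lc-zero (d ∷ ds) [] _ = refl
        lc-zero (d ∷ ds) (r ∷ rs) (refl ∷ zs) = cong₂ _+_ (ℚP.*-zeroˡ (v r i)) (lc-zero ds rs zs)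
        c≡0 : c ≡ 0ℚ
        c≡0 = *-nonzero c (v p i) vpi≢0 (trans (sym (ℚP.+-identityʳ _)) (trans (cong (c * v p i +_) (sym (lc-zero cs qs cs≡0))) zi))

-- Power series over ℤ

module PowerSeries where
  open import Data.Integer using (ℤ; +_; _+_; _*_; -_)
  open import Data.List.Properties using (map-applyUpTo; map-cong)
  open import Relation.Binary.PropositionalEquality
  open import Tactic.RingSolver using (solve-∀)
  open import Data.Integer.Tactic.RingSolver using () renaming (ring to ℤ-ring)
  open FiniteSums

  module ℤΣ = Sum ℤP.+-*-commutativeRing

  infix 4 _≈_
  _≈_ : PS → PS → Set
  a ≈ b = ∀ d → a d ≡ b d

  tail : PS → PS
  tail a d = a (suc d)

  map-upTo-suc : {A : Set} (f : ℕ → A) (d : ℕ) → map f (upTo (suc d)) ≡ f 0 ∷ map (f ∘ suc) (upTo d)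
  map-upTo-suc f d = cong (f 0 ∷_) (trans (map-applyUpTo suc f d) (sym (map-applyUpTo id (f ∘ suc) d)))

  *-zero : ∀ a b → (a *ₚ b) 0 ≡ a 0 * b 0
  *-zero a b = ℤP.+-identityʳ _

  -- Peeling the constant term off the left factor turns the ring laws into inductions on the
  -- degree, with `tail a` in place of `a`.
  *-suc : ∀ a b d → (a *ₚ b) (suc d) ≡ a 0 * b (suc d) + (tail a *ₚ b) d
  *-suc a b d = cong sumℤ (map-upTo-suc (λ i → a i * b (suc d ∸ i)) (suc d))

  *ₚ-cong : ∀ {a a′ b b′} → a ≈ a′ → b ≈ b′ → a *ₚ b ≈ a′ *ₚ b′
  *ₚ-cong p q d = cong sumℤ (map-cong (λ i → cong₂ _*_ (p i) (q (d ∸ i))) (upTo (suc d)))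

  infixl 6 _+ₚ_
  _+ₚ_ : PS → PS → PS
  (a +ₚ b) d = a d + b d

  -ₚ_ : PS → PS
  (-ₚ a) d = - a d

  0ₚ 1ₚ : PS
  0ₚ _ = + 0
  1ₚ = constPS (+ 1)

  *ₚ-distribʳ : ∀ c a b → (a +ₚ b) *ₚ c ≈ (a *ₚ c) +ₚ (b *ₚ c)
  *ₚ-distribʳ c a b zero = lemma (a 0) (b 0) (c 0)
    where
    lemma : ∀ x y z → (x + y) * z + + 0 ≡ (x * z + + 0) + (y * z + + 0)
    lemma = solve-∀ ℤ-ring
  *ₚ-distribʳ c a b (suc d) = begin
    ((a +ₚ b) *ₚ c) (suc d) ≡⟨ *-suc (a +ₚ b) c d ⟩
    (a 0 + b 0) * c (suc d) + ((tail a +ₚ tail b) *ₚ c) d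
      ≡⟨ cong (λ x → (a 0 + b 0) * c (suc d) + x) (*ₚ-distribʳ c (tail a) (tail b) d) ⟩
    (a 0 + b 0) * c (suc d) + ((tail a *ₚ c) d + (tail b *ₚ c) d)
      ≡⟨ lemma (a 0) (b 0) (c (suc d)) ((tail a *ₚ c) d) ((tail b *ₚ c) d) ⟩
    (a 0 * c (suc d) + (tail a *ₚ c) d) + (b 0 * c (suc d) + (tail b *ₚ c) d)
      ≡⟨ cong₂ _+_ (*-suc a c d) (*-suc b c d) ⟨
    (a *ₚ c) (suc d) + (b *ₚ c) (suc d) ∎
    where
    open ≡-Reasoning
    lemma : ∀ x y z u v → (x + y) * z + (u + v) ≡ (x * z + u) + (y * z + v)
    lemma = solve-∀ ℤ-ring

  scale : ℤ → PS → PS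
  scale k a d = k * a d

  scale-*ₚ : ∀ k a b → scale k a *ₚ b ≈ scale k (a *ₚ b)
  scale-*ₚ k a b d = trans (ℤΣ.Σ-cong (upTo (suc d)) (λ i → ℤP.*-assoc k (a i) (b (d ∸ i))))
    (ℤΣ.Σ-*ˡ (upTo (suc d)) k (λ i → a i * b (d ∸ i)))

  *ₚ-assoc : ∀ a b c → (a *ₚ b) *ₚ c ≈ a *ₚ (b *ₚ c)
  *ₚ-assoc a b c zero = lemma (a 0) (b 0) (c 0)
    where
    lemma : ∀ x y z → (x * y + + 0) * z + + 0 ≡ x * (y * z + + 0) + + 0
    lemma = solve-∀ ℤ-ring
  *ₚ-assoc a b c (suc d) = begin
    ((a *ₚ b) *ₚ c) (suc d) ≡⟨ *-suc (a *ₚ b) c d ⟩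
    (a *ₚ b) 0 * c (suc d) + (tail (a *ₚ b) *ₚ c) d
      ≡⟨ cong₂ (λ x y → x * c (suc d) + y) (*-zero a b) (*ₚ-cong {b = c} (*-suc a b) (λ _ → refl) d) ⟩
    a 0 * b 0 * c (suc d) + ((scale (a 0) (tail b) +ₚ (tail a *ₚ b)) *ₚ c) d
      ≡⟨ cong (λ x → a 0 * b 0 * c (suc d) + x) (*ₚ-distribʳ c (scale (a 0) (tail b)) (tail a *ₚ b) d) ⟩
    a 0 * b 0 * c (suc d) + ((scale (a 0) (tail b) *ₚ c) d + ((tail a *ₚ b) *ₚ c) d)
      ≡⟨ cong₂ (λ x y → a 0 * b 0 * c (suc d) + (x + y)) (scale-*ₚ (a 0) (tail b) c d) (*ₚ-assoc (tail a) b c d) ⟩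
    a 0 * b 0 * c (suc d) + (a 0 * (tail b *ₚ c) d + (tail a *ₚ (b *ₚ c)) d)
      ≡⟨ lemma (a 0) (b 0) (c (suc d)) ((tail b *ₚ c) d) ((tail a *ₚ (b *ₚ c)) d) ⟩
    a 0 * (b 0 * c (suc d) + (tail b *ₚ c) d) + (tail a *ₚ (b *ₚ c)) d
      ≡⟨ cong (λ x → a 0 * x + (tail a *ₚ (b *ₚ c)) d) (*-suc b c d) ⟨
    a 0 * (b *ₚ c) (suc d) + (tail a *ₚ (b *ₚ c)) d
      ≡⟨ *-suc a (b *ₚ c) d ⟨
    (a *ₚ (b *ₚ c)) (suc d) ∎
    where
    open ≡-Reasoning
    lemma : ∀ x y z u v → x * y * z + (x * u + v) ≡ x * (y * z + u) + v
    lemma = solve-∀ ℤ-ring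

  *-sucʳ : ∀ a b d → (a *ₚ b) (suc d) ≡ a (suc d) * b 0 + (a *ₚ tail b) d
  *-sucʳ a b zero = lemma (a 0 * b 1) (a 1 * b 0)
    where
    lemma : ∀ x y → x + (y + + 0) ≡ y + (x + + 0)
    lemma = solve-∀ ℤ-ring
  *-sucʳ a b (suc d) = begin
    (a *ₚ b) (suc (suc d)) ≡⟨ *-suc a b (suc d) ⟩
    x + (tail a *ₚ b) (suc d) ≡⟨ cong (λ z → x + z) (*-sucʳ (tail a) b d) ⟩
    x + (y + (tail a *ₚ tail b) d) ≡⟨ lemma x y ((tail a *ₚ tail b) d) ⟩
    y + (x + (tail a *ₚ tail b) d) ≡⟨ cong (λ z → y + z) (*-suc a (tail b) d) ⟨
    y + (a *ₚ tail b) (suc d) ∎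
    where
    open ≡-Reasoning
    x = a 0 * b (suc (suc d))
    y = a (suc (suc d)) * b 0
    lemma : ∀ x y z → x + (y + z) ≡ y + (x + z)
    lemma = solve-∀ ℤ-ring

  *ₚ-comm : ∀ a b → a *ₚ b ≈ b *ₚ a
  *ₚ-comm a b zero = cong (λ z → z + + 0) (ℤP.*-comm (a 0) (b 0))
  *ₚ-comm a b (suc d) = begin
    (a *ₚ b) (suc d) ≡⟨ *-suc a b d ⟩
    a 0 * b (suc d) + (tail a *ₚ b) d ≡⟨ cong₂ _+_ (ℤP.*-comm (a 0) (b (suc d))) (*ₚ-comm (tail a) b d) ⟩
    b (suc d) * a 0 + (b *ₚ tail a) d ≡⟨ *-sucʳ b a d ⟨
    (b *ₚ a) (suc d) ∎
    where open ≡-Reasoning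

  0ₚ-*ₚ : ∀ b → 0ₚ *ₚ b ≈ 0ₚ
  0ₚ-*ₚ b d = ℤΣ.Σ-0-∈ (upTo (suc d)) (λ {i} _ → ℤP.*-zeroˡ (b (d ∸ i)))

  1ₚ-*ₚ : ∀ b → 1ₚ *ₚ b ≈ b
  1ₚ-*ₚ b zero = trans (ℤP.+-identityʳ _) (ℤP.*-identityˡ (b 0))
  1ₚ-*ₚ b (suc d) = trans (*-suc 1ₚ b d)
    (trans (cong₂ _+_ (ℤP.*-identityˡ (b (suc d))) (0ₚ-*ₚ b d)) (ℤP.+-identityʳ _))

  PS-ring : CommutativeRing 0ℓ 0ℓ
  PS-ring = record
    { Carrier = PS ; _≈_ = _≈_ ; _+_ = _+ₚ_ ; _*_ = _*ₚ_ ; -_ = -ₚ_ ; 0# = 0ₚ ; 1# = 1ₚ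
    ; isCommutativeRing = record
      { isRing = record
        { +-isAbelianGroup = record
          { isGroup = record
            { isMonoid = record
              { isSemigroup = record
                { isMagma = record
                  { isEquivalence = record
                    { refl = λ _ → refl ; sym = λ p d → sym (p d) ; trans = λ p q d → trans (p d) (q d) }
                  ; ∙-cong = λ p q d → cong₂ _+_ (p d) (q d) }
                ; assoc = λ a b c d → ℤP.+-assoc (a d) (b d) (c d) }
              ; identity = (λ a d → ℤP.+-identityˡ (a d)) , (λ a d → ℤP.+-identityʳ (a d)) }
            ; inverse = (λ a d → ℤP.+-inverseˡ (a d)) , (λ a d → ℤP.+-inverseʳ (a d))
            ; ⁻¹-cong = λ p d → cong -_ (p d) }
          ; comm = λ a b d → ℤP.+-comm (a d) (b d) }
        ; *-cong = *ₚ-cong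
        ; *-assoc = *ₚ-assoc
        ; *-identity = 1ₚ-*ₚ , λ a d → trans (*ₚ-comm a 1ₚ d) (1ₚ-*ₚ a d)
        ; distrib = (λ a b c d → trans (*ₚ-comm a (b +ₚ c) d) (trans (*ₚ-distribʳ a b c d)
                       (cong₂ _+_ (*ₚ-comm b a d) (*ₚ-comm c a d))))
                    , *ₚ-distribʳ }
      ; *-comm = *ₚ-comm } }

-- Flats and building sets

module LatticeOfFlats where
  open import Data.Nat using (_+_)
  open import Data.Fin.Subset using (⊤; ⁅_⁆; _∈_; _∉_)
  open import Data.Fin.Subset.Properties
  open import Data.Vec.Base using (here; there)
  open import Data.List.Membership.Propositional using () renaming (_∈_ to _∈ˡ_)
  open import Data.List.Membership.Propositional.Properties using (∈-filter⁺; ∈-filter⁻; ∈-concatMap⁺)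
  open import Data.List.Relation.Unary.All using (All; []; _∷_)
  open import Data.List.Relation.Unary.AllPairs using (AllPairs; []; _∷_)
  open import Relation.Binary.PropositionalEquality

  ∈-allSubsets : ∀ {n} (A : Subset n) → A ∈ˡ allSubsets n
  ∈-allSubsets V.[] = here refl
  ∈-allSubsets (b V.∷ A) = ∈-concatMap⁺ _ (Any.map (λ { refl → pick b }) (∈-allSubsets A))
    where
    pick : ∀ b → (b V.∷ A) ∈ˡ (false V.∷ A) ∷ (true V.∷ A) ∷ []
    pick false = here refl
    pick true = there (here refl)

  -- Subsets are listed by increasing binary value, so the order refines inclusion.
  allSubsets-sorted : ∀ n → AllPairs (λ A B → ¬ B ⊆ A) (allSubsets n)
  allSubsets-sorted zero = [] ∷ []
  allSubsets-sorted (suc n) = AllPairsP.concat⁺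
    (All.tabulate (λ x∈ → both x∈))
    (AllPairsP.map⁺ (AllPairs.map cross (allSubsets-sorted n)))
    where
    extend : Subset n → List (Subset (suc n))
    extend s = (false V.∷ s) ∷ (true V.∷ s) ∷ []
    both : ∀ {xs} → xs ∈ˡ map extend (allSubsets n) → AllPairs (λ A B → ¬ B ⊆ A) xs
    both = go (allSubsets n)
      where
      go : ∀ L {xs} → xs ∈ˡ map extend L → AllPairs (λ A B → ¬ B ⊆ A) xs
      go (s ∷ L) (here refl) = ((λ sub → true∉ (sub here)) ∷ []) ∷ [] ∷ []
        where
        true∉ : ¬ (zero ∈ (false V.∷ s))
        true∉ ()
      go (s ∷ L) (there m) = go L m
    cross : ∀ {s s′} → ¬ s′ ⊆ s → All (λ x → All (λ y → ¬ y ⊆ x) (extend s′)) (extend s)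
    cross p = ((λ q → p (drop-∷-⊆ q)) ∷ (λ q → p (drop-∷-⊆ q)) ∷ []) ∷ ((λ q → p (drop-∷-⊆ q)) ∷ (λ q → p (drop-∷-⊆ q)) ∷ []) ∷ []

  sorted⇒Unique : ∀ {n} {L : List (Subset n)} → AllPairs (λ A B → ¬ B ⊆ A) L → Unique L
  sorted⇒Unique = AllPairs.map λ { p refl → p id }

  ⊈⇒∃ : ∀ {n} {A B : Subset n} → ¬ A ⊆ B → ∃ λ e → e ∈ A × e ∉ B
  ⊈⇒∃ {A = A} {B} A⊈B with FinP.any? (λ e → (e ∈? A) ×-dec ¬? (e ∈? B))
  ... | yes w = w
  ... | no ¬w = ⊥-elim (A⊈B (λ {x} x∈A → decidable-stable (x ∈? B) (λ x∉B → ¬w (x , x∈A , x∉B))))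

  ∪-least : ∀ {n} {A B C : Subset n} → A ⊆ C → B ⊆ C → A ∪ B ⊆ C
  ∪-least {A = A} {B} p q = [ p , q ]′ ∘ x∈p∪q⁻ A B

  ∩-greatest : ∀ {n} {A B C : Subset n} → C ⊆ A → C ⊆ B → C ⊆ A ∩ B
  ∩-greatest p q x∈ = x∈p∩q⁺ (p x∈ , q x∈)

  ⁅⁆⊆ : ∀ {n} {e} {A : Subset n} → e ∈ A → ⁅ e ⁆ ⊆ A
  ⁅⁆⊆ {e = e} e∈A x∈ with refl ← x∈⁅y⁆⇒x≡y e x∈ = e∈A

  ⋂ : ∀ {n} → List (Subset n) → Subset n
  ⋂ = foldr _∩_ ⊤

  ⋂-lower : ∀ {n} {K : Subset n} {L} → K ∈ˡ L → ⋂ L ⊆ K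
  ⋂-lower {L = K ∷ L} (here refl) = p∩q⊆p K (⋂ L)
  ⋂-lower {L = K ∷ L} (there m) = ⋂-lower m ∘ p∩q⊆q K (⋂ L)

  ⋂-greatest : ∀ {n} {A : Subset n} L → (∀ {K} → K ∈ˡ L → A ⊆ K) → A ⊆ ⋂ L
  ⋂-greatest [] p = ⊆⊤
  ⋂-greatest (K ∷ L) p = ∩-greatest (p (here refl)) (⋂-greatest L (p ∘ there))

  module Flats {n : ℕ} (M : Polymatroid n) where
    open Polymatroid M public

    private
      infixr 6 _∨ᴹ_
      _∨ᴹ_ : Subset n → Subset n → Subset n
      _∨ᴹ_ = _∨_ M
      Flat : Subset n → Set
      Flat = IsFlat M

    ⊤-flat : Flat ⊤
    ⊤-flat e e∉ = ⊥-elim (e∉ ∈⊤)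

    -- Diminishing returns: submodularity for `K` and `A ∪ ⁅ e ⁆`, whose intersection still contains
    -- `A`, makes `e` raise the rank of `A` because it raises that of the larger `K`.
    rk-adjoin-below : ∀ {A K e} → Flat K → e ∉ K → A ⊆ K → rk A < rk (A ∪ ⁅ e ⁆)
    rk-adjoin-below {A} {K} {e} flatK e∉K A⊆K = ℕP.+-cancelˡ-< (rk K) _ _ (begin-strict
      rk K + rk A <⟨ ℕP.+-monoˡ-< (rk A) (flatK e e∉K) ⟩
      rk (K ∪ ⁅ e ⁆) + rk A
        ≤⟨ ℕP.+-mono-≤ (rk-mono (∪-least (p⊆p∪q _) (q⊆p∪q K _ ∘ q⊆p∪q A ⁅ e ⁆)))
                        (rk-mono (∩-greatest A⊆K (p⊆p∪q _))) ⟩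
      rk (K ∪ (A ∪ ⁅ e ⁆)) + rk (K ∩ (A ∪ ⁅ e ⁆)) ≤⟨ rk-submod K (A ∪ ⁅ e ⁆) ⟩
      rk K + rk (A ∪ ⁅ e ⁆) ∎)
      where open ℕP.≤-Reasoning

    ∩-flat : ∀ {F G} → Flat F → Flat G → Flat (F ∩ G)
    ∩-flat {F} {G} flatF flatG e e∉ with e ∈? F
    ... | no e∉F = rk-adjoin-below flatF e∉F (p∩q⊆p F G)
    ... | yes e∈F = rk-adjoin-below flatG (λ e∈G → e∉ (x∈p∩q⁺ (e∈F , e∈G))) (p∩q⊆q F G)

    rk-strict : ∀ {F G} → Flat F → F ⊆ G → ¬ G ⊆ F → rk F < rk G
    rk-strict {F} {G} flatF F⊆G G⊈F with ⊈⇒∃ G⊈F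
    ... | e , e∈G , e∉F = ℕP.<-≤-trans (flatF e e∉F) (rk-mono (∪-least F⊆G (⁅⁆⊆ e∈G)))

    ∈-flats : ∀ {K} → Flat K → K ∈ˡ flats M
    ∈-flats {K} fK = ∈-filter⁺ (isFlat? M) (∈-allSubsets K) fK

    flats-flat : ∀ {K} → K ∈ˡ flats M → Flat K
    flats-flat m = proj₂ (∈-filter⁻ (isFlat? M) {xs = allSubsets n} m)

    ⋂-flat : ∀ L → (∀ {K} → K ∈ˡ L → Flat K) → Flat (⋂ L)
    ⋂-flat [] p = ⊤-flat
    ⋂-flat (K ∷ L) p = ∩-flat (p (here refl)) (⋂-flat L (p ∘ there))

    private
      uppers : Subset n → Subset n → List (Subset n)
      uppers F G = filter (λ K → (F ∪ G) ⊆? K) (flats M)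

    ∨-flat : ∀ F G → Flat (F ∨ᴹ G)
    ∨-flat F G = ⋂-flat (uppers F G) (λ m → flats-flat (proj₁ (∈-filter⁻ (λ K → (F ∪ G) ⊆? K) m)))

    ∨-least : ∀ {F G K} → Flat K → F ⊆ K → G ⊆ K → F ∨ᴹ G ⊆ K
    ∨-least {F} {G} flatK F⊆K G⊆K = ⋂-lower (∈-filter⁺ (λ K → (F ∪ G) ⊆? K) (∈-flats flatK) (∪-least F⊆K G⊆K))

    ∪⊆∨ : ∀ F G → F ∪ G ⊆ F ∨ᴹ G
    ∪⊆∨ F G = ⋂-greatest (uppers F G) (λ {K} m → proj₂ (∈-filter⁻ (λ K → (F ∪ G) ⊆? K) {xs = flats M} m))

    ∨-upperˡ : ∀ F G → F ⊆ F ∨ᴹ G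
    ∨-upperˡ F G = ∪⊆∨ F G ∘ p⊆p∪q G

    ∨-upperʳ : ∀ F G → G ⊆ F ∨ᴹ G
    ∨-upperʳ F G = ∪⊆∨ F G ∘ q⊆p∪q F G

    -- Elements that do not raise the rank are added until none is left. The set grows each time, so
    -- fuel `n` suffices.
    flatHull : ∀ A → ∃ λ K → Flat K × A ⊆ K × rk K ≡ rk A
    flatHull A = go n A (ℕP.m≤n+m n ∣ A ∣)
      where
      go : ∀ k A → n ≤ ∣ A ∣ + k → ∃ λ K → Flat K × A ⊆ K × rk K ≡ rk A
      go k A bound with isFlat? M A
      ... | yes flatA = A , flatA , id , refl
      ... | no ¬flatA with FinP.¬∀⟶∃¬ n _ (λ e → ¬? (e ∈? A) →-dec (rk A ℕP.<? rk (A ∪ ⁅ e ⁆))) ¬flatA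
      ...   | e , ¬p with e ∈? A
      ...     | yes e∈A = ⊥-elim (¬p (λ e∉A → ⊥-elim (e∉A e∈A)))
      ...     | no e∉A with k
      ...       | zero = ⊥-elim (¬flatA (subst Flat (sym (∣p∣≡n⇒p≡⊤ (ℕP.≤-antisym (∣p∣≤n A) (subst (n ≤_) (ℕP.+-identityʳ _) bound)))) ⊤-flat))
      ...       | suc k = let (K , flatK , sub , eq) = go k (A ∪ ⁅ e ⁆) bound′ in
                    K , flatK , sub ∘ p⊆p∪q ⁅ e ⁆ ,
                    trans eq (ℕP.≤-antisym (ℕP.≮⇒≥ (λ lt → ¬p (λ _ → lt))) (rk-mono (p⊆p∪q ⁅ e ⁆)))
        where
        bound′ : n ≤ ∣ A ∪ ⁅ e ⁆ ∣ + k
        bound′ = ℕP.≤-trans bound (subst (_≤ ∣ A ∪ ⁅ e ⁆ ∣ + k) (sym (ℕP.+-suc ∣ A ∣ k))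
          (ℕP.+-monoˡ-≤ k (p⊂q⇒∣p∣<∣q∣ (p⊆p∪q ⁅ e ⁆ , e , q⊆p∪q A ⁅ e ⁆ (x∈⁅x⁆ e) , e∉A))))

    -- The join is the least flat above the union, so it lies between the union and a flat of the
    -- same rank.
    rk-∨ : ∀ F G → rk (F ∨ᴹ G) ≡ rk (F ∪ G)
    rk-∨ F G with flatHull (F ∪ G)
    ... | K , flatK , sub , eq = ℕP.≤-antisym
      (subst (rk (F ∨ᴹ G) ≤_) eq (rk-mono (∨-least flatK (sub ∘ p⊆p∪q G) (sub ∘ q⊆p∪q F G))))
      (rk-mono (∪⊆∨ F G))

    bigJoin-flat : ∀ {b} L → Flat b → Flat (bigJoin M b L)
    bigJoin-flat [] flatb = flatb
    bigJoin-flat (K ∷ L) flatb = ∨-flat K _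

    bigJoin-base : ∀ {b} L → b ⊆ bigJoin M b L
    bigJoin-base [] = id
    bigJoin-base (K ∷ L) = ∨-upperʳ K _ ∘ bigJoin-base L

    bigJoin-upper : ∀ {b L K} → K ∈ˡ L → K ⊆ bigJoin M b L
    bigJoin-upper {L = K ∷ L} (here refl) = ∨-upperˡ K _
    bigJoin-upper {L = K ∷ L} (there m) = ∨-upperʳ K _ ∘ bigJoin-upper m

    bigJoin-least : ∀ {b X} L → Flat X → b ⊆ X → (∀ {K} → K ∈ˡ L → K ⊆ X) → bigJoin M b L ⊆ X
    bigJoin-least [] flatX b⊆X p = b⊆X
    bigJoin-least (K ∷ L) flatX b⊆X p = ∨-least flatX (p (here refl)) (bigJoin-least L flatX b⊆X (p ∘ there))

    interval⁺ : ∀ {F G K} → Flat K → F ⊆ K → K ⊆ G → K ∈ˡ interval M F G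
    interval⁺ {F} {G} flatK F⊆K K⊆G =
      ∈-filter⁺ (λ H → (F ⊆? H) ×-dec (H ⊆? G)) (∈-flats flatK) ((λ {x} → F⊆K {x}) , λ {x} → K⊆G {x})

    interval⁻ : ∀ {F G K} → K ∈ˡ interval M F G → Flat K × F ⊆ K × K ⊆ G
    interval⁻ {F} {G} m =
      let (m′ , F⊆K , K⊆G) = ∈-filter⁻ (λ H → (F ⊆? H) ×-dec (H ⊆? G)) {xs = flats M} m
      in flats-flat m′ , (λ {x} → F⊆K {x}) , λ {x} → K⊆G {x}

    interval-unique : ∀ F G → Unique (interval M F G)
    interval-unique F G = UniqueP.filter⁺ _ (UniqueP.filter⁺ _ (sorted⇒Unique (allSubsets-sorted n)))

-- Factors of a flat, and the induced building sets

module BuildingSets where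
  open LatticeOfFlats
  open import Data.Nat using (_+_)
  open import Data.Nat.ListAction.Properties using (sum-↭)
  open import Data.Fin.Subset using (⊥; _∈_)
  open import Data.Fin.Subset.Properties
  open import Data.List.Membership.Propositional.Properties.WithK using (unique∧set⇒bag)
  open import Data.List.Relation.Binary.BagAndSetEquality using (∼bag⇒↭)
  open import Function.Bundles using (mk⇔)
  open import Data.List.Membership.Propositional using (find; lose) renaming (_∈_ to _∈ˡ_)
  open import Data.List.Membership.Propositional.Properties using (∈-filter⁺; ∈-filter⁻; ∈-∃++; ∈-map⁺; ∈-map⁻)
  open import Data.List.Relation.Unary.All using (All; []; _∷_)
  open import Data.List.Relation.Unary.AllPairs using ([]; _∷_)
  open import Data.List.Relation.Binary.Permutation.Propositional using (_↭_)
  open import Data.List.Relation.Binary.Permutation.Propositional.Properties using (shift; ∈-resp-↭; ↭-length)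
  open import Relation.Binary.PropositionalEquality hiding (J)

  ⊊⇒⊉ : ∀ {n} {A B : Subset n} → A ⊊ B → ¬ B ⊆ A
  ⊊⇒⊉ (A⊆B , A≢B) B⊆A = A≢B (⊆-antisym A⊆B B⊆A)

  ⊊⇒∣<∣ : ∀ {n} {A B : Subset n} → A ⊊ B → ∣ A ∣ < ∣ B ∣
  ⊊⇒∣<∣ p@(A⊆B , _) = p⊂q⇒∣p∣<∣q∣ (A⊆B , ⊈⇒∃ (⊊⇒⊉ p))

  ∈⇒↭ : {A : Set} {x : A} {xs : List A} → x ∈ˡ xs → ∃ λ ys → xs ↭ (x ∷ ys)
  ∈⇒↭ {x = x} m with ∈-∃++ m
  ... | ls , rs , refl = ls ++ rs , shift x ls rs

  module Maximal {n : ℕ} (M : Polymatroid n) where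
    maximal∈ : ∀ {L W} → W ∈ˡ maximals M L → W ∈ˡ L
    maximal∈ {L} m = proj₁ (∈-filter⁻ (λ G → ¬? (any? (G ⊊?_) L)) m)

    maximal-top : ∀ {L W K} → W ∈ˡ maximals M L → K ∈ˡ L → W ⊆ K → W ≡ K
    maximal-top {L} {W} {K} m K∈ W⊆K with W ≟ₛ K
    ... | yes eq = eq
    ... | no W≢K = ⊥-elim (proj₂ (∈-filter⁻ (λ G → ¬? (any? (G ⊊?_) L)) {xs = L} m) (lose K∈ ((λ {x} → W⊆K {x}) , W≢K)))

    maximal⁺ : ∀ {L W} → W ∈ˡ L → (∀ {K} → K ∈ˡ L → W ⊆ K → W ≡ K) → W ∈ˡ maximals M L
    maximal⁺ {L} W∈ p = ∈-filter⁺ (λ G → ¬? (any? (G ⊊?_) L)) W∈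
      (λ a → let (K , K∈ , W⊆K , W≢K) = find a in W≢K (p K∈ W⊆K))

    maximal-above : ∀ L {K} → K ∈ˡ L → ∃ λ W → W ∈ˡ maximals M L × K ⊆ W
    maximal-above L {K} K∈ = go n K K∈ (ℕP.m≤n+m n ∣ K ∣)
      where
      go : ∀ k K → K ∈ˡ L → n ≤ ∣ K ∣ + k → ∃ λ W → W ∈ˡ maximals M L × K ⊆ W
      go k K K∈ bound with any? (K ⊊?_) L
      ... | no none = K , ∈-filter⁺ (λ G → ¬? (any? (G ⊊?_) L)) K∈ none , id
      ... | yes a with find a
      ...   | K′ , K′∈ , K⊊K′ with k
      ...     | zero = ⊥-elim (ℕP.<-irrefl refl (ℕP.<-≤-trans (⊊⇒∣<∣ K⊊K′)
                  (ℕP.≤-trans (∣p∣≤n K′) (subst (n ≤_) (ℕP.+-identityʳ _) bound))))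
      ...     | suc k = let (W , W∈ , K′⊆W) = go k K′ K′∈ bound′ in W , W∈ , K′⊆W ∘ proj₁ K⊊K′
        where
        bound′ : n ≤ ∣ K′ ∣ + k
        bound′ = ℕP.≤-trans bound (subst (_≤ ∣ K′ ∣ + k) (sym (ℕP.+-suc ∣ K ∣ k)) (ℕP.+-monoˡ-≤ k (⊊⇒∣<∣ K⊊K′)))

  sumOf : {A : Set} → (A → ℕ) → List A → ℕ
  sumOf f L = foldr _+_ 0 (map f L)

  sumOf-↭ : {A : Set} (f : A → ℕ) {xs ys : List A} → xs ↭ ys → sumOf f xs ≡ sumOf f ys
  sumOf-↭ f p = sum-↭ (PermP.map⁺ f p)

  module Building {n : ℕ} (M : Polymatroid n) (loopless : Loopless M)
                  (𝒢 : Subset n → Bool) (building : IsBuildingSet M 𝒢) where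
    open Flats M public
    open Maximal M public
    open IsBuildingSet building public

    private
      infixr 6 _∨ᴹ_
      _∨ᴹ_ : Subset n → Subset n → Subset n
      _∨ᴹ_ = _∨_ M
      Flat : Subset n → Set
      Flat = IsFlat M

    -- These index the product decomposition of [∅, G].
    factors : Subset n → List (Subset n)
    factors G = maximals M (𝒢≤ M 𝒢 G)

    factors-unique : ∀ G → Unique (factors G)
    factors-unique G = sorted⇒Unique (AllPairsP.filter⁺ _ (AllPairsP.filter⁺ _ (allSubsets-sorted n)))

    𝒢≤⁻ : ∀ {G K} → K ∈ˡ 𝒢≤ M 𝒢 G → T (𝒢 K) × K ⊆ G
    𝒢≤⁻ {G} m = proj₂ (∈-filter⁻ (λ K → T? (𝒢 K) ×-dec (K ⊆? G)) {xs = allSubsets n} m)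

    𝒢≤⁺ : ∀ {G K} → T (𝒢 K) → K ⊆ G → K ∈ˡ 𝒢≤ M 𝒢 G
    𝒢≤⁺ {G} {K} K∈ K⊆G = ∈-filter⁺ (λ K → T? (𝒢 K) ×-dec (K ⊆? G)) (∈-allSubsets K) (K∈ , λ {x} → K⊆G {x})

    factor-𝒢 : ∀ {G W} → W ∈ˡ factors G → T (𝒢 W)
    factor-𝒢 m = proj₁ (𝒢≤⁻ (maximal∈ m))

    factor-⊆ : ∀ {G W} → W ∈ˡ factors G → W ⊆ G
    factor-⊆ {G} {W} m = proj₂ (𝒢≤⁻ {G} {W} (maximal∈ m))

    factor-flat : ∀ {G W} → W ∈ˡ factors G → Flat W
    factor-flat m = members-flat _ (factor-𝒢 m)

    factor-above : ∀ {G K} → T (𝒢 K) → K ⊆ G → ∃ λ W → W ∈ˡ factors G × K ⊆ W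
    factor-above {G} K∈ K⊆G = maximal-above (𝒢≤ M 𝒢 G) (𝒢≤⁺ K∈ K⊆G)

    others : Subset n → Subset n → Subset n
    others G W = bigJoin M ⊥ (filter (λ W′ → ¬? (W′ ≟ₛ W)) (factors G))

    others-upper : ∀ {G W W′} → W′ ∈ˡ factors G → W′ ≢ W → W′ ⊆ others G W
    others-upper {G} {W} m W′≢W = bigJoin-upper (∈-filter⁺ (λ W′ → ¬? (W′ ≟ₛ W)) m W′≢W)

    -- The tuple is a preimage of `Y` under the join map; its entries are below `Y` because they
    -- take part in the join.
    decompose : ∀ {F Y} → Flat F → Flat Y → Y ⊆ F → ∃ λ s →
      joinTuple M (factors F) s ≡ Y ×
      (∀ {W} → W ∈ˡ factors F → Flat (s W) × s W ⊆ W × s W ⊆ Y)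
    decompose {F} {Y} flatF flatY Y⊆F with join-surj F flatF Y flatY Y⊆F
    ... | s , valid , eq = s , eq , λ {W} m →
      proj₁ (All.lookup valid m) , proj₂ (All.lookup valid m) ,
      λ {x} → subst (s W ⊆_) eq (bigJoin-upper (∈-map⁺ s m)) {x}

    choose : Subset n → Subset n → (Subset n → Subset n) → Subset n → Subset n
    choose W X f W′ with W′ ≟ₛ W
    ... | yes _ = X
    ... | no _ = f W′

    choose-same : ∀ W X f → choose W X f W ≡ X
    choose-same W X f with W ≟ₛ W
    ... | yes _ = refl
    ... | no W≢W = ⊥-elim (W≢W refl)

    -- Components of a join in the product decomposition: compare X ∈ [∅,W] with the tuple
    -- whose entry at W is Y ∩ W and which is full elsewhere.
    factor-independent : ∀ {G W X Y} → Flat G → W ∈ˡ factors G → Flat X → X ⊆ W → Flat Y → Y ⊆ G →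
      X ⊆ Y ∨ᴹ others G W → X ⊆ Y
    factor-independent {G} {W} {X} {Y} flatG W∈ flatX X⊆W flatY Y⊆G X⊆ =
      p∩q⊆p Y W ∘ subst₂ _⊆_ (choose-same W X _) (choose-same W (Y ∩ W) id)
        (All.lookup (proj₁ (join-order G flatG t′ t valid′ valid) t′⊆t) W∈)
      where
      ms = factors G
      t t′ : Subset n → Subset n
      t = choose W (Y ∩ W) id
      t′ = choose W X (λ _ → ⊥)
      valid : ValidTuple M ms t
      valid = All.tabulate λ {W′} m → go W′ m
        where
        go : ∀ W′ → W′ ∈ˡ ms → Flat (t W′) × t W′ ⊆ W′
        go W′ m with W′ ≟ₛ W
        ... | yes refl = ∩-flat flatY (factor-flat m) , p∩q⊆q Y W
        ... | no _ = factor-flat m , id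
      valid′ : ValidTuple M ms t′
      valid′ = All.tabulate λ {W′} m → go W′ m
        where
        go : ∀ W′ → W′ ∈ˡ ms → Flat (t′ W′) × t′ W′ ⊆ W′
        go W′ m with W′ ≟ₛ W
        ... | yes refl = flatX , X⊆W
        ... | no _ = loopless , ⊥⊆
      flat-join : Flat (joinTuple M ms t)
      flat-join = bigJoin-flat (map t ms) loopless
      t-upper : ∀ {W′} → W′ ∈ˡ ms → t W′ ⊆ joinTuple M ms t
      t-upper m = bigJoin-upper (∈-map⁺ t m)
      -- The component of `Y` at `W` lies in `Y ∩ W`; every other component lies in its factor,
      -- where `t` is full.
      Y⊆ : Y ⊆ joinTuple M ms t
      Y⊆ with decompose flatG flatY Y⊆G
      ... | s , eq , below = subst (_⊆ joinTuple M ms t) eq (bigJoin-least (map s ms) flat-join ⊥⊆ part)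
        where
        part : ∀ {K} → K ∈ˡ map s ms → K ⊆ joinTuple M ms t
        part {K} m with ∈-map⁻ s m
        ... | W′ , W′∈ , refl = t-upper W′∈ ∘ go W′ W′∈
          where
          go : ∀ W′ → W′ ∈ˡ ms → s W′ ⊆ t W′
          go W′ m with W′ ≟ₛ W
          ... | yes refl = ∩-greatest (proj₂ (proj₂ (below m))) (proj₁ (proj₂ (below m)))
          ... | no _ = proj₁ (proj₂ (below m))
      V⊆ : others G W ⊆ joinTuple M ms t
      V⊆ = bigJoin-least (filter (λ W′ → ¬? (W′ ≟ₛ W)) ms) flat-join ⊥⊆ part
        where
        part : ∀ {K} → K ∈ˡ filter (λ W′ → ¬? (W′ ≟ₛ W)) ms → K ⊆ joinTuple M ms t
        part {K} m = let (K∈ , K≢W) = ∈-filter⁻ (λ W′ → ¬? (W′ ≟ₛ W)) {xs = ms} m in t-upper K∈ ∘ go K K≢W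
          where
          go : ∀ K → K ≢ W → K ⊆ t K
          go K K≢W with K ≟ₛ W
          ... | yes K≡W = ⊥-elim (K≢W K≡W)
          ... | no _ = id
      t′⊆t : joinTuple M ms t′ ⊆ joinTuple M ms t
      t′⊆t = bigJoin-least (map t′ ms) flat-join ⊥⊆ part
        where
        part : ∀ {K} → K ∈ˡ map t′ ms → K ⊆ joinTuple M ms t
        part {K} m with ∈-map⁻ t′ m
        ... | W′ , W′∈ , refl = go W′
          where
          go : ∀ W′ → t′ W′ ⊆ joinTuple M ms t
          go W′ with W′ ≟ₛ W
          ... | yes _ = ∨-least flat-join Y⊆ V⊆ ∘ X⊆
          ... | no _ = ⊥⊆

    rk-bigJoin-≤ : ∀ L → rk (bigJoin M ⊥ L) ≤ sumOf rk L
    rk-bigJoin-≤ [] = ℕP.≤-reflexive rk-⊥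
    rk-bigJoin-≤ (K ∷ L) = begin
      rk (K ∨ᴹ bigJoin M ⊥ L) ≡⟨ rk-∨ K _ ⟩
      rk (K ∪ bigJoin M ⊥ L) ≤⟨ ℕP.m+n≤o⇒m≤o _ (rk-submod K (bigJoin M ⊥ L)) ⟩
      rk K + rk (bigJoin M ⊥ L) ≤⟨ ℕP.+-monoʳ-≤ (rk K) (rk-bigJoin-≤ L) ⟩
      rk K + sumOf rk L ∎
      where open ℕP.≤-Reasoning

    -- By submodularity, adjoining `W` to a set that contains `J` raises the rank by at most rk W -
    -- rk (J ∩ W); these costs add up along the list.
    rk-bigJoin-meets : ∀ {J X} → J ⊆ X → ∀ L → rk (bigJoin M X L) + sumOf (λ W → rk (J ∩ W)) L ≤ rk X + sumOf rk L
    rk-bigJoin-meets J⊆X [] = ℕP.≤-refl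
    rk-bigJoin-meets {J} {X} J⊆X (W ∷ L) = begin
      rk (W ∨ᴹ Y) + (rk (J ∩ W) + S) ≡⟨ cong (_+ (rk (J ∩ W) + S)) (rk-∨ W Y) ⟩
      rk (W ∪ Y) + (rk (J ∩ W) + S) ≡⟨ ℕP.+-assoc (rk (W ∪ Y)) _ S ⟨
      rk (W ∪ Y) + rk (J ∩ W) + S
        ≤⟨ ℕP.+-monoˡ-≤ S (ℕP.+-monoʳ-≤ (rk (W ∪ Y)) (rk-mono (∩-greatest (p∩q⊆q J W) (bigJoin-base L ∘ J⊆X ∘ p∩q⊆p J W)))) ⟩
      rk (W ∪ Y) + rk (W ∩ Y) + S ≤⟨ ℕP.+-monoˡ-≤ S (rk-submod W Y) ⟩
      rk W + rk Y + S ≡⟨ ℕP.+-assoc (rk W) (rk Y) S ⟩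
      rk W + (rk Y + S) ≤⟨ ℕP.+-monoʳ-≤ (rk W) (rk-bigJoin-meets J⊆X L) ⟩
      rk W + (rk X + sumOf rk L) ≡⟨ ℕP.+-assoc (rk W) (rk X) _ ⟨
      rk W + rk X + sumOf rk L ≡⟨ cong (_+ sumOf rk L) (ℕP.+-comm (rk W) (rk X)) ⟩
      rk X + rk W + sumOf rk L ≡⟨ ℕP.+-assoc (rk X) (rk W) _ ⟩
      rk X + (rk W + sumOf rk L) ∎
      where
      open ℕP.≤-Reasoning
      Y = bigJoin M X L
      S = sumOf (λ W → rk (J ∩ W)) L

    sumOf-mono : {A : Set} {f g : A → ℕ} (L : List A) → (∀ {x} → x ∈ˡ L → f x ≤ g x) → sumOf f L ≤ sumOf g L
    sumOf-mono [] p = ℕ.z≤n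
    sumOf-mono (x ∷ L) p = ℕP.+-mono-≤ (p (here refl)) (sumOf-mono L (p ∘ there))

    map-sumOf : {A : Set} (f : A → Subset n) (L : List A) → sumOf rk (map f L) ≡ sumOf (rk ∘ f) L
    map-sumOf f [] = refl
    map-sumOf f (x ∷ L) = cong (rk (f x) +_) (map-sumOf f L)

    -- Adjoining the factors of G to J ∪ W one at a time bounds rk G from above, while rk G is
    -- exactly the sum of the ranks of the factors.
    rk-modular : ∀ {G W J} → Flat G → W ∈ˡ factors G → Flat J → J ⊆ G →
      rk (J ∨ᴹ W) + rk (J ∩ W) ≡ rk J + rk W
    rk-modular {G} {W} {J} flatG W∈ flatJ J⊆G = ℕP.≤-antisym
      (subst (λ r → r + rk (J ∩ W) ≤ rk J + rk W) (sym (rk-∨ J W)) (rk-submod J W))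
      (ℕP.+-cancelʳ-≤ (sumOf meets rest) _ _ (begin
        rk J + rk W + sumOf meets rest ≡⟨ ℕP.+-assoc (rk J) (rk W) _ ⟩
        rk J + (rk W + sumOf meets rest) ≤⟨ ℕP.+-mono-≤ below-meets above ⟩
        rk (J ∩ W) + sumOf meets rest + rk (J ∨ᴹ W) ≡⟨ ℕP.+-comm _ (rk (J ∨ᴹ W)) ⟩
        rk (J ∨ᴹ W) + (rk (J ∩ W) + sumOf meets rest) ≡⟨ ℕP.+-assoc (rk (J ∨ᴹ W)) _ _ ⟨
        rk (J ∨ᴹ W) + rk (J ∩ W) + sumOf meets rest ∎))
      where
      open ℕP.≤-Reasoning
      meets : Subset n → ℕ
      meets K = rk (J ∩ K)
      rest = proj₁ (∈⇒↭ W∈)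
      factors↭ = proj₂ (∈⇒↭ W∈)
      rk-G : rk G ≡ rk W + sumOf rk rest
      rk-G = trans (rank-sum G flatG) (sumOf-↭ rk factors↭)
      G⊆ : G ⊆ bigJoin M (J ∨ᴹ W) rest
      G⊆ with decompose flatG flatG id
      ... | s , eq , below = subst (_⊆ bigJoin M (J ∨ᴹ W) rest) eq
          (bigJoin-least (map s (factors G)) (bigJoin-flat rest (∨-flat J W)) ⊥⊆ part)
        where
        part : ∀ {K} → K ∈ˡ map s (factors G) → K ⊆ bigJoin M (J ∨ᴹ W) rest
        part m with ∈-map⁻ s m
        ... | W′ , W′∈ , refl with ∈-resp-↭ factors↭ W′∈
        ...   | here refl = bigJoin-base rest ∘ ∨-upperʳ J W ∘ proj₁ (proj₂ (below W′∈))
        ...   | there m′ = bigJoin-upper m′ ∘ proj₁ (proj₂ (below W′∈))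
      -- Adding the other factors to `J ∨ᴹ W` reaches all of `G`, whose rank is the full sum of the
      -- factor ranks; so `J ∨ᴹ W` must already have this much rank.
      above : rk W + sumOf meets rest ≤ rk (J ∨ᴹ W)
      above = ℕP.+-cancelˡ-≤ (sumOf rk rest) _ _ (begin
        sumOf rk rest + (rk W + sumOf meets rest) ≡⟨ ℕP.+-assoc (sumOf rk rest) (rk W) _ ⟨
        sumOf rk rest + rk W + sumOf meets rest ≡⟨ cong (_+ sumOf meets rest) (trans (ℕP.+-comm (sumOf rk rest) (rk W)) (sym rk-G)) ⟩
        rk G + sumOf meets rest ≤⟨ ℕP.+-monoˡ-≤ _ (rk-mono G⊆) ⟩
        rk (bigJoin M (J ∨ᴹ W) rest) + sumOf meets rest ≤⟨ rk-bigJoin-meets (∨-upperˡ J W) rest ⟩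
        rk (J ∨ᴹ W) + sumOf rk rest ≡⟨ ℕP.+-comm (rk (J ∨ᴹ W)) _ ⟩
        sumOf rk rest + rk (J ∨ᴹ W) ∎)
      -- Subadditivity along the decomposition of `J`, whose components lie in the intersections of
      -- `J` with the factors.
      below-meets : rk J ≤ rk (J ∩ W) + sumOf meets rest
      below-meets with decompose flatG flatJ J⊆G
      ... | s , eq , below = begin
        rk J ≡⟨ cong rk eq ⟨
        rk (bigJoin M ⊥ (map s (factors G))) ≤⟨ rk-bigJoin-≤ (map s (factors G)) ⟩
        sumOf rk (map s (factors G)) ≡⟨ map-sumOf s (factors G) ⟩
        sumOf (rk ∘ s) (factors G) ≤⟨ sumOf-mono (factors G) (λ {K} m → rk-mono (∩-greatest (proj₂ (proj₂ (below m))) (proj₁ (proj₂ (below m))))) ⟩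
        sumOf meets (factors G) ≡⟨ sumOf-↭ meets factors↭ ⟩
        rk (J ∩ W) + sumOf meets rest ∎

    record Induced (F G K : Subset n) : Set where
      field
        source : Subset n
        source-𝒢 : T (𝒢 source)
        source⊆ : source ⊆ G
        source⊈ : ¬ source ⊆ F
        source-∨ : source ∨ᴹ F ≡ K

    induced⁻ : ∀ {F G K} → K ∈ˡ induced M 𝒢 F G → (Flat K × F ⊆ K × K ⊆ G) × Induced F G K
    induced⁻ {F} {G} m with ∈-filter⁻ (inInduced? M 𝒢 F G) {xs = interval M F G} m
    ... | K∈ , a with find a
    ...   | H , _ , H∈ , H⊆G , H⊈F , eq = interval⁻ K∈ , record
        { source = H ; source-𝒢 = H∈ ; source⊆ = H⊆G ; source⊈ = H⊈F ; source-∨ = eq }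

    induced⁺ : ∀ {F G H} → Flat G → F ⊆ G → T (𝒢 H) → H ⊆ G → ¬ H ⊆ F → H ∨ᴹ F ∈ˡ induced M 𝒢 F G
    induced⁺ {F} {G} {H} flatG F⊆G H∈ H⊆G H⊈F = ∈-filter⁺ (inInduced? M 𝒢 F G)
      (interval⁺ (∨-flat H F) (∨-upperʳ H F) (∨-least flatG H⊆G F⊆G))
      (lose (∈-allSubsets H) (H∈ , (λ {x} → H⊆G {x}) , H⊈F , refl))

    -- All three sources lie in the same factor of H₁ ∨ H₂, the one containing the source of C.
    induced-∨ : ∀ {F G C H₁ H₂} → Flat F → Flat G → F ⊆ G →
      C ∈ˡ induced M 𝒢 F G → H₁ ∈ˡ induced M 𝒢 F G → H₂ ∈ˡ induced M 𝒢 F G →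
      C ⊆ H₁ → C ⊆ H₂ → H₁ ∨ᴹ H₂ ∈ˡ induced M 𝒢 F G
    induced-∨ {F} {G} {C} {H₁} {H₂} flatF flatG F⊆G C∈ H₁∈ H₂∈ C⊆H₁ C⊆H₂
      with induced⁻ C∈ | induced⁻ H₁∈ | induced⁻ H₂∈
    ... | _ , ic | (flat₁ , F⊆H₁ , H₁⊆G) , i₁ | (flat₂ , F⊆H₂ , H₂⊆G) , i₂ =
      subst (_∈ˡ induced M 𝒢 F G) W∨F≡ (induced⁺ flatG F⊆G (factor-𝒢 W∈) (join⊆G ∘ factor-⊆ W∈) W⊈F)
      where
      module C = Induced ic
      module I₁ = Induced i₁
      module I₂ = Induced i₂
      J = H₁ ∨ᴹ H₂
      flatJ : Flat J
      flatJ = ∨-flat H₁ H₂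
      join⊆G : J ⊆ G
      join⊆G = ∨-least flatG H₁⊆G H₂⊆G
      F⊆J : F ⊆ J
      F⊆J = ∨-upperˡ H₁ H₂ ∘ F⊆H₁
      sourceC⊆ : C.source ⊆ C
      sourceC⊆ = subst (C.source ⊆_) C.source-∨ (∨-upperˡ C.source F)
      W = proj₁ (factor-above C.source-𝒢 (∨-upperˡ H₁ H₂ ∘ C⊆H₁ ∘ sourceC⊆))
      W∈ : W ∈ˡ factors J
      W∈ = proj₁ (proj₂ (factor-above C.source-𝒢 (∨-upperˡ H₁ H₂ ∘ C⊆H₁ ∘ sourceC⊆)))
      C⊆W : C.source ⊆ W
      C⊆W = proj₂ (proj₂ (factor-above C.source-𝒢 (∨-upperˡ H₁ H₂ ∘ C⊆H₁ ∘ sourceC⊆)))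
      W⊈F : ¬ W ⊆ F
      W⊈F W⊆F = C.source⊈ (W⊆F ∘ C⊆W)
      -- Were the source of `H` in another factor, `C` would lie in the join of `F` with the factors
      -- other than `W`, and independence would force the source of `C` into `F`.
      same-factor : ∀ {H} (i : Induced F G H) → C ⊆ H → H ⊆ J → Induced.source i ⊆ W
      same-factor {H} i C⊆H H⊆J
          with factor-above (Induced.source-𝒢 i)
                 (H⊆J ∘ subst (Induced.source i ⊆_) (Induced.source-∨ i) (∨-upperˡ (Induced.source i) F))
      ... | W′ , W′∈ , sub with W′ ≟ₛ W
      ...   | yes refl = sub
      ...   | no W′≢W = ⊥-elim (C.source⊈ (factor-independent flatJ W∈ (members-flat _ C.source-𝒢) C⊆W flatF F⊆J
                (∨-least (∨-flat F (others J W)) (∨-upperʳ F (others J W) ∘ others-upper W′∈ W′≢W ∘ sub) (∨-upperˡ F (others J W))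
                  ∘ subst (C ⊆_) (sym (Induced.source-∨ i)) C⊆H ∘ sourceC⊆)))
      H⊆W∨F : ∀ {H} (i : Induced F G H) → C ⊆ H → H ⊆ J → H ⊆ W ∨ᴹ F
      H⊆W∨F {H} i C⊆H H⊆J = subst (_⊆ W ∨ᴹ F) (Induced.source-∨ i)
        (∨-least (∨-flat W F) (∨-upperˡ W F ∘ same-factor i C⊆H H⊆J) (∨-upperʳ W F))
      W∨F≡ : W ∨ᴹ F ≡ J
      W∨F≡ = ⊆-antisym (∨-least flatJ (factor-⊆ W∈) F⊆J)
        (∨-least (∨-flat W F) (H⊆W∨F i₁ C⊆H₁ (∨-upperˡ H₁ H₂)) (H⊆W∨F i₂ C⊆H₂ (∨-upperʳ H₁ H₂)))

    induced⊆factor : ∀ {F G B} → B ∈ˡ induced M 𝒢 F G → ∃ λ W → W ∈ˡ factors G × ¬ W ⊆ F × B ⊆ W ∨ᴹ F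
    induced⊆factor {F} {G} {B} B∈ =
      let (_ , i) = induced⁻ B∈
          (W , W∈ , H⊆W) = factor-above (Induced.source-𝒢 i) (Induced.source⊆ i)
      in W , W∈ , (λ W⊆F → Induced.source⊈ i (W⊆F ∘ H⊆W)) ,
         λ {x} → subst (_⊆ W ∨ᴹ F) (Induced.source-∨ i) (∨-least (∨-flat W F) (∨-upperˡ W F ∘ H⊆W) (∨-upperʳ W F)) {x}

    -- Otherwise `W` would lie in the join of `F` with the factors other than `W`, hence in `F` by
    -- independence.
    factor-∨-injective : ∀ {F G W W′} → Flat F → Flat G → F ⊆ G → W ∈ˡ factors G → ¬ W ⊆ F → W′ ∈ˡ factors G →
      W ⊆ W′ ∨ᴹ F → W′ ≡ W
    factor-∨-injective {F} {G} {W} {W′} flatF flatG F⊆G W∈ W⊈F W′∈ sub with W′ ≟ₛ W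
    ... | yes eq = eq
    ... | no W′≢W = ⊥-elim (W⊈F (factor-independent flatG W∈ (factor-flat W∈) id flatF F⊆G
            (∨-least (∨-flat F (others G W)) (∨-upperʳ F (others G W) ∘ others-upper W′∈ W′≢W) (∨-upperˡ F (others G W)) ∘ sub)))

    factor-∨-maximal : ∀ {F G W B} → Flat F → Flat G → F ⊆ G → W ∈ˡ factors G → ¬ W ⊆ F → B ∈ˡ induced M 𝒢 F G →
      W ∨ᴹ F ⊆ B → B ⊆ W ∨ᴹ F
    factor-∨-maximal {F} {G} {W} {B} flatF flatG F⊆G W∈ W⊈F B∈ sub =
      let (W′ , W′∈ , _ , B⊆) = induced⊆factor B∈
      in subst (λ V → B ⊆ V ∨ᴹ F) (factor-∨-injective flatF flatG F⊆G W∈ W⊈F W′∈ (λ {x} x∈ → B⊆ (sub (∨-upperˡ W F {x} x∈)))) (λ {x} → B⊆ {x})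

    unique-map-∈ : {A B : Set} (f : A → B) {L : List A} → (∀ {x y} → x ∈ˡ L → y ∈ˡ L → f x ≡ f y → x ≡ y) → Unique L → Unique (map f L)
    unique-map-∈ f inj [] = []
    unique-map-∈ f {x ∷ L} inj (x∉ ∷ u) =
      All.tabulate (λ {z} z∈ eq → let (y , y∈ , z≡) = ∈-map⁻ f z∈ in All.lookup x∉ y∈ (inj (here refl) (there y∈) (trans eq z≡)))
      ∷ unique-map-∈ f (λ x∈ y∈ → inj (there x∈) (there y∈)) u

    -- The maximal elements on [F, G] are the W ∨ F for the factors W of `G` not below `F`, and
    -- distinct W give distinct elements. Thus the power of 1 - x in the reduced characteristic
    -- function depends on `F` only through the set of factors below it. Both lists are
    -- duplicate-free, so equal membership gives equal length.
    maximals-induced : ∀ {F G} → Flat F → Flat G → F ⊆ G →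
      length (maximals M (induced M 𝒢 F G)) ≡ length (filter (λ W → ¬? (W ⊆? F)) (factors G))
    maximals-induced {F} {G} flatF flatG F⊆G = trans (↭-length (∼bag⇒↭ (unique∧set⇒bag
        (sorted⇒Unique (AllPairsP.filter⁺ _ (AllPairsP.filter⁺ _ (AllPairsP.filter⁺ _ (AllPairsP.filter⁺ _ (allSubsets-sorted n))))))
        (unique-map-∈ (_∨ᴹ F) injective (UniqueP.filter⁺ _ (factors-unique G)))
        (mk⇔ to from)))) (ListP.length-map (_∨ᴹ F) Ws)
      where
      out? = λ W → ¬? (W ⊆? F)
      Ws = filter out? (factors G)
      out⁻ : ∀ {W} → W ∈ˡ Ws → W ∈ˡ factors G × ¬ W ⊆ F
      out⁻ m = ∈-filter⁻ out? {xs = factors G} m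
      injective : ∀ {W W′} → W ∈ˡ Ws → W′ ∈ˡ Ws → W ∨ᴹ F ≡ W′ ∨ᴹ F → W ≡ W′
      injective {W} {W′} m m′ eq = sym (factor-∨-injective flatF flatG F⊆G (proj₁ (out⁻ m)) (proj₂ (out⁻ m)) (proj₁ (out⁻ m′))
        (subst (W ⊆_) eq (∨-upperˡ W F)))
      factor-induced : ∀ {W} → W ∈ˡ factors G → ¬ W ⊆ F → W ∨ᴹ F ∈ˡ induced M 𝒢 F G
      factor-induced W∈ W⊈F = induced⁺ flatG F⊆G (factor-𝒢 W∈) (factor-⊆ W∈) W⊈F
      to : ∀ {B} → B ∈ˡ maximals M (induced M 𝒢 F G) → B ∈ˡ map (_∨ᴹ F) Ws
      to {B} m = let (W , W∈ , W⊈F , B⊆) = induced⊆factor (maximal∈ m) in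
        subst (_∈ˡ map (_∨ᴹ F) Ws) (sym (maximal-top m (factor-induced W∈ W⊈F) B⊆)) (∈-map⁺ (_∨ᴹ F) (∈-filter⁺ out? W∈ W⊈F))
      from : ∀ {B} → B ∈ˡ map (_∨ᴹ F) Ws → B ∈ˡ maximals M (induced M 𝒢 F G)
      from m = let (W , W∈Ws , eq) = ∈-map⁻ (_∨ᴹ F) m ; (W∈ , W⊈F) = out⁻ W∈Ws in
        subst (_∈ˡ maximals M (induced M 𝒢 F G)) (sym eq) (maximal⁺ (factor-induced W∈ W⊈F)
          (λ K∈ sub → ⊆-antisym sub (factor-∨-maximal flatF flatG F⊆G W∈ W⊈F K∈ sub)))

-- Inverse systems: functionals annihilated by the relations of the Chow ring

module PolynomialOperators where
  open LinearAlgebra using (ℚ-ring)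
  open import Data.Rational using (ℚ; 0ℚ; _+_; -_)
  open import Data.Vec as V using (Vec; []; _∷_; lookup; updateAt; _[_]≔_)
  open import Data.Vec.Properties using (updateAt-commutes)
  open import Relation.Binary.PropositionalEquality
  open import Tactic.RingSolver using (solve-∀)

  -- Linear functionals on polynomials in m variables, given by their values on monomials.
  Fun : ℕ → Set
  Fun m = Vec ℕ m → ℚ

  infix 4 _≐_
  _≐_ : ∀ {m} → Fun m → Fun m → Set
  φ ≐ ψ = ∀ e → φ e ≡ ψ e

  0ᶠ : ∀ {m} → Fun m
  0ᶠ _ = 0ℚ

  -- Polynomials acting on functionals: (p · φ)(q) = φ(p q).
  infixl 6 _⊕_
  infixl 7 _⊗_
  data Op (m : ℕ) : Set where
    𝟘 𝟙 : Op m
    var : Fin m → Op m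
    _⊕_ _⊗_ : Op m → Op m → Op m

  ⟦_⟧ : ∀ {m} → Op m → Fun m → Fun m
  ⟦ 𝟘 ⟧ φ e = 0ℚ
  ⟦ 𝟙 ⟧ φ = φ
  ⟦ var i ⟧ φ e = φ (updateAt e i suc)
  ⟦ a ⊕ b ⟧ φ e = ⟦ a ⟧ φ e + ⟦ b ⟧ φ e
  ⟦ a ⊗ b ⟧ φ = ⟦ a ⟧ (⟦ b ⟧ φ)

  module _ {m : ℕ} where
    op-cong : ∀ (a : Op m) {φ ψ} → φ ≐ ψ → ⟦ a ⟧ φ ≐ ⟦ a ⟧ ψ
    op-cong 𝟘 p e = refl
    op-cong 𝟙 p = p
    op-cong (var i) p e = p (updateAt e i suc)
    op-cong (a ⊕ b) p e = cong₂ _+_ (op-cong a p e) (op-cong b p e)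
    op-cong (a ⊗ b) p = op-cong a (op-cong b p)

    op-+ : ∀ (a : Op m) φ ψ → ⟦ a ⟧ (λ e → φ e + ψ e) ≐ λ e → ⟦ a ⟧ φ e + ⟦ a ⟧ ψ e
    op-+ 𝟘 φ ψ e = refl
    op-+ 𝟙 φ ψ e = refl
    op-+ (var i) φ ψ e = refl
    op-+ (a ⊕ b) φ ψ e = trans (cong₂ _+_ (op-+ a φ ψ e) (op-+ b φ ψ e)) (lemma (⟦ a ⟧ φ e) (⟦ a ⟧ ψ e) (⟦ b ⟧ φ e) (⟦ b ⟧ ψ e))
      where
      lemma : ∀ x y z w → (x + y) + (z + w) ≡ (x + z) + (y + w)
      lemma = solve-∀ ℚ-ring
    op-+ (a ⊗ b) φ ψ e = trans (op-cong a (op-+ b φ ψ) e) (op-+ a (⟦ b ⟧ φ) (⟦ b ⟧ ψ) e)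

    op-neg : ∀ (a : Op m) φ → ⟦ a ⟧ (λ e → - φ e) ≐ λ e → - ⟦ a ⟧ φ e
    op-neg 𝟘 φ e = refl
    op-neg 𝟙 φ e = refl
    op-neg (var i) φ e = refl
    op-neg (a ⊕ b) φ e = trans (cong₂ _+_ (op-neg a φ e) (op-neg b φ e)) (sym (ℚP.neg-distrib-+ (⟦ a ⟧ φ e) (⟦ b ⟧ φ e)))
    op-neg (a ⊗ b) φ e = trans (op-cong a (op-neg b φ) e) (op-neg a (⟦ b ⟧ φ) e)

    op-0 : ∀ (a : Op m) {φ} → φ ≐ 0ᶠ → ⟦ a ⟧ φ ≐ 0ᶠ
    op-0 𝟘 p e = refl
    op-0 𝟙 p = p
    op-0 (var i) p e = p (updateAt e i suc)
    op-0 (a ⊕ b) p e = cong₂ _+_ (op-0 a p e) (op-0 b p e)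
    op-0 (a ⊗ b) p = op-0 a (op-0 b p)

    op-comm-var : ∀ (a : Op m) i φ → ⟦ a ⟧ (⟦ var i ⟧ φ) ≐ ⟦ var i ⟧ (⟦ a ⟧ φ)
    op-comm-var 𝟘 i φ e = refl
    op-comm-var 𝟙 i φ e = refl
    op-comm-var (var j) i φ e with i FinP.≟ j
    ... | yes refl = refl
    ... | no i≢j = cong φ (updateAt-commutes i j i≢j e)
    op-comm-var (a ⊕ b) i φ e = cong₂ _+_ (op-comm-var a i φ e) (op-comm-var b i φ e)
    op-comm-var (a ⊗ b) i φ e = trans (op-cong a (op-comm-var b i φ) e) (op-comm-var a i (⟦ b ⟧ φ) e)

    op-comm : ∀ (a b : Op m) φ → ⟦ a ⟧ (⟦ b ⟧ φ) ≐ ⟦ b ⟧ (⟦ a ⟧ φ)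
    op-comm a 𝟘 φ e = op-0 a (λ _ → refl) e
    op-comm a 𝟙 φ e = refl
    op-comm a (var i) φ e = op-comm-var a i φ e
    op-comm a (b ⊕ c) φ e = trans (op-+ a (⟦ b ⟧ φ) (⟦ c ⟧ φ) e) (cong₂ _+_ (op-comm a b φ e) (op-comm a c φ e))
    op-comm a (b ⊗ c) φ e = trans (op-comm a b (⟦ c ⟧ φ) e) (op-cong b (op-comm a c φ) e)

    infixr 8 _^ᵒ_
    _^ᵒ_ : Op m → ℕ → Op m
    a ^ᵒ zero = 𝟙
    a ^ᵒ suc k = a ⊗ a ^ᵒ k

    ^ᵒ-+ : ∀ (a : Op m) j k φ → ⟦ a ^ᵒ (j ℕ.+ k) ⟧ φ ≡ ⟦ a ^ᵒ j ⟧ (⟦ a ^ᵒ k ⟧ φ)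
    ^ᵒ-+ a zero k φ = refl
    ^ᵒ-+ a (suc j) k φ = cong ⟦ a ⟧ (^ᵒ-+ a j k φ)

    -- All operators commute, so agreement on the single functional `ψ` passes to powers, even if
    -- `a` and `b` differ elsewhere.
    ^ᵒ-agree : ∀ (a b : Op m) ψ → ⟦ a ⟧ ψ ≐ ⟦ b ⟧ ψ → ∀ k → ⟦ a ^ᵒ k ⟧ ψ ≐ ⟦ b ^ᵒ k ⟧ ψ
    ^ᵒ-agree a b ψ eq zero e = refl
    ^ᵒ-agree a b ψ eq (suc k) e = begin
      ⟦ a ⟧ (⟦ a ^ᵒ k ⟧ ψ) e ≡⟨ op-cong a (^ᵒ-agree a b ψ eq k) e ⟩
      ⟦ a ⟧ (⟦ b ^ᵒ k ⟧ ψ) e ≡⟨ op-comm a (b ^ᵒ k) ψ e ⟩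
      ⟦ b ^ᵒ k ⟧ (⟦ a ⟧ ψ) e ≡⟨ op-cong (b ^ᵒ k) eq e ⟩
      ⟦ b ^ᵒ k ⟧ (⟦ b ⟧ ψ) e ≡⟨ op-comm (b ^ᵒ k) b ψ e ⟩
      ⟦ b ⟧ (⟦ b ^ᵒ k ⟧ ψ) e ∎
      where open ≡-Reasoning

  -- The functional φ_k, the restriction of φ to the k-th power of the first variable times
  -- polynomials in the others.
  slice : ∀ {m} → Fun (suc m) → ℕ → Fun m
  slice φ k e = φ (k ∷ e)

  ↑ : ∀ {m} → Op m → Op (suc m)
  ↑ 𝟘 = 𝟘
  ↑ 𝟙 = 𝟙
  ↑ (var i) = var (suc i)
  ↑ (a ⊕ b) = ↑ a ⊕ ↑ b
  ↑ (a ⊗ b) = ↑ a ⊗ ↑ b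

  op-↑ : ∀ {m} (a : Op m) φ k → slice (⟦ ↑ a ⟧ φ) k ≐ ⟦ a ⟧ (slice φ k)
  op-↑ 𝟘 φ k e = refl
  op-↑ 𝟙 φ k e = refl
  op-↑ (var i) φ k e = refl
  op-↑ (a ⊕ b) φ k e = cong₂ _+_ (op-↑ a φ k e) (op-↑ b φ k e)
  op-↑ (a ⊗ b) φ k e = trans (op-↑ a (⟦ ↑ b ⟧ φ) k e) (op-cong a (op-↑ b φ k) e)

  xS : ∀ {m} → Subset m → Op m
  xS [] = 𝟙
  xS (true ∷ S) = var zero ⊗ ↑ (xS S)
  xS (false ∷ S) = ↑ (xS S)

  lin : ∀ {m} → Vec Bool m → Op m
  lin [] = 𝟘
  lin (s ∷ sel) = (if s then var zero else 𝟘) ⊕ ↑ (lin sel)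

  lin-agree : ∀ {m} (s s′ : Vec Bool m) ψ → (∀ i → lookup s i ≢ lookup s′ i → ⟦ var i ⟧ ψ ≐ 0ᶠ) →
    ⟦ lin s ⟧ ψ ≐ ⟦ lin s′ ⟧ ψ
  lin-agree [] [] ψ p e = refl
  lin-agree (b ∷ s) (b′ ∷ s′) ψ p (k ∷ e) = cong₂ _+_ (head b b′ (p zero))
    (trans (op-↑ (lin s) ψ k e)
      (trans (lin-agree s s′ (slice ψ k) (λ i ne e′ → p (suc i) ne (k ∷ e′)) e) (sym (op-↑ (lin s′) ψ k e))))
    where
    head : ∀ b b′ → (b ≢ b′ → ⟦ var zero ⟧ ψ ≐ 0ᶠ) →
      ⟦ if b then var zero else 𝟘 ⟧ ψ (k ∷ e) ≡ ⟦ if b′ then var zero else 𝟘 ⟧ ψ (k ∷ e)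
    head true true _ = refl
    head true false q = q (λ ()) (k ∷ e)
    head false true q = sym (q (λ ()) (k ∷ e))
    head false false _ = refl

  -- The operator x_i x_S is the one of S ∪ {i}, times a further x_i when i is already in S. This
  -- brings in the relations with larger support.
  xS-insert : ∀ {m} (S : Subset m) i ψ → ⟦ xS (S [ i ]≔ true) ⟧ ψ ≐ 0ᶠ → ⟦ var i ⟧ (⟦ xS S ⟧ ψ) ≐ 0ᶠ
  xS-insert (true ∷ S) zero ψ p e = op-0 (var zero) p e
  xS-insert (false ∷ S) zero ψ p e = p e
  xS-insert (true ∷ S) (suc i) ψ p (k ∷ e) =
    trans (op-↑ (xS S) ψ (suc k) (updateAt e i suc))
      (xS-insert S i (slice ψ (suc k)) (λ e′ → trans (sym (op-↑ (xS (S [ i ]≔ true)) ψ (suc k) e′)) (p (k ∷ e′))) e)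
  xS-insert (false ∷ S) (suc i) ψ p (k ∷ e) =
    trans (op-↑ (xS S) ψ k (updateAt e i suc))
      (xS-insert S i (slice ψ k) (λ e′ → trans (sym (op-↑ (xS (S [ i ]≔ true)) ψ k e′)) (p (k ∷ e′))) e)

  xS-⊥ : ∀ {m} ψ → ⟦ xS (V.replicate m false) ⟧ ψ ≐ ψ
  xS-⊥ {zero} ψ e = refl
  xS-⊥ {suc m} ψ (k ∷ e) = trans (op-↑ (xS (V.replicate m false)) ψ k e) (xS-⊥ (slice ψ k) e)

  slice-lin-false : ∀ {m} (s : Vec Bool m) c φ k → slice (⟦ lin (false ∷ s) ^ᵒ c ⟧ φ) k ≐ ⟦ lin s ^ᵒ c ⟧ (slice φ k)
  slice-lin-false s zero φ k e = refl
  slice-lin-false s (suc c) φ k e = trans (ℚP.+-identityˡ _)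
    (trans (op-↑ (lin s) (⟦ lin (false ∷ s) ^ᵒ c ⟧ φ) k e) (op-cong (lin s) (slice-lin-false s c φ k) e))

  slice-lin-true : ∀ {m} (s : Vec Bool m) φ k → slice (⟦ lin (true ∷ s) ⟧ φ) k ≐ λ e → φ (suc k ∷ e) + ⟦ lin s ⟧ (slice φ k) e
  slice-lin-true s φ k e = cong (λ z → φ (suc k ∷ e) + z) (op-↑ (lin s) φ k e)

  a-b+b : ∀ a b → (a + - b) + b ≡ a
  a-b+b = solve-∀ ℚ-ring

  a+b-b : ∀ a b → (a + b) + - b ≡ a
  a+b-b = solve-∀ ℚ-ring

  -- Functionals φ killed by (x₀ + h)^c, with h a linear form in the other variables, are
  -- freely determined by their slices 0, …, c − 1.
  module Sequence {m : ℕ} (s : Vec Bool m) where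
    private
      L = lin (true ∷ s)
      h = lin s

    -- Induction through Lφ, which one power less kills and whose low slices vanish too. Once Lφ =
    -- 0, the rule φ_{k+1} = (Lφ)_k - h φ_k spreads the vanishing of φ_0 to all slices.
    L-unique : ∀ c φ → ⟦ L ^ᵒ c ⟧ φ ≐ 0ᶠ → (∀ k → k ℕ.< c → slice φ k ≐ 0ᶠ) → ∀ k → slice φ k ≐ 0ᶠ
    L-unique zero φ kill z k e = kill (k ∷ e)
    L-unique (suc c) φ kill z = all
      where
      ψ-zero : ∀ k → slice (⟦ L ⟧ φ) k ≐ 0ᶠ
      ψ-zero = L-unique c (⟦ L ⟧ φ) (λ e → trans (sym (op-comm L (L ^ᵒ c) φ e)) (kill e))
        (λ k k<c e → trans (slice-lin-true s φ k e) (cong₂ _+_ (z (suc k) (s≤s k<c) e) (op-0 h (z k (ℕP.m≤n⇒m≤1+n k<c)) e)))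
      all : ∀ k → slice φ k ≐ 0ᶠ
      all zero = z 0 (s≤s z≤n)
      all (suc k) e = trans (sym (a+b-b (φ (suc k ∷ e)) (⟦ h ⟧ (slice φ k) e)))
        (cong₂ (λ x y → x + - y) (trans (sym (slice-lin-true s φ k e)) (ψ-zero k e)) (op-0 h (all k) e))

    -- Solves Lφ = ψ with φ_0 = g_0, using (Lφ)_k = φ_{k+1} + h φ_k.
    extend-slices : Fun (suc m) → Fun (suc m) → ℕ → Fun m
    extend-slices ψ g zero = slice g 0
    extend-slices ψ g (suc k) e = slice ψ k e + - ⟦ h ⟧ (extend-slices ψ g k) e

    -- If L^(c+1) is to kill φ, then L^c must kill Lφ; so Lφ is taken to be the extension of `L g`
    -- for the smaller power. Only the slices of `g` below the power are kept, none of them for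
    -- power 0.
    extend : ℕ → Fun (suc m) → Fun (suc m)
    extend zero g = 0ᶠ
    extend (suc c) g (k ∷ e) = extend-slices (extend c (⟦ L ⟧ g)) g k e

    L-extend : ∀ c g → ⟦ L ⟧ (extend (suc c) g) ≐ extend c (⟦ L ⟧ g)
    L-extend c g (k ∷ e) = trans (slice-lin-true s (extend (suc c) g) k e)
      (a-b+b (extend c (⟦ L ⟧ g) (k ∷ e)) (⟦ h ⟧ (slice (extend (suc c) g) k) e))

    extend-kill : ∀ c g → ⟦ L ^ᵒ c ⟧ (extend c g) ≐ 0ᶠ
    extend-kill zero g e = refl
    extend-kill (suc c) g e = trans (op-comm L (L ^ᵒ c) (extend (suc c) g) e)
      (trans (op-cong (L ^ᵒ c) (L-extend c g) e) (extend-kill c (⟦ L ⟧ g) e))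

    extend-agree : ∀ c g k → k ℕ.< c → slice (extend c g) k ≐ slice g k
    extend-agree (suc c) g zero k<c e = refl
    extend-agree (suc c) g (suc k) (s≤s k<c) e =
      trans (cong₂ (λ x y → x + - y) (trans (extend-agree c (⟦ L ⟧ g) k k<c e) (slice-lin-true s g k e))
                                      (op-cong h (extend-agree (suc c) g k (ℕP.m≤n⇒m≤1+n k<c)) e))
        (a+b-b (g (suc k ∷ e)) (⟦ h ⟧ (slice g k) e))

    module _ (A : Fun m → Set)
             (A-cong : ∀ {φ ψ} → φ ≐ ψ → A φ → A ψ)
             (A-+ : ∀ {φ ψ} → A φ → A ψ → A (λ e → φ e + ψ e))
             (A-neg : ∀ {φ} → A φ → A (λ e → - φ e))
             (A-op : ∀ a {φ} → A φ → A (⟦ a ⟧ φ)) where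

      -- The initial slice need not lie in `A`, only its image under h^c. The induction passes to ψ
      -- = Lφ, for which h^(c-1) ψ_0 is the sum of h^(c-1) φ_1 and h^c φ_0, and returns by φ_{k+1} =
      -- ψ_k - h φ_k.
      positive-slices : ∀ c φ → ⟦ L ^ᵒ c ⟧ φ ≐ 0ᶠ → A (⟦ h ^ᵒ c ⟧ (slice φ 0)) →
        (∀ k → 1 ℕ.≤ k → k ℕ.< c → A (slice φ k)) → ∀ k → A (slice φ (suc k))
      positive-slices zero φ kill A0 Ak k = A-cong (λ e → trans (kill (0 ∷ e)) (sym (kill (suc k ∷ e)))) A0
      positive-slices (suc c) φ kill A0 Ak = all
        where
        ψ = ⟦ L ⟧ φ
        ψ-kill : ⟦ L ^ᵒ c ⟧ ψ ≐ 0ᶠ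
        ψ-kill e = trans (sym (op-comm L (L ^ᵒ c) φ e)) (kill e)
        slice-ψ : ∀ k → slice ψ k ≐ λ e → φ (suc k ∷ e) + ⟦ h ⟧ (slice φ k) e
        slice-ψ = slice-lin-true s φ
        next : ∀ k → slice φ (suc k) ≐ λ e → slice ψ k e + - ⟦ h ⟧ (slice φ k) e
        next k e = trans (sym (a+b-b (φ (suc k ∷ e)) (⟦ h ⟧ (slice φ k) e))) (cong (λ x → x + - ⟦ h ⟧ (slice φ k) e) (sym (slice-ψ k e)))
        -- If the power of L is at least 2, this slice is among the given ones. If it is 1, then ψ =
        -- 0 and φ_1 = -h φ_0, which lies in `A` by the hypothesis on the initial slice.
        first : A (slice φ 1)
        first = go c kill A0 Ak ψ-kill
          where
          go : ∀ c → ⟦ L ^ᵒ suc c ⟧ φ ≐ 0ᶠ → A (⟦ h ^ᵒ suc c ⟧ (slice φ 0)) →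
            (∀ k → 1 ℕ.≤ k → k ℕ.< suc c → A (slice φ k)) → ⟦ L ^ᵒ c ⟧ ψ ≐ 0ᶠ → A (slice φ 1)
          go zero _ A0 _ z = A-cong
            (λ e → sym (trans (next 0 e) (trans (cong (λ x → x + - ⟦ h ⟧ (slice φ 0) e) (z (0 ∷ e))) (ℚP.+-identityˡ _)))) (A-neg A0)
          go (suc c) _ _ Ak _ = Ak 1 (s≤s z≤n) (s≤s (s≤s z≤n))
        ψ-A : ∀ k → A (slice ψ (suc k))
        ψ-A = positive-slices c ψ ψ-kill
          (A-cong (λ e → sym (trans (op-cong (h ^ᵒ c) (slice-ψ 0) e)
              (trans (op-+ (h ^ᵒ c) (slice φ 1) (⟦ h ⟧ (slice φ 0)) e)
                (cong (λ x → ⟦ h ^ᵒ c ⟧ (slice φ 1) e + x) (op-comm (h ^ᵒ c) h (slice φ 0) e)))))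
            (A-+ (A-op (h ^ᵒ c) first) A0))
          (λ { (suc k) _ k<c → A-cong (λ e → sym (slice-ψ (suc k) e))
               (A-+ (Ak (suc (suc k)) (s≤s z≤n) (s≤s k<c)) (A-op h (Ak (suc k) (s≤s z≤n) (ℕP.m≤n⇒m≤1+n k<c)))) })
        all : ∀ k → A (slice φ (suc k))
        all zero = first
        all (suc k) = A-cong (λ e → sym (next (suc k) e)) (A-+ (ψ-A k) (A-neg (A-op h (all k))))

-- Functionals killed by the relations, one variable at a time

module Annihilators where
  open LatticeOfFlats
  open PolynomialOperators
  open BuildingSets using (⊊⇒⊉)
  open import Data.Nat using () renaming (_+_ to _+ℕ_)
  open import Data.Bool.Properties using (T-∧)
  open import Data.Rational using (0ℚ; _+_; -_)
  open import Data.Vec as V using (Vec; []; _∷_; _[_]≔_)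
  open import Data.Fin.Subset.Properties
  open import Data.List.Properties using (filter-++; filter-reject)
  open import Data.List.Membership.Propositional using () renaming (_∈_ to _∈ˡ_)
  open import Data.List.Membership.Propositional.Properties using (∈-filter⁺; ∈-filter⁻; ∈-++⁺ˡ; ∈-++⁺ʳ; ∈-++⁻)
  open import Data.Unit using (⊤; tt)
  open import Function.Bundles using (Equivalence)
  open import Relation.Binary.PropositionalEquality hiding (J)

  pick : {A : Set} (U : List A) → Subset (length U) → List A
  pick [] [] = []
  pick (C ∷ U) (true ∷ S) = C ∷ pick U S
  pick (C ∷ U) (false ∷ S) = pick U S

  pick-∈ : {A : Set} (U : List A) (S : Subset (length U)) {Y : A} → Y ∈ˡ pick U S → Y ∈ˡ U
  pick-∈ [] [] ()
  pick-∈ (C ∷ U) (true ∷ S) (here eq) = here eq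
  pick-∈ (C ∷ U) (true ∷ S) (there m) = there (pick-∈ U S m)
  pick-∈ (C ∷ U) (false ∷ S) m = there (pick-∈ U S m)

  pick-insert⁼ : {A : Set} (U : List A) (S : Subset (length U)) (i : Fin (length U)) → List.lookup U i ∈ˡ pick U (S [ i ]≔ true)
  pick-insert⁼ (C ∷ U) (b ∷ S) zero = here refl
  pick-insert⁼ (C ∷ U) (true ∷ S) (suc i) = there (pick-insert⁼ U S i)
  pick-insert⁼ (C ∷ U) (false ∷ S) (suc i) = pick-insert⁼ U S i

  pick-insert : {A : Set} (U : List A) (S : Subset (length U)) (i : Fin (length U)) {Y : A} → Y ∈ˡ pick U S → Y ∈ˡ pick U (S [ i ]≔ true)
  pick-insert (C ∷ U) (true ∷ S) zero m = m
  pick-insert (C ∷ U) (false ∷ S) zero m = there m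
  pick-insert (C ∷ U) (true ∷ S) (suc i) (here eq) = here eq
  pick-insert (C ∷ U) (true ∷ S) (suc i) (there m) = there (pick-insert U S i m)
  pick-insert (C ∷ U) (false ∷ S) (suc i) m = pick-insert U S i m

  module _ {n : ℕ} where
    -- Selects the variables x_H with H ⊇ B; `lin` of it is the linear form in the relation at `B`.
    above : (U : List (Subset n)) → Subset n → Vec Bool (length U)
    above [] B = []
    above (H ∷ U) B = does (B ⊆? H) ∷ above U B

    lookup-∈ : (U : List (Subset n)) (i : Fin (length U)) → List.lookup U i ∈ˡ U
    lookup-∈ (H ∷ U) zero = here refl
    lookup-∈ (H ∷ U) (suc i) = there (lookup-∈ U i)

    lookup-above : (U : List (Subset n)) (B : Subset n) (i : Fin (length U)) → V.lookup (above U B) i ≡ does (B ⊆? List.lookup U i)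
    lookup-above (H ∷ U) B zero = refl
    lookup-above (H ∷ U) B (suc i) = lookup-above U B i

    above-differ : (U : List (Subset n)) {B B′ : Subset n} → B ⊆ B′ → ∀ i → V.lookup (above U B) i ≢ V.lookup (above U B′) i →
      B ⊆ List.lookup U i × ¬ B′ ⊆ List.lookup U i
    above-differ U {B} {B′} B⊆B′ i ne with B ⊆? List.lookup U i | B′ ⊆? List.lookup U i | lookup-above U B i | lookup-above U B′ i
    ... | yes p | yes q | eq | eq′ = ⊥-elim (ne (trans eq (sym eq′)))
    ... | yes p | no ¬q | eq | eq′ = (λ {x} → p {x}) , ¬q
    ... | no ¬p | yes q | eq | eq′ = ⊥-elim (¬p (q ∘ B⊆B′))
    ... | no ¬p | no ¬q | eq | eq′ = ⊥-elim (ne (trans eq (sym eq′)))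

  module Tower {n : ℕ} (M : Polymatroid n) (F : Subset n) (flatF : IsFlat M F) where
    open Flats M

    private
      infixr 6 _∨ᴹ_
      _∨ᴹ_ : Subset n → Subset n → Subset n
      _∨ᴹ_ = _∨_ M
      Flat : Subset n → Set
      Flat = IsFlat M

    sup : List (Subset n) → Subset n → Subset n
    sup T B = bigJoin M F (filter (_⊊? B) T)

    exponent : List (Subset n) → Subset n → ℕ
    exponent T B = rk B ∸ rk (sup T B)

    sup-flat : ∀ T B → Flat (sup T B)
    sup-flat T B = bigJoin-flat (filter (_⊊? B) T) flatF

    sup-base : ∀ T B → F ⊆ sup T B
    sup-base T B = bigJoin-base (filter (_⊊? B) T)

    sup-upper : ∀ {T B Y} → Y ∈ˡ T → Y ⊊ B → Y ⊆ sup T B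
    sup-upper {T} {B} Y∈ Y⊊B = bigJoin-upper (∈-filter⁺ (_⊊? B) Y∈ Y⊊B)

    sup-least : ∀ {T B X} → Flat X → F ⊆ X → (∀ {Y} → Y ∈ˡ T → Y ⊊ B → Y ⊆ X) → sup T B ⊆ X
    sup-least {T} {B} flatX F⊆X p = bigJoin-least (filter (_⊊? B) T) flatX F⊆X
      (λ m → let (Y∈ , Y⊊B) = ∈-filter⁻ (_⊊? B) {xs = T} m in p Y∈ Y⊊B)

    sup-mono : ∀ {T T′ B B′} → (∀ {Y} → Y ∈ˡ T → Y ⊊ B → Y ⊆ sup T′ B′) → sup T B ⊆ sup T′ B′
    sup-mono {T′ = T′} {B′ = B′} = sup-least (sup-flat T′ B′) (sup-base T′ B′)

    sup⊆ : ∀ T {B} → Flat B → F ⊆ B → sup T B ⊆ B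
    sup⊆ T flatB F⊆B = sup-least {T} flatB F⊆B (λ _ → proj₁)

    exponent-anti : ∀ {T T′ B} → (∀ {Y} → Y ∈ˡ T → Y ⊊ B → Y ⊆ sup T′ B) → exponent T′ B ≤ exponent T B
    exponent-anti {T} {T′} {B} p = ℕP.∸-monoʳ-≤ (rk B) (rk-mono (sup-mono {T} {T′} p))

    exponent-⊆ : ∀ {T T′ B} → (∀ {Y} → Y ∈ˡ T → Y ∈ˡ T′) → exponent T′ B ≤ exponent T B
    exponent-⊆ {T} {T′} {B} p = exponent-anti {T} {T′} (λ m → sup-upper {T′} {B} (p m))

    exponent-skip : ∀ X T {B C} → ¬ C ⊊ B → exponent (X ++ C ∷ T) B ≡ exponent (X ++ T) B
    exponent-skip X T {B} {C} ¬C⊊B = cong (λ L → rk B ∸ rk (bigJoin M F L)) (begin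
      filter (_⊊? B) (X ++ C ∷ T) ≡⟨ filter-++ (_⊊? B) X (C ∷ T) ⟩
      filter (_⊊? B) X ++ filter (_⊊? B) (C ∷ T) ≡⟨ cong (filter (_⊊? B) X ++_) (filter-reject (_⊊? B) ¬C⊊B) ⟩
      filter (_⊊? B) X ++ filter (_⊊? B) T ≡⟨ filter-++ (_⊊? B) X T ⟨
      filter (_⊊? B) (X ++ T) ∎)
      where open ≡-Reasoning

    -- Joins are required only for pairs with a common lower bound, the head: two arbitrary elements
    -- of a building set need not have their join in it.
    Good : List (Subset n) → Set
    Good [] = ⊤
    Good (C ∷ U) = (Flat C × F ⊆ C) × (∀ {H} → H ∈ˡ U → ¬ H ⊆ C) ×
      (∀ {H₁ H₂} → H₁ ∈ˡ U → H₂ ∈ˡ U → C ⊆ H₁ → C ⊆ H₂ → H₁ ∨ᴹ H₂ ∈ˡ U) × Good U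

    good-flat : ∀ U → Good U → ∀ {B} → B ∈ˡ U → Flat B × F ⊆ B
    good-flat (C ∷ U) ((flatC , F⊆C) , _) (here refl) = flatC , λ {x} → F⊆C {x}
    good-flat (C ∷ U) (_ , _ , _ , good) (there m) = good-flat U good m

    -- Adjoining `C` to the support raises the rank of the supremum Y by at most rk C - rk (Y ∩ C),
    -- and Y ∩ C contains sup(T, C). So the exponent of `B` drops by at most that of `C`.
    exponent-adjoin : ∀ X T {B C} → Flat B → F ⊆ B → Flat C → F ⊆ C → C ⊊ B →
      exponent (X ++ T) B ≤ exponent T C +ℕ exponent (X ++ C ∷ T) B
    exponent-adjoin X T {B} {C} flatB F⊆B flatC F⊆C C⊊B = ℕP.m≤n+o⇒m∸n≤o (rk B) (rk Y) (begin
      rk B ≡⟨ ℕP.m+[n∸m]≡n (rk-mono (sup⊆ (X ++ C ∷ T) flatB F⊆B)) ⟨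
      rk Y′ +ℕ q ≤⟨ ℕP.+-monoˡ-≤ q (ℕP.+-cancelʳ-≤ (rk Z) _ _ rank-bound) ⟩
      rk Y +ℕ p +ℕ q ≡⟨ ℕP.+-assoc (rk Y) p q ⟩
      rk Y +ℕ (p +ℕ q) ∎)
      where
      open ℕP.≤-Reasoning
      Y = sup (X ++ T) B
      Y′ = sup (X ++ C ∷ T) B
      Z = sup T C
      p = exponent T C
      q = exponent (X ++ C ∷ T) B
      Y′⊆ : Y′ ⊆ Y ∨ᴹ C
      Y′⊆ = sup-least {X ++ C ∷ T} (∨-flat Y C) (∨-upperˡ Y C ∘ sup-base (X ++ T) B) go
        where
        go : ∀ {D} → D ∈ˡ X ++ C ∷ T → D ⊊ B → D ⊆ Y ∨ᴹ C
        go m D⊊B with ∈-++⁻ X m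
        ... | inj₁ m′ = ∨-upperˡ Y C ∘ sup-upper (∈-++⁺ˡ m′) D⊊B
        ... | inj₂ (here refl) = ∨-upperʳ Y C
        ... | inj₂ (there m′) = ∨-upperˡ Y C ∘ sup-upper (∈-++⁺ʳ X m′) D⊊B
      Z⊆ : Z ⊆ Y ∩ C
      Z⊆ = ∩-greatest (sup-mono {T} {X ++ T} (λ m D⊊C → sup-upper (∈-++⁺ʳ X m)
               ((proj₁ C⊊B ∘ proj₁ D⊊C) , λ { refl → ⊊⇒⊉ C⊊B (proj₁ D⊊C) })))
             (sup⊆ T flatC F⊆C)
      rank-bound : rk Y′ +ℕ rk Z ≤ rk Y +ℕ p +ℕ rk Z
      rank-bound = begin
        rk Y′ +ℕ rk Z ≤⟨ ℕP.+-mono-≤ (rk-mono Y′⊆) (rk-mono Z⊆) ⟩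
        rk (Y ∨ᴹ C) +ℕ rk (Y ∩ C) ≡⟨ cong (_+ℕ rk (Y ∩ C)) (rk-∨ Y C) ⟩
        rk (Y ∪ C) +ℕ rk (Y ∩ C) ≤⟨ rk-submod Y C ⟩
        rk Y +ℕ rk C ≡⟨ cong (rk Y +ℕ_) (ℕP.m+[n∸m]≡n (rk-mono (sup⊆ T flatC F⊆C))) ⟨
        rk Y +ℕ (rk Z +ℕ p) ≡⟨ cong (rk Y +ℕ_) (ℕP.+-comm (rk Z) p) ⟩
        rk Y +ℕ (p +ℕ rk Z) ≡⟨ ℕP.+-assoc (rk Y) p (rk Z) ⟨
        rk Y +ℕ p +ℕ rk Z ∎

    -- Once `H` is in the support, the relation at `B` can be traded for the one at H ∨ B. As `H` is
    -- strictly below H ∨ B it enters the supremum there, and submodularity for `B` and the union of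
    -- `H` with sup(T, B) shows that the exponent does not grow.
    exponent-∨ : ∀ T T′ {B H} → Flat B → F ⊆ B → ¬ B ⊆ H → H ∈ˡ T′ →
      (∀ {Y} → Y ∈ˡ T → Y ⊊ B → Y ⊆ sup T′ (H ∨ᴹ B)) → exponent T′ (H ∨ᴹ B) ≤ exponent T B
    exponent-∨ T T′ {B} {H} flatB F⊆B B⊈H H∈ p = ℕP.m≤n+o⇒m∸n≤o (rk D) (rk Q) (ℕP.+-cancelʳ-≤ (rk P) _ _ (begin
      rk D +ℕ rk P ≤⟨ ℕP.+-mono-≤ (subst (_≤ rk (B ∪ (P ∪ H))) (sym (rk-∨ H B)) (rk-mono (∪-least (q⊆p∪q B _ ∘ q⊆p∪q P H) (p⊆p∪q _))))
           (rk-mono (∩-greatest (sup⊆ T flatB F⊆B) (p⊆p∪q H))) ⟩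
      rk (B ∪ (P ∪ H)) +ℕ rk (B ∩ (P ∪ H)) ≤⟨ rk-submod B (P ∪ H) ⟩
      rk B +ℕ rk (P ∪ H) ≤⟨ ℕP.+-monoʳ-≤ (rk B) (rk-mono (∪-least P⊆Q H⊆Q)) ⟩
      rk B +ℕ rk Q ≡⟨ cong (_+ℕ rk Q) (ℕP.m+[n∸m]≡n (rk-mono (sup⊆ T flatB F⊆B))) ⟨
      rk P +ℕ exponent T B +ℕ rk Q ≡⟨ ℕP.+-comm (rk P +ℕ exponent T B) (rk Q) ⟩
      rk Q +ℕ (rk P +ℕ exponent T B) ≡⟨ cong (rk Q +ℕ_) (ℕP.+-comm (rk P) _) ⟩
      rk Q +ℕ (exponent T B +ℕ rk P) ≡⟨ ℕP.+-assoc (rk Q) _ _ ⟨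
      rk Q +ℕ exponent T B +ℕ rk P ∎))
      where
      open ℕP.≤-Reasoning
      D = H ∨ᴹ B
      P = sup T B
      Q = sup T′ D
      P⊆Q : P ⊆ Q
      P⊆Q = sup-mono {T} {T′} p
      H⊆Q : H ⊆ Q
      H⊆Q = sup-upper H∈ (∨-upperˡ H B , λ eq → B⊈H (subst (B ⊆_) (sym eq) (∨-upperʳ H B)))

    -- Elements of `T` count in the exponent, but their variables do not occur: they have already
    -- been multiplied into the functional.
    relation : (U T : List (Subset n)) → Subset (length U) → Subset n → Op (length U)
    relation U T S B = xS S ⊗ lin (above U B) ^ᵒ exponent (pick U S ++ T) B

    Ann : (U : List (Subset n)) → List (Subset n) → Fun (length U) → Set
    Ann U T φ = ∀ (S : Subset (length U)) {B} → B ∈ˡ U → ⟦ relation U T S B ⟧ φ ≐ 0ᶠ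

    module _ {U T : List (Subset n)} where
      Ann-cong : ∀ {φ ψ} → φ ≐ ψ → Ann U T φ → Ann U T ψ
      Ann-cong eq ann S {B} B∈ e = trans (op-cong (relation U T S B) (λ e → sym (eq e)) e) (ann S B∈ e)

      Ann-+ : ∀ {φ ψ} → Ann U T φ → Ann U T ψ → Ann U T (λ e → φ e + ψ e)
      Ann-+ {φ} {ψ} ann ann′ S {B} B∈ e =
        trans (op-+ (relation U T S B) φ ψ e) (cong₂ _+_ (ann S B∈ e) (ann′ S B∈ e))

      Ann-neg : ∀ {φ} → Ann U T φ → Ann U T (λ e → - φ e)
      Ann-neg {φ} ann S {B} B∈ e = trans (op-neg (relation U T S B) φ e) (cong -_ (ann S B∈ e))

      Ann-0 : Ann U T 0ᶠ
      Ann-0 S {B} B∈ = op-0 (relation U T S B) (λ _ → refl)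

      Ann-op : ∀ a {φ} → Ann U T φ → Ann U T (⟦ a ⟧ φ)
      Ann-op a {φ} ann S {B} B∈ e = trans (op-comm (relation U T S B) a φ e) (op-0 a (ann S B∈) e)

      Ann-power : ∀ {φ} → Ann U T φ → ∀ S {B} → B ∈ˡ U → ∀ {k} → exponent (pick U S ++ T) B ≤ k →
        ⟦ xS S ⟧ (⟦ lin (above U B) ^ᵒ k ⟧ φ) ≐ 0ᶠ
      Ann-power {φ} ann S {B} B∈ {k} le e = begin
        ⟦ xS S ⟧ (⟦ h ^ᵒ k ⟧ φ) e ≡⟨ cong (λ j → ⟦ xS S ⟧ (⟦ h ^ᵒ j ⟧ φ) e) (ℕP.m∸n+n≡m le) ⟨
        ⟦ xS S ⟧ (⟦ h ^ᵒ (k ∸ x +ℕ x) ⟧ φ) e ≡⟨ cong (λ ψ → ⟦ xS S ⟧ ψ e) (^ᵒ-+ h (k ∸ x) x φ) ⟩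
        ⟦ xS S ⟧ (⟦ h ^ᵒ (k ∸ x) ⟧ (⟦ h ^ᵒ x ⟧ φ)) e ≡⟨ op-comm (xS S) (h ^ᵒ (k ∸ x)) (⟦ h ^ᵒ x ⟧ φ) e ⟩
        ⟦ h ^ᵒ (k ∸ x) ⟧ (⟦ xS S ⟧ (⟦ h ^ᵒ x ⟧ φ)) e ≡⟨ op-0 (h ^ᵒ (k ∸ x)) (ann S B∈) e ⟩
        0ℚ ∎
        where
        open ≡-Reasoning
        h = lin (above U B)
        x = exponent (pick U S ++ T) B

      -- The relation with S = {H, K} and B = K ∨ H has exponent 0.
      Ann-pair : ∀ {φ} → Ann U T φ → ∀ i j → let H = List.lookup U i ; K = List.lookup U j in
        ¬ H ⊆ K → ¬ K ⊆ H → K ∨ᴹ H ∈ˡ U → ⟦ var j ⟧ (⟦ var i ⟧ φ) ≐ 0ᶠ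
      Ann-pair {φ} ann i j H⊈K K⊈H D∈ e = trans (op-comm (var j) (var i) φ e)
        (trans (op-cong (var i) (λ e′ → sym (xS-⊥ (⟦ var j ⟧ φ) e′)) e)
          (xS-insert S₀ i (⟦ var j ⟧ φ) (λ e′ → trans (op-comm (xS S₁) (var j) φ e′) (xS-insert S₁ j φ zero-S₂ e′)) e))
        where
        H = List.lookup U i
        K = List.lookup U j
        D = K ∨ᴹ H
        S₀ = V.replicate (length U) false
        S₁ = S₀ [ i ]≔ true
        S₂ = S₁ [ j ]≔ true
        D⊆sup : D ⊆ sup (pick U S₂ ++ T) D
        D⊆sup = ∨-least (sup-flat (pick U S₂ ++ T) D)
          (sup-upper (∈-++⁺ˡ (pick-insert⁼ U S₁ j)) (∨-upperˡ K H , λ eq → H⊈K (subst (H ⊆_) (sym eq) (∨-upperʳ K H))))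
          (sup-upper (∈-++⁺ˡ (pick-insert U S₁ j (pick-insert⁼ U S₀ i))) (∨-upperʳ K H , λ eq → K⊈H (subst (K ⊆_) (sym eq) (∨-upperˡ K H))))
        zero-S₂ : ⟦ xS S₂ ⟧ φ ≐ 0ᶠ
        zero-S₂ = Ann-power ann S₂ D∈ {0} (ℕP.≤-reflexive (ℕP.m≤n⇒m∸n≡0 (rk-mono D⊆sup)))

    -- If `C` is not strictly below `B`, it does not affect the exponent. If C ⊊ B, let ψ = x_S
    -- h_B^a φ with a the exponent for T ∪ {C}. On ψ the forms h_C and h_B act alike, because every
    -- x_H with H above `C` but not above `B` kills it. So h_C^c ψ = x_S h_B^(c+a) φ, and c + a is
    -- at least the exponent without `C`.
    critical : ∀ {C U T} → Good (C ∷ U) → ∀ {φ} → Ann U T φ →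
      Ann U (C ∷ T) (⟦ lin (above U C) ^ᵒ exponent T C ⟧ φ)
    critical {C} {U} {T} ((flatC , F⊆C) , later , closed , good) {φ} ann S {B} B∈ with C ⊊? B
    ... | no ¬C⊊B = subst (λ k → ⟦ xS S ⟧ (⟦ lin (above U B) ^ᵒ k ⟧ (⟦ lin (above U C) ^ᵒ exponent T C ⟧ φ)) ≐ 0ᶠ)
      (sym (exponent-skip (pick U S) T ¬C⊊B)) (Ann-op (lin (above U C) ^ᵒ exponent T C) ann S B∈)
    ... | yes C⊊B = λ e → begin
      ⟦ xS S ⟧ (⟦ hB ^ᵒ a ⟧ (⟦ hC ^ᵒ c ⟧ φ)) e ≡⟨ op-comm (xS S ⊗ hB ^ᵒ a) (hC ^ᵒ c) φ e ⟩
      ⟦ hC ^ᵒ c ⟧ ψ e ≡⟨ ^ᵒ-agree hC hB ψ (lin-agree (above U C) (above U B) ψ (λ i ne →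
                            let (C⊆H , B⊈H) = above-differ U (proj₁ C⊊B) i ne in kill i C⊆H B⊈H)) c e ⟩
      ⟦ hB ^ᵒ c ⟧ ψ e ≡⟨ op-comm (hB ^ᵒ c) (xS S) (⟦ hB ^ᵒ a ⟧ φ) e ⟩
      ⟦ xS S ⟧ (⟦ hB ^ᵒ c ⟧ (⟦ hB ^ᵒ a ⟧ φ)) e ≡⟨ cong (λ χ → ⟦ xS S ⟧ χ e) (^ᵒ-+ hB c a φ) ⟨
      ⟦ xS S ⟧ (⟦ hB ^ᵒ (c +ℕ a) ⟧ φ) e ≡⟨ Ann-power {U} {T} ann S B∈ (exponent-adjoin X T flatB F⊆B flatC F⊆C C⊊B) e ⟩
      0ℚ ∎
      where
      open ≡-Reasoning
      X = pick U S
      a = exponent (X ++ C ∷ T) B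
      c = exponent T C
      hB = lin (above U B)
      hC = lin (above U C)
      ψ = ⟦ xS S ⟧ (⟦ hB ^ᵒ a ⟧ φ)
      flatB = proj₁ (good-flat U good B∈)
      F⊆B : F ⊆ B
      F⊆B = proj₂ (good-flat U good B∈)
      module _ (i : Fin (length U)) where
        private
          H = List.lookup U i
          S′ = S [ i ]≔ true
          T′ = pick U S′ ++ T

        -- The role of `C` is taken over by H, which contains it and belongs to the enlarged
        -- support.
        absorb : ∀ {D} → C ⊆ H → H ⊊ D → B ⊆ D → ∀ {Y} → Y ∈ˡ X ++ C ∷ T → Y ⊊ B → Y ⊆ sup T′ D
        absorb {D} C⊆H H⊊D B⊆D m Y⊊B with ∈-++⁻ X m
        ... | inj₁ m′ = sup-upper (∈-++⁺ˡ (pick-insert U S i m′)) ((B⊆D ∘ proj₁ Y⊊B) , λ { refl → ⊊⇒⊉ Y⊊B B⊆D })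
        ... | inj₂ (here refl) = sup-upper (∈-++⁺ˡ (pick-insert⁼ U S i)) H⊊D ∘ C⊆H
        ... | inj₂ (there m′) = sup-upper (∈-++⁺ʳ (pick U S′) m′) ((B⊆D ∘ proj₁ Y⊊B) , λ { refl → ⊊⇒⊉ Y⊊B B⊆D })

        -- If H ⊊ B, the relation at `B` for S ∪ {H} applies, its exponent being at most `a`.
        -- Otherwise H and `B` are incomparable, their join D is again in the list, and x_H h_B may
        -- be replaced by x_H h_D, to which the relation at D applies.
        kill : C ⊆ H → ¬ B ⊆ H → ⟦ var i ⟧ ψ ≐ 0ᶠ
        kill C⊆H B⊈H with H ⊊? B
        ... | yes H⊊B = xS-insert S i (⟦ hB ^ᵒ a ⟧ φ)
              (Ann-power {U} {T} ann S′ B∈ (exponent-anti {X ++ C ∷ T} {T′} (absorb C⊆H H⊊B id)))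
        ... | no ¬H⊊B = λ e → begin
          ⟦ var i ⟧ (⟦ xS S ⟧ (⟦ hB ^ᵒ a ⟧ φ)) e ≡⟨ op-comm (var i) (xS S ⊗ hB ^ᵒ a) φ e ⟩
          ⟦ xS S ⟧ (⟦ hB ^ᵒ a ⟧ (⟦ var i ⟧ φ)) e ≡⟨ op-cong (xS S) (^ᵒ-agree hB hD (⟦ var i ⟧ φ) hB≐hD a) e ⟩
          ⟦ xS S ⟧ (⟦ hD ^ᵒ a ⟧ (⟦ var i ⟧ φ)) e ≡⟨ op-comm (xS S ⊗ hD ^ᵒ a) (var i) φ e ⟩
          ⟦ var i ⟧ (⟦ xS S ⟧ (⟦ hD ^ᵒ a ⟧ φ)) e ≡⟨ xS-insert S i (⟦ hD ^ᵒ a ⟧ φ) (Ann-power {U} {T} ann S′ D∈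
               (exponent-∨ (X ++ C ∷ T) T′ flatB F⊆B B⊈H (∈-++⁺ˡ (pick-insert⁼ U S i))
                 (absorb C⊆H (∨-upperˡ H B , λ eq → B⊈H (subst (B ⊆_) (sym eq) (∨-upperʳ H B))) (∨-upperʳ H B)))) e ⟩
          0ℚ ∎
          where
          D = H ∨ᴹ B
          hD = lin (above U D)
          D∈ : D ∈ˡ U
          D∈ = closed (lookup-∈ U i) B∈ C⊆H (proj₁ C⊊B)
          -- A K above `B` but not above `D` is incomparable to H. Both contain `C`, so K ∨ H is in
          -- the list and x_K x_H kills φ.
          hB≐hD : ⟦ hB ⟧ (⟦ var i ⟧ φ) ≐ ⟦ hD ⟧ (⟦ var i ⟧ φ)
          hB≐hD = lin-agree (above U B) (above U D) (⟦ var i ⟧ φ) λ j ne →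
            let (B⊆K , D⊈K) = above-differ U (∨-upperʳ H B) j ne
                K = List.lookup U j
            in Ann-pair {U} {T} ann i j
                 (λ H⊆K → D⊈K (∨-least (proj₁ (good-flat U good (lookup-∈ U j))) H⊆K B⊆K))
                 (λ K⊆H → B⊈H (K⊆H ∘ B⊆K))
                 (closed (lookup-∈ U j) (lookup-∈ U i) (B⊆K ∘ proj₁ C⊊B) C⊆H)

    above-head : ∀ (C : Subset n) U → above (C ∷ U) C ≡ true ∷ above U C
    above-head C U = cong (_∷ above U C) (dec-true (C ⊆? C) id)

    above-later : ∀ {B C : Subset n} U → ¬ B ⊆ C → above (C ∷ U) B ≡ false ∷ above U B
    above-later {B} {C} U B⊈C = cong (_∷ above U B) (dec-false (B ⊆? C) B⊈C)

    exponent-head : ∀ {C U} T → (∀ {H} → H ∈ˡ U → ¬ H ⊆ C) → ∀ (S : Subset (length (C ∷ U))) →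
      exponent (pick (C ∷ U) S ++ T) C ≡ exponent T C
    exponent-head {C} {U} T later S = ℕP.≤-antisym (exponent-⊆ (∈-++⁺ʳ (pick (C ∷ U) S)))
      (exponent-anti {pick (C ∷ U) S ++ T} {T} go)
      where
      go : ∀ {Y} → Y ∈ˡ pick (C ∷ U) S ++ T → Y ⊊ C → Y ⊆ sup T C
      go m Y⊊C with ∈-++⁻ (pick (C ∷ U) S) m
      ... | inj₂ m′ = sup-upper m′ Y⊊C
      ... | inj₁ m′ with pick-∈ (C ∷ U) S m′
      ...   | here refl = ⊥-elim (⊊⇒⊉ Y⊊C id)
      ...   | there m″ = ⊥-elim (later m″ (proj₁ Y⊊C))

    exponent-move : ∀ X T {B C} → exponent (C ∷ X ++ T) B ≡ exponent (X ++ C ∷ T) B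
    exponent-move X T {B} {C} = ℕP.≤-antisym (exponent-⊆ to) (exponent-⊆ from)
      where
      to : ∀ {Y} → Y ∈ˡ X ++ C ∷ T → Y ∈ˡ C ∷ X ++ T
      to m with ∈-++⁻ X m
      ... | inj₁ m′ = there (∈-++⁺ˡ m′)
      ... | inj₂ (here eq) = here eq
      ... | inj₂ (there m′) = there (∈-++⁺ʳ X m′)
      from : ∀ {Y} → Y ∈ˡ C ∷ X ++ T → Y ∈ˡ X ++ C ∷ T
      from (here eq) = ∈-++⁺ʳ X (here eq)
      from (there m) with ∈-++⁻ X m
      ... | inj₁ m′ = ∈-++⁺ˡ m′
      ... | inj₂ m′ = ∈-++⁺ʳ X (there m′)

    slice-relation : ∀ {C : Subset n} {U : List (Subset n)} (S : Subset (length U)) {B} k (φ : Fun (length (C ∷ U))) → ¬ B ⊆ C → ∀ j →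
      slice (⟦ ↑ (xS S) ⟧ (⟦ lin (above (C ∷ U) B) ^ᵒ k ⟧ φ)) j ≐ ⟦ xS S ⟧ (⟦ lin (above U B) ^ᵒ k ⟧ (slice φ j))
    slice-relation {C} {U} S {B} k φ B⊈C j e = trans (op-↑ (xS S) (⟦ lin (above (C ∷ U) B) ^ᵒ k ⟧ φ) j e)
      (op-cong (xS S) (λ e′ → trans (cong (λ s → ⟦ lin s ^ᵒ k ⟧ φ (j ∷ e′)) (above-later U B⊈C)) (slice-lin-false (above U B) k φ j e′)) e)

    module _ {C : Subset n} {U T : List (Subset n)} (good : Good (C ∷ U)) where
      private
        later = proj₁ (proj₂ good)

      Ann-slice-zero : ∀ {φ} → Ann (C ∷ U) T φ → ∀ j → Ann U T (slice φ j)
      Ann-slice-zero {φ} ann j S {B} B∈ e =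
        trans (sym (slice-relation {C} {U} S (exponent (pick U S ++ T) B) φ (later B∈) j e)) (ann (false ∷ S) (there B∈) (j ∷ e))

      Ann-slice-suc : ∀ {φ} → Ann (C ∷ U) T φ → ∀ j → Ann U (C ∷ T) (slice φ (suc j))
      Ann-slice-suc {φ} ann j S {B} B∈ e =
        trans (sym (slice-relation {C} {U} S (exponent (pick U S ++ C ∷ T) B) φ (later B∈) (suc j) e))
          (subst (λ k → ⟦ ↑ (xS S) ⟧ (⟦ lin (above (C ∷ U) B) ^ᵒ k ⟧ φ) (suc j ∷ e) ≡ 0ℚ) (exponent-move (pick U S) T)
            (ann (true ∷ S) (there B∈) (j ∷ e)))

      Ann-head : ∀ {φ} → Ann (C ∷ U) T φ → ⟦ lin (true ∷ above U C) ^ᵒ exponent T C ⟧ φ ≐ 0ᶠ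
      Ann-head {φ} ann e = subst₂ (λ s k → ⟦ lin s ^ᵒ k ⟧ φ e ≡ 0ℚ) (above-head C U) (exponent-head T later S₀)
        (trans (sym (xS-⊥ (⟦ lin (above (C ∷ U) C) ^ᵒ exponent (pick (C ∷ U) S₀ ++ T) C ⟧ φ) e)) (ann S₀ (here refl) e))
        where S₀ = V.replicate (length (C ∷ U)) false

      Ann-cons : ∀ {φ} → Ann U T (slice φ 0) → (∀ k → Ann U (C ∷ T) (slice φ (suc k))) →
        ⟦ lin (true ∷ above U C) ^ᵒ exponent T C ⟧ φ ≐ 0ᶠ → Ann (C ∷ U) T φ
      Ann-cons {φ} ann₀ ann₊ head S (here refl) = λ e → trans
        (cong₂ (λ s k → ⟦ xS S ⟧ (⟦ lin s ^ᵒ k ⟧ φ) e) (above-head C U) (exponent-head T later S))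
        (op-0 (xS S) head e)
      Ann-cons {φ} ann₀ ann₊ head (false ∷ S) {B} (there B∈) (zero ∷ e) =
        trans (slice-relation {C} {U} S (exponent (pick U S ++ T) B) φ (later B∈) 0 e) (ann₀ S B∈ e)
      -- Here `C` is not in the support S but the slice is a positive one: its relations for T ∪ {C}
      -- have exponents no larger, and so imply those for `T`.
      Ann-cons {φ} ann₀ ann₊ head (false ∷ S) {B} (there B∈) (suc j ∷ e) =
        trans (slice-relation {C} {U} S (exponent (pick U S ++ T) B) φ (later B∈) (suc j) e)
          (Ann-power {U} {C ∷ T} (ann₊ j) S B∈ (exponent-⊆ skip) e)
        where
        skip : ∀ {Y} → Y ∈ˡ pick U S ++ T → Y ∈ˡ pick U S ++ C ∷ T
        skip m with ∈-++⁻ (pick U S) m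
        ... | inj₁ m′ = ∈-++⁺ˡ m′
        ... | inj₂ m′ = ∈-++⁺ʳ (pick U S) (there m′)
      Ann-cons {φ} ann₀ ann₊ head (true ∷ S) {B} (there B∈) (j ∷ e) =
        trans (slice-relation {C} {U} S (exponent (C ∷ pick U S ++ T) B) φ (later B∈) (suc j) e)
          (subst (λ k → ⟦ xS S ⟧ (⟦ lin (above U B) ^ᵒ k ⟧ (slice φ (suc j))) e ≡ 0ℚ) (sym (exponent-move (pick U S) T)) (ann₊ j S B∈ e))

    -- The coordinates that can be prescribed freely: slices below c in each variable, where a
    -- positive exponent puts `C` into the support seen by the later variables. The test 0 < c
    -- matters: for c = 0 not even exponent 0 is allowed.
    Std : (U T : List (Subset n)) → Vec ℕ (length U) → Bool
    Std [] T [] = true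
    Std (C ∷ U) T (zero ∷ e) = (0 <ᵇ exponent T C) ∧ Std U T e
    Std (C ∷ U) T (suc k ∷ e) = (suc k <ᵇ exponent T C) ∧ Std U (C ∷ T) e

    Std-head : ∀ C U T k e → k < exponent T C → Data.Bool.T (Std U (if k ℕ.≡ᵇ 0 then T else C ∷ T) e) → Data.Bool.T (Std (C ∷ U) T (k ∷ e))
    Std-head C U T zero e lt st = Equivalence.from T-∧ (ℕP.<⇒<ᵇ lt , st)
    Std-head C U T (suc k) e lt st = Equivalence.from T-∧ (ℕP.<⇒<ᵇ lt , st)

    -- The slices below c vanish by recursion, and `Sequence.L-unique` forces the remaining ones.
    Ann-unique : ∀ U T → Good U → ∀ {φ} → Ann U T φ → (∀ e → Data.Bool.T (Std U T e) → φ e ≡ 0ℚ) → φ ≐ 0ᶠ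
    Ann-unique [] T good ann z [] = z [] tt
    Ann-unique (C ∷ U) T good {φ} ann z (k ∷ e) =
      Sequence.L-unique (above U C) (exponent T C) φ (Ann-head good ann) low k e
      where
      good′ = proj₂ (proj₂ (proj₂ good))
      low : ∀ k → k < exponent T C → slice φ k ≐ 0ᶠ
      low zero lt = Ann-unique U T good′ (Ann-slice-zero good ann 0) (λ e st → z (0 ∷ e) (Std-head C U T 0 e lt st))
      low (suc k) lt = Ann-unique U (C ∷ T) good′ (Ann-slice-suc good ann k) (λ e st → z (suc k ∷ e) (Std-head C U T (suc k) e lt st))

    -- The slices below c come from the recursion, slice 0 for `T` and the positive ones for T ∪
    -- {C}; the others are forced. These satisfy the relations for T ∪ {C} by `positive-slices`,
    -- whose hypothesis on h^c φ_0 is supplied by `critical`.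
    Ann-exists : ∀ U T → Good U → (v : Fun (length U)) →
      ∃ λ φ → Ann U T φ × (∀ e → Data.Bool.T (Std U T e) → φ e ≡ v e)
    Ann-exists [] T good v = v , (λ S ()) , λ e _ → refl
    Ann-exists (C ∷ U) T good@((flatC , F⊆C) , _ , _ , good′) v =
      φ , Ann-cons good ann₀ ann₊ (extend-kill c g) , agree
      where
      open Sequence (above U C)
      c = exponent T C
      rec₀ = Ann-exists U T good′ (slice v 0)
      rec₊ = λ k → Ann-exists U (C ∷ T) good′ (slice v (suc k))
      g : Fun (suc (length U))
      g (zero ∷ e) = proj₁ rec₀ e
      g (suc k ∷ e) = proj₁ (rec₊ k) e
      φ = extend c g
      -- For c = 0 the extension is the zero functional and does not keep slice 0 of `g`.
      extend-0-ann : ∀ c g → Ann U T (slice g 0) → Ann U T (slice (extend c g) 0)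
      extend-0-ann zero g ann = Ann-0 {U} {T}
      extend-0-ann (suc c) g ann = ann
      ann₀ : Ann U T (slice φ 0)
      ann₀ = extend-0-ann c g (proj₁ (proj₂ rec₀))
      ann₊ : ∀ k → Ann U (C ∷ T) (slice φ (suc k))
      ann₊ = positive-slices (Ann U (C ∷ T)) (Ann-cong {U} {C ∷ T}) (Ann-+ {U} {C ∷ T}) (Ann-neg {U} {C ∷ T}) (Ann-op {U} {C ∷ T})
        c φ (extend-kill c g) (critical good ann₀)
        (λ { (suc k) _ k<c → Ann-cong {U} {C ∷ T} (λ e → sym (extend-agree c g (suc k) k<c e)) (proj₁ (proj₂ (rec₊ k))) })
      agree : ∀ e → Data.Bool.T (Std (C ∷ U) T e) → φ e ≡ v e
      agree (zero ∷ e) st = let (lt , st′) = Equivalence.to T-∧ st in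
        trans (extend-agree c g 0 (ℕP.<ᵇ⇒< 0 c lt) e) (proj₂ (proj₂ rec₀) e st′)
      agree (suc k ∷ e) st = let (lt , st′) = Equivalence.to T-∧ st in
        trans (extend-agree c g (suc k) (ℕP.<ᵇ⇒< (suc k) c lt) e) (proj₂ (proj₂ (rec₊ k)) e st′)

-- Polynomials as lists of terms: action on functionals, degrees, coefficients

module PolynomialActions where
  open LinearAlgebra
  open PolynomialOperators
  open import Data.Nat using () renaming (_+_ to _+ℕ_)
  open import Data.Rational using (ℚ; 0ℚ; 1ℚ; _+_; _*_)
  open import Data.Vec as V using (Vec; []; _∷_; lookup; updateAt; _[_]≔_; zipWith; replicate)
  open import Data.Vec.Properties using (≡-dec; zipWith-assoc; zipWith-identityʳ)
  open import Data.List using (tabulate)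
  open import Data.List.Membership.Propositional using (_∈_; _∉_; lose; find)
  open import Data.List.Membership.Propositional.Properties using (∈-concatMap⁺; ∈-concatMap⁻; ∈-map⁺; ∈-map⁻; ∈-upTo⁺; ∈-upTo⁻)
  open import Data.List.Relation.Unary.All using (All; []; _∷_)
  open import Data.List.Relation.Unary.AllPairs using (AllPairs; []; _∷_)
  open import Data.List.Relation.Unary.Unique.Propositional.Properties using (upTo⁺; map⁺)
  open import Relation.Unary using (Decidable)
  open import Relation.Binary.PropositionalEquality
  open import Tactic.RingSolver using (solve-∀)

  infixl 6 _⊞_
  _⊞_ : ∀ {m} → Vec ℕ m → Vec ℕ m → Vec ℕ m
  _⊞_ = zipWith _+ℕ_

  _≟ᵐ_ : ∀ {m} (e f : Vec ℕ m) → Dec (e ≡ f)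
  _≟ᵐ_ = ≡-dec ℕ._≟_

  pair : ∀ {m} → Fun m → Poly m → ℚ
  pair φ p = Σ p (λ t → proj₁ t * φ (proj₂ t))

  act : ∀ {m} → Poly m → Fun m → Fun m
  act p φ e = Σ p (λ t → proj₁ t * φ (e ⊞ proj₂ t))

  pair-monoP : ∀ {m} (φ : Fun m) e p → pair φ (monoP e *P p) ≡ act p φ e
  pair-monoP φ e p = begin
    Σ (map f p ++ []) g ≡⟨ cong (λ L → Σ L g) (ListP.++-identityʳ (map f p)) ⟩
    Σ (map f p) g ≡⟨ Σ-map p f g ⟩
    Σ p (g ∘ f) ≡⟨ Σ-cong p (λ u → cong (_* φ (e ⊞ proj₂ u)) (ℚP.*-identityˡ (proj₁ u))) ⟩
    act p φ e ∎
    where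
    open ≡-Reasoning
    f = λ u → (1ℚ * proj₁ u , e ⊞ proj₂ u)
    g = λ t → proj₁ t * φ (proj₂ t)

  act-*P : ∀ {m} (p q : Poly m) φ → act (p *P q) φ ≐ act p (act q φ)
  act-*P p q φ e = begin
    Σ (concatMap (λ t → map (f t) q) p) g ≡⟨ Σ-concatMap p (λ t → map (f t) q) g ⟩
    Σ p (λ t → Σ (map (f t) q) g) ≡⟨ Σ-cong p (λ t → trans (Σ-map q (f t) g) (trans (Σ-cong q (inner t)) (Σ-*ˡ q (proj₁ t) _))) ⟩
    Σ p (λ t → proj₁ t * act q φ (e ⊞ proj₂ t)) ∎
    where
    open ≡-Reasoning
    f = λ t u → (proj₁ t * proj₁ u , proj₂ t ⊞ proj₂ u)
    g = λ t → proj₁ t * φ (e ⊞ proj₂ t)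
    inner : ∀ t u → (proj₁ t * proj₁ u) * φ (e ⊞ (proj₂ t ⊞ proj₂ u)) ≡ proj₁ t * (proj₁ u * φ (e ⊞ proj₂ t ⊞ proj₂ u))
    inner t u = trans (ℚP.*-assoc (proj₁ t) (proj₁ u) _)
      (cong (λ x → proj₁ t * (proj₁ u * φ x)) (sym (zipWith-assoc ℕP.+-assoc e (proj₂ t) (proj₂ u))))

  act-cong : ∀ {m} (p : Poly m) {φ ψ} → φ ≐ ψ → act p φ ≐ act p ψ
  act-cong p eq e = Σ-cong p (λ t → cong (proj₁ t *_) (eq (e ⊞ proj₂ t)))

  act-monoP : ∀ {m} (f : Vec ℕ m) φ e → act (monoP f) φ e ≡ φ (e ⊞ f)
  act-monoP f φ e = trans (ℚP.+-identityʳ _) (ℚP.*-identityˡ _)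

  act-oneP : ∀ {m} φ → act (oneP {m}) φ ≐ φ
  act-oneP {m} φ e = trans (act-monoP (replicate m 0) φ e) (cong φ (zipWith-identityʳ ℕP.+-identityʳ e))

  ⊞-unit : ∀ {m} (e : Vec ℕ m) i → e ⊞ (replicate m 0 [ i ]≔ 1) ≡ updateAt e i suc
  ⊞-unit (k ∷ e) zero = cong₂ _∷_ (ℕP.+-comm k 1) (zipWith-identityʳ ℕP.+-identityʳ e)
  ⊞-unit (k ∷ e) (suc i) = cong₂ _∷_ (ℕP.+-identityʳ k) (⊞-unit e i)

  act-varP : ∀ {m} (i : Fin m) φ → act (varP i) φ ≐ ⟦ var i ⟧ φ
  act-varP {m} i φ e = trans (act-monoP (replicate m 0 [ i ]≔ 1) φ e) (cong φ (⊞-unit e i))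

  act-^P : ∀ {m} (p : Poly m) (a : Op m) → (∀ φ → act p φ ≐ ⟦ a ⟧ φ) → ∀ k φ → act (p ^P k) φ ≐ ⟦ a ^ᵒ k ⟧ φ
  act-^P p a eq zero φ e = act-oneP φ e
  act-^P p a eq (suc k) φ e = trans (act-*P p (p ^P k) φ e)
    (trans (act-cong p (act-^P p a eq k φ) e) (eq (⟦ a ^ᵒ k ⟧ φ) e))

  sumOp prodOp : ∀ {m} → List (Fin m) → Op m
  sumOp = foldr (λ i a → var i ⊕ a) 𝟘
  prodOp = foldr (λ i a → var i ⊗ a) 𝟙

  act-sumP : ∀ {m} (is : List (Fin m)) φ → act (sumP (map varP is)) φ ≐ ⟦ sumOp is ⟧ φ
  act-sumP [] φ e = refl
  act-sumP (i ∷ is) φ e = trans (Σ-++ (varP i) (sumP (map varP is)) (λ t → proj₁ t * φ (e ⊞ proj₂ t))) (cong₂ _+_ (act-varP i φ e) (act-sumP is φ e))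

  act-prodP : ∀ {m} (is : List (Fin m)) φ → act (prodP (map varP is)) φ ≐ ⟦ prodOp is ⟧ φ
  act-prodP [] φ e = act-oneP φ e
  act-prodP (i ∷ is) φ e = trans (act-*P (varP i) (prodP (map varP is)) φ e)
    (trans (act-cong (varP i) (act-prodP is φ) e) (act-varP i (⟦ prodOp is ⟧ φ) e))

  filter-map : {A B : Set} {P : B → Set} {Q : A → Set} (P? : Decidable P) (Q? : Decidable Q) (f : A → B) →
    (∀ x → does (P? (f x)) ≡ does (Q? x)) → ∀ xs → filter P? (map f xs) ≡ map f (filter Q? xs)
  filter-map P? Q? f eq [] = refl
  filter-map P? Q? f eq (x ∷ xs) rewrite eq x with does (Q? x)
  ... | true = cong (f x ∷_) (filter-map P? Q? f eq xs)
  ... | false = filter-map P? Q? f eq xs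

  lookup? : ∀ {m} (s : Vec Bool m) → Decidable (λ i → lookup s i ≡ true)
  lookup? s i = lookup s i Data.Bool.≟ true
    where import Data.Bool

  selected : ∀ {m} → Vec Bool m → List (Fin m)
  selected {m} s = filter (lookup? s) (allFin m)

  selected-∷ : ∀ {m} b (s : Vec Bool m) → selected (b ∷ s) ≡ (if b then zero ∷ map suc (selected s) else map suc (selected s))
  selected-∷ {m} b s = trans (head b) (cong (λ L → if b then zero ∷ L else L)
    (trans (cong (filter (lookup? (b ∷ s))) (sym (ListP.map-tabulate id suc)))
           (filter-map (lookup? (b ∷ s)) (lookup? s) suc (λ i → refl) (allFin m))))
    where
    head : ∀ b → selected (b ∷ s) ≡ (if b then zero ∷ filter (lookup? (b ∷ s)) (tabulate suc) else filter (lookup? (b ∷ s)) (tabulate suc))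
    head true = refl
    head false = refl

  sumOp-suc : ∀ {m} (is : List (Fin m)) → sumOp (map suc is) ≡ ↑ (sumOp is)
  sumOp-suc [] = refl
  sumOp-suc (i ∷ is) = cong (var (suc i) ⊕_) (sumOp-suc is)

  prodOp-suc : ∀ {m} (is : List (Fin m)) → prodOp (map suc is) ≡ ↑ (prodOp is)
  prodOp-suc [] = refl
  prodOp-suc (i ∷ is) = cong (var (suc i) ⊗_) (prodOp-suc is)

  sumOp-selected : ∀ {m} (s : Vec Bool m) φ → ⟦ sumOp (selected s) ⟧ φ ≐ ⟦ lin s ⟧ φ
  sumOp-selected [] φ e = refl
  sumOp-selected (true ∷ s) φ (k ∷ e) = trans (cong (λ L → ⟦ sumOp L ⟧ φ (k ∷ e)) (selected-∷ true s))
    (cong (λ z → φ (suc k ∷ e) + z) (trans (cong (λ a → ⟦ a ⟧ φ (k ∷ e)) (sumOp-suc (selected s)))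
      (trans (op-↑ (sumOp (selected s)) φ k e) (trans (sumOp-selected s (slice φ k) e) (sym (op-↑ (lin s) φ k e))))))
  sumOp-selected (false ∷ s) φ (k ∷ e) = trans (cong (λ L → ⟦ sumOp L ⟧ φ (k ∷ e)) (selected-∷ false s))
    (trans (trans (cong (λ a → ⟦ a ⟧ φ (k ∷ e)) (sumOp-suc (selected s)))
      (trans (op-↑ (sumOp (selected s)) φ k e) (trans (sumOp-selected s (slice φ k) e) (sym (op-↑ (lin s) φ k e)))))
      (sym (ℚP.+-identityˡ _)))

  prodOp-selected : ∀ {m} (s : Vec Bool m) φ → ⟦ prodOp (selected s) ⟧ φ ≐ ⟦ xS s ⟧ φ
  prodOp-selected [] φ e = refl
  prodOp-selected (true ∷ s) φ (k ∷ e) = trans (cong (λ L → ⟦ prodOp L ⟧ φ (k ∷ e)) (selected-∷ true s))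
    (trans (cong (λ a → ⟦ a ⟧ φ (suc k ∷ e)) (prodOp-suc (selected s)))
      (trans (op-↑ (prodOp (selected s)) φ (suc k) e) (trans (prodOp-selected s (slice φ (suc k)) e) (sym (op-↑ (xS s) φ (suc k) e)))))
  prodOp-selected (false ∷ s) φ (k ∷ e) = trans (cong (λ L → ⟦ prodOp L ⟧ φ (k ∷ e)) (selected-∷ false s))
    (trans (cong (λ a → ⟦ a ⟧ φ (k ∷ e)) (prodOp-suc (selected s)))
      (trans (op-↑ (prodOp (selected s)) φ k e) (trans (prodOp-selected s (slice φ k) e) (sym (op-↑ (xS s) φ k e)))))

  Homogeneous : ∀ {m} → ℕ → Poly m → Set
  Homogeneous d p = All (λ t → V.sum (proj₂ t) ≡ d) p

  sum-⊞ : ∀ {m} (e f : Vec ℕ m) → V.sum (e ⊞ f) ≡ V.sum e +ℕ V.sum f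
  sum-⊞ [] [] = refl
  sum-⊞ (k ∷ e) (j ∷ f) = trans (cong ((k +ℕ j) +ℕ_) (sum-⊞ e f)) (lemma k j (V.sum e) (V.sum f))
    where
    open import Data.Nat.Tactic.RingSolver using () renaming (solve-∀ to solveℕ)
    lemma : ∀ a b c d → a +ℕ b +ℕ (c +ℕ d) ≡ a +ℕ c +ℕ (b +ℕ d)
    lemma = solveℕ

  *P-homogeneous : ∀ {m d d′} (p q : Poly m) → Homogeneous d p → Homogeneous d′ q → Homogeneous (d +ℕ d′) (p *P q)
  *P-homogeneous [] q hp hq = []
  *P-homogeneous (t ∷ p) q (ht ∷ hp) hq = AllP.++⁺ (AllP.map⁺ (All.map (λ {u} hu → trans (sum-⊞ (proj₂ t) (proj₂ u)) (cong₂ _+ℕ_ ht hu)) hq))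
    (*P-homogeneous p q hp hq)

  sum-replicate-0 : ∀ m → V.sum (replicate m 0) ≡ 0
  sum-replicate-0 zero = refl
  sum-replicate-0 (suc m) = sum-replicate-0 m

  oneP-homogeneous : ∀ {m} → Homogeneous 0 (oneP {m})
  oneP-homogeneous {m} = sum-replicate-0 m ∷ []

  varP-homogeneous : ∀ {m} (i : Fin m) → Homogeneous 1 (varP i)
  varP-homogeneous {m} i = go i ∷ []
    where
    go : ∀ {m} (i : Fin m) → V.sum (replicate m 0 [ i ]≔ 1) ≡ 1
    go {suc m} zero = cong suc (sum-replicate-0 m)
    go (suc i) = go i

  prodP-homogeneous : ∀ {m} (is : List (Fin m)) → Homogeneous (Data.List.length is) (prodP (map varP is))
  prodP-homogeneous [] = oneP-homogeneous
  prodP-homogeneous (i ∷ is) = *P-homogeneous (varP i) (prodP (map varP is)) (varP-homogeneous i) (prodP-homogeneous is)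

  sumP-homogeneous : ∀ {m} (is : List (Fin m)) → Homogeneous 1 (sumP (map varP is))
  sumP-homogeneous [] = []
  sumP-homogeneous (i ∷ is) = AllP.++⁺ (varP-homogeneous i) (sumP-homogeneous is)

  ^P-homogeneous : ∀ {m} (p : Poly m) → Homogeneous 1 p → ∀ k → Homogeneous k (p ^P k)
  ^P-homogeneous p h zero = oneP-homogeneous
  ^P-homogeneous p h (suc k) = *P-homogeneous p (p ^P k) h (^P-homogeneous p h k)

  ∈-monos : ∀ {m} (e : Vec ℕ m) → e ∈ monos m (V.sum e)
  ∈-monos [] = here refl
  ∈-monos {suc m} (k ∷ e) = ∈-concatMap⁺ (λ k → map (k ∷_) (monos m (k′ ∸ k))) (lose (∈-upTo⁺ (s≤s (ℕP.m≤m+n k (V.sum e))))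
    (∈-map⁺ (k ∷_) (subst (λ d → e ∈ monos m d) (sym (ℕP.m+n∸m≡n k (V.sum e))) (∈-monos e))))
    where k′ = k +ℕ V.sum e

  monos-sum : ∀ m d {e : Vec ℕ m} → e ∈ monos m d → V.sum e ≡ d
  monos-sum zero zero (here refl) = refl
  monos-sum (suc m) d mem with find (∈-concatMap⁻ (λ k → map (k ∷_) (monos m (d ∸ k))) {xs = upTo (suc d)} mem)
  ... | k , k∈ , e∈ with ∈-map⁻ (k ∷_) e∈
  ...   | e , e∈′ , refl = trans (cong (k +ℕ_) (monos-sum m (d ∸ k) e∈′)) (ℕP.m+[n∸m]≡n (ℕP.≤-pred (∈-upTo⁻ k∈)))

  monos-unique : ∀ m d → Unique (monos m d)
  monos-unique zero zero = [] ∷ []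
  monos-unique zero (suc d) = []
  monos-unique (suc m) d = AllPairsP.concat⁺
    (AllP.map⁺ (All.tabulate (λ {k} _ → map⁺ (λ { refl → refl }) (monos-unique m (d ∸ k)))))
    (AllPairsP.map⁺ (AllPairs.map (λ {j} {k} j≢k → All.tabulate (λ x∈ → All.tabulate (λ y∈ x≡y → j≢k (same x∈ y∈ x≡y)))) (upTo⁺ (suc d))))
    where
    same : ∀ {j k x y} → x ∈ map (j ∷_) (monos m (d ∸ j)) → y ∈ map (k ∷_) (monos m (d ∸ k)) → x ≡ y → j ≡ k
    same x∈ y∈ eq with ∈-map⁻ _ x∈ | ∈-map⁻ _ y∈
    ... | _ , _ , refl | _ , _ , refl with refl ← eq = refl

  coeffP-off : ∀ {m} (p : Poly m) e → All (λ t → proj₂ t ≢ e) p → coeffP p e ≡ 0ℚ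
  coeffP-off p e off = cong (λ L → sumℚ (map proj₁ L)) (ListP.filter-none (λ t → proj₂ t ≟ᵐ e) off)

  indicator : Bool → ℚ → ℚ
  indicator b x = if b then x else 0ℚ

  coeffP-Σ : ∀ {m} (p : Poly m) e → coeffP p e ≡ Σ p (λ t → indicator (does (proj₂ t ≟ᵐ e)) (proj₁ t))
  coeffP-Σ p e = Σ-filter (λ t → proj₂ t ≟ᵐ e) p proj₁

  Σ-point : ∀ {m} (L : List (Vec ℕ m)) (f : Vec ℕ m → ℚ) (x : Vec ℕ m) → Unique L → (x ∉ L → f x ≡ 0ℚ) →
    Σ L (λ e → indicator (does (x ≟ᵐ e)) (f e)) ≡ f x
  Σ-point [] f x u off = sym (off λ ())
  Σ-point (y ∷ L) f x (y∉ ∷ u) off with x ≟ᵐ y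
  ... | yes refl = trans (cong (λ z → f x + z) (Σ-0-∈ L zeros)) (ℚP.+-identityʳ (f x))
    where
    zeros : ∀ {e} → e ∈ L → indicator (does (x ≟ᵐ e)) (f e) ≡ 0ℚ
    zeros {e} e∈ with x ≟ᵐ e
    ... | yes refl = ⊥-elim (All.lookup y∉ e∈ refl)
    ... | no _ = refl
  ... | no x≢y = trans (ℚP.+-identityˡ _) (Σ-point L f x u (λ x∉ → off λ { (here eq) → x≢y eq ; (there x∈) → x∉ x∈ }))

  -- A list of terms may repeat a monomial; `pair` sums over the terms while `coeffP` collects them,
  -- and exchanging the sums identifies the two. Monomials of `p` outside `L` are harmless because φ
  -- vanishes there.
  pair-coeffP : ∀ {m} (φ : Fun m) (p : Poly m) (L : List (Vec ℕ m)) → Unique L →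
    (∀ {t} → t ∈ p → proj₂ t ∉ L → φ (proj₂ t) ≡ 0ℚ) → Σ L (λ e → φ e * coeffP p e) ≡ pair φ p
  pair-coeffP φ p L u off = begin
    Σ L (λ e → φ e * coeffP p e) ≡⟨ Σ-cong L (λ e → trans (cong (φ e *_) (coeffP-Σ p e)) (sym (Σ-*ˡ p (φ e) _))) ⟩
    Σ L (λ e → Σ p (λ t → φ e * indicator (does (proj₂ t ≟ᵐ e)) (proj₁ t))) ≡⟨ Σ-swap L p _ ⟩
    Σ p (λ t → Σ L (λ e → φ e * indicator (does (proj₂ t ≟ᵐ e)) (proj₁ t))) ≡⟨ Σ-cong-∈ p inner ⟩
    pair φ p ∎
    where
    open ≡-Reasoning
    pull : ∀ b a c → a * indicator b c ≡ c * indicator b a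
    pull true a c = ℚP.*-comm a c
    pull false a c = trans (ℚP.*-zeroʳ a) (sym (ℚP.*-zeroʳ c))
    inner : ∀ {t} → t ∈ p → Σ L (λ e → φ e * indicator (does (proj₂ t ≟ᵐ e)) (proj₁ t)) ≡ proj₁ t * φ (proj₂ t)
    inner {t} t∈ = trans (Σ-cong L (λ e → pull (does (proj₂ t ≟ᵐ e)) (φ e) (proj₁ t)))
      (trans (Σ-*ˡ L (proj₁ t) _) (cong (proj₁ t *_) (Σ-point L φ (proj₂ t) u (off t∈))))

-- Hilbert series of the Chow ring

module HilbertSeries where
  open LinearAlgebra
  open PolynomialOperators
  open LatticeOfFlats
  open Annihilators
  open PolynomialActions
  open import Data.Nat using () renaming (_+_ to _+ℕ_)
  open import Data.Bool.Properties using (T-≡)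
  open import Data.Rational using (ℚ; 0ℚ; 1ℚ; _+_; _*_)
  open import Data.Vec as V using (Vec; []; _∷_)
  open import Data.Vec.Properties using ([]=⇒lookup; lookup⇒[]=)
  open import Data.Fin.Subset.Properties using (_∈?_; _⊆?_; ⊆-antisym)
  open import Data.List using (tabulate)
  open import Data.List.Membership.Propositional using (_∈_; lose; find)
  open import Data.List.Membership.Propositional.Properties using (∈-concatMap⁺; ∈-concatMap⁻; ∈-map⁺; ∈-map⁻;
    ∈-++⁺ˡ; ∈-++⁻; ∈-filter⁺; ∈-filter⁻; ∈-allFin; ∈-lookup)
  open import Data.List.Relation.Unary.All using (All; []; _∷_)
  open import Data.List.Relation.Binary.Sublist.Propositional using () renaming (_⊆_ to _⊑_)
  open import Function.Bundles using (Equivalence)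
  open import Relation.Binary.PropositionalEquality

  length-filter-¬ : {A : Set} (p : A → Bool) (xs : List A) →
    length (filter (λ x → T? (p x)) xs) +ℕ length (filter (λ x → ¬? (T? (p x))) xs) ≡ length xs
  length-filter-¬ p [] = refl
  length-filter-¬ p (x ∷ xs) with p x
  ... | true = cong suc (length-filter-¬ p xs)
  ... | false = trans (ℕP.+-suc _ _) (cong suc (length-filter-¬ p xs))

  module _ {A : Set} where
    pick-lookup : (U : List A) (S : Subset (length U)) (i : Fin (length U)) → V.lookup S i ≡ true → List.lookup U i ∈ pick U S
    pick-lookup (C ∷ U) (true ∷ S) zero eq = here refl
    pick-lookup (C ∷ U) (true ∷ S) (suc i) eq = there (pick-lookup U S i eq)
    pick-lookup (C ∷ U) (false ∷ S) (suc i) eq = pick-lookup U S i eq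

    pick-lookup⁻ : (U : List A) (S : Subset (length U)) {Y : A} → Y ∈ pick U S → ∃ λ i → V.lookup S i ≡ true × List.lookup U i ≡ Y
    pick-lookup⁻ [] [] ()
    pick-lookup⁻ (C ∷ U) (true ∷ S) (here refl) = zero , refl , refl
    pick-lookup⁻ (C ∷ U) (true ∷ S) (there m) = let (i , p , q) = pick-lookup⁻ U S m in suc i , p , q
    pick-lookup⁻ (C ∷ U) (false ∷ S) m = let (i , p , q) = pick-lookup⁻ U S m in suc i , p , q

  ∣∣≡length-selected : ∀ {m} (S : Subset m) → length (selected S) ≡ ∣ S ∣
  ∣∣≡length-selected [] = refl
  ∣∣≡length-selected (true ∷ S) = trans (cong length (selected-∷ true S))
    (cong suc (trans (ListP.length-map suc (selected S)) (∣∣≡length-selected S)))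
  ∣∣≡length-selected (false ∷ S) = trans (cong length (selected-∷ false S)) (trans (ListP.length-map suc (selected S)) (∣∣≡length-selected S))

  module Hilbert {n : ℕ} (M : Polymatroid n) (𝒢 : Subset n → Bool) (F G : Subset n) (flatF : IsFlat M F)
                 (good : Tower.Good M F flatF (induced M 𝒢 F G)) where
    open Flats M
    open Tower M F flatF
    U : List (Subset n)
    U = induced M 𝒢 F G
    m : ℕ
    m = length U
    B : Fin m → Subset n
    B = Bel M 𝒢 F G

    -- With nothing multiplied in yet, the relative supremum is that of the Chow ring.
    supSB≡ : ∀ S b → supSB M 𝒢 F G S b ≡ sup (pick U S ++ []) (B b)
    supSB≡ S b = ⊆-antisym
      (bigJoin-least members (sup-flat (pick U S ++ []) (B b)) (sup-base (pick U S ++ []) (B b)) to)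
      (sup-least {pick U S ++ []} (bigJoin-flat members flatF) (bigJoin-base members) from)
      where
      inS? = λ i → (i ∈? S) ×-dec (B i ⊊? B b)
      members = map B (filter inS? (allFin m))
      to : ∀ {K} → K ∈ members → K ⊆ sup (pick U S ++ []) (B b)
      to mem =
        let (i , i∈ , K≡) = ∈-map⁻ B mem
            (_ , i∈S , sub) = ∈-filter⁻ inS? {xs = allFin m} i∈
        in subst (_⊆ sup (pick U S ++ []) (B b)) (sym K≡) (sup-upper (∈-++⁺ˡ (pick-lookup U S i ([]=⇒lookup i∈S))) sub)
      from : ∀ {Y} → Y ∈ pick U S ++ [] → Y ⊊ B b → Y ⊆ bigJoin M F members
      from {Y} mem sub = [ in-pick , (λ ()) ]′ (∈-++⁻ (pick U S) mem)
        where
        in-pick : Y ∈ pick U S → Y ⊆ bigJoin M F members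
        in-pick mem′ = let (i , Si , eq) = pick-lookup⁻ U S mem′ in
          subst (_⊆ bigJoin M F members) eq
            (bigJoin-upper (∈-map⁺ B (∈-filter⁺ inS? (∈-allFin i) (lookup⇒[]= i S Si , subst (_⊊ B b) (sym eq) sub))))

    expo≡ : ∀ S b → expo M 𝒢 F G S b ≡ exponent (pick U S ++ []) (B b)
    expo≡ S b = cong (λ X → rk (B b) ∸ rk X) (supSB≡ S b)

    S-selected : ∀ (S : Subset m) → filter (_∈? S) (allFin m) ≡ selected S
    S-selected S = ListP.filter-≐ (_∈? S) (lookup? S) ([]=⇒lookup , lookup⇒[]= _ S) (allFin m)

    above-selected : ∀ b → filter (λ j → B b ⊆? B j) (allFin m) ≡ selected (above U (B b))
    above-selected b = ListP.filter-≐ (λ j → B b ⊆? B j) (lookup? (above U (B b)))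
      ((λ {j} sub → trans (lookup-above U (B b) j) (dec-true (B b ⊆? B j) sub)) , (λ {j} eq → from j (trans (sym (lookup-above U (B b) j)) eq)))
      (allFin m)
      where
      from : ∀ j → does (B b ⊆? B j) ≡ true → B b ⊆ B j
      from j eq with B b ⊆? B j
      ... | yes sub = sub

    act-chowGen : ∀ S b φ → act (proj₂ (chowGen M 𝒢 F G S b)) φ ≐ ⟦ relation U [] S (B b) ⟧ φ
    act-chowGen S b φ e = begin
      act (prodP (map varP (filter (_∈? S) (allFin m))) *P (linForm M 𝒢 F G b ^P k)) φ e
        ≡⟨ act-*P (prodP (map varP (filter (_∈? S) (allFin m)))) (linForm M 𝒢 F G b ^P k) φ e ⟩
      act (prodP (map varP (filter (_∈? S) (allFin m)))) (act (linForm M 𝒢 F G b ^P k) φ) e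
        ≡⟨ act-cong (prodP (map varP (filter (_∈? S) (allFin m)))) (act-^P (linForm M 𝒢 F G b) (lin (above U (B b))) act-linForm k φ) e ⟩
      act (prodP (map varP (filter (_∈? S) (allFin m)))) (⟦ lin (above U (B b)) ^ᵒ k ⟧ φ) e
        ≡⟨ act-prodP (filter (_∈? S) (allFin m)) (⟦ lin (above U (B b)) ^ᵒ k ⟧ φ) e ⟩
      ⟦ prodOp (filter (_∈? S) (allFin m)) ⟧ (⟦ lin (above U (B b)) ^ᵒ k ⟧ φ) e
        ≡⟨ cong (λ L → ⟦ prodOp L ⟧ (⟦ lin (above U (B b)) ^ᵒ k ⟧ φ) e) (S-selected S) ⟩
      ⟦ prodOp (selected S) ⟧ (⟦ lin (above U (B b)) ^ᵒ k ⟧ φ) e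
        ≡⟨ prodOp-selected S (⟦ lin (above U (B b)) ^ᵒ k ⟧ φ) e ⟩
      ⟦ xS S ⟧ (⟦ lin (above U (B b)) ^ᵒ k ⟧ φ) e
        ≡⟨ cong (λ k → ⟦ xS S ⟧ (⟦ lin (above U (B b)) ^ᵒ k ⟧ φ) e) (expo≡ S b) ⟩
      ⟦ relation U [] S (B b) ⟧ φ e ∎
      where
      open ≡-Reasoning
      k = expo M 𝒢 F G S b
      act-linForm : ∀ φ → act (linForm M 𝒢 F G b) φ ≐ ⟦ lin (above U (B b)) ⟧ φ
      act-linForm φ e = trans (act-sumP (filter (λ j → B b ⊆? B j) (allFin m)) φ e)
        (trans (cong (λ L → ⟦ sumOp L ⟧ φ e) (above-selected b)) (sumOp-selected (above U (B b)) φ e))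

    chowGen-homogeneous : ∀ S b → Homogeneous (proj₁ (chowGen M 𝒢 F G S b)) (proj₂ (chowGen M 𝒢 F G S b))
    chowGen-homogeneous S b = *P-homogeneous (prodP (map varP (filter (_∈? S) (allFin m)))) (linForm M 𝒢 F G b ^P expo M 𝒢 F G S b)
      (subst (λ d → Homogeneous d (prodP (map varP (filter (_∈? S) (allFin m))))) (trans (cong length (S-selected S)) (∣∣≡length-selected S))
        (prodP-homogeneous (filter (_∈? S) (allFin m))))
      (^P-homogeneous (linForm M 𝒢 F G b) (sumP-homogeneous (filter (λ j → B b ⊆? B j) (allFin m))) (expo M 𝒢 F G S b))

    multiple : Vec ℕ m → Subset m → Fin m → Poly m
    multiple e S b = monoP e *P proj₂ (chowGen M 𝒢 F G S b)

    degree : Subset m → Fin m → ℕ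
    degree S b = proj₁ (chowGen M 𝒢 F G S b)

    private
      multiples : ℕ → ℕ × Poly m → List (Poly m)
      multiples d g = if proj₁ g ≤ᵇ d then map (λ e → monoP e *P proj₂ g) (monos m (d ∸ proj₁ g)) else []

    idealDeg⁺ : ∀ d e S b → V.sum e +ℕ degree S b ≡ d → multiple e S b ∈ idealDeg M 𝒢 F G d
    idealDeg⁺ d e S b eq = ∈-concatMap⁺ (multiples d) (lose gen∈ (inner (degree S b ≤ᵇ d) (Equivalence.to T-≡ (ℕP.≤⇒≤ᵇ le))))
      where
      le : degree S b ≤ d
      le = ℕP.≤-trans (ℕP.m≤n+m (degree S b) (V.sum e)) (ℕP.≤-reflexive eq)
      gen∈ : chowGen M 𝒢 F G S b ∈ chowGens M 𝒢 F G
      gen∈ = ∈-concatMap⁺ (λ S → map (chowGen M 𝒢 F G S) (allFin m)) (lose (∈-allSubsets S) (∈-map⁺ (chowGen M 𝒢 F G S) (∈-allFin b)))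
      inner : ∀ c → c ≡ true → multiple e S b ∈ (if c then map (λ e → multiple e S b) (monos m (d ∸ degree S b)) else [])
      inner true _ = ∈-map⁺ (λ e → multiple e S b) (subst (λ j → e ∈ monos m j)
        (trans (sym (ℕP.m+n∸n≡m (V.sum e) (degree S b))) (cong (_∸ degree S b) eq)) (∈-monos e))

    idealDeg⁻ : ∀ d {p} → p ∈ idealDeg M 𝒢 F G d → ∃ λ e → ∃ λ S → ∃ λ b → p ≡ multiple e S b × V.sum e +ℕ degree S b ≡ d
    idealDeg⁻ d {p} mem =
      let (g , g∈ , p∈) = find (∈-concatMap⁻ (multiples d) {xs = chowGens M 𝒢 F G} mem)
          (S , _ , g∈′) = find (∈-concatMap⁻ (λ S → map (chowGen M 𝒢 F G S) (allFin m)) {xs = allSubsets m} g∈)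
          (b , _ , g≡) = ∈-map⁻ (chowGen M 𝒢 F G S) g∈′
          (e , e∈ , p≡ , le) = inner S b (degree S b ≤ᵇ d) refl (subst (λ g → p ∈ multiples d g) g≡ p∈)
      in e , S , b , p≡ , trans (cong (_+ℕ degree S b) (monos-sum m (d ∸ degree S b) e∈)) (ℕP.m∸n+n≡m le)
      where
      inner : ∀ S b c → c ≡ (degree S b ≤ᵇ d) → p ∈ (if c then map (λ e → multiple e S b) (monos m (d ∸ degree S b)) else []) →
        ∃ λ e → e ∈ monos m (d ∸ degree S b) × p ≡ multiple e S b × degree S b ≤ d
      inner S b true eq p∈ =
        let (e , e∈ , p≡) = ∈-map⁻ (λ e → multiple e S b) p∈
        in e , e∈ , p≡ , ℕP.≤ᵇ⇒≤ (degree S b) d (Equivalence.from T-≡ (sym eq))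

    multiple-homogeneous : ∀ e S b → Homogeneous (V.sum e +ℕ degree S b) (multiple e S b)
    multiple-homogeneous e S b = *P-homogeneous (monoP e) (proj₂ (chowGen M 𝒢 F G S b)) (refl ∷ []) (chowGen-homogeneous S b)

    pair-multiple : ∀ φ e S b → pair φ (multiple e S b) ≡ ⟦ relation U [] S (B b) ⟧ φ e
    pair-multiple φ e S b = trans (pair-monoP φ e (proj₂ (chowGen M 𝒢 F G S b))) (act-chowGen S b φ e)

    idealDeg-homogeneous : ∀ d {p} → p ∈ idealDeg M 𝒢 F G d → Homogeneous d p
    idealDeg-homogeneous d p∈ =
      let (e , S , b , p≡ , eq) = idealDeg⁻ d p∈
      in subst₂ Homogeneous eq (sym p≡) (multiple-homogeneous e S b)

    std? : Vec ℕ m → Bool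
    std? = Std U []

    standard nonstandard : ℕ → List (Vec ℕ m)
    standard d = filter (λ e → T? (std? e)) (monos m d)
    nonstandard d = filter (λ e → ¬? (T? (std? e))) (monos m d)

    nonstandard-unique : ∀ d → Unique (nonstandard d)
    nonstandard-unique d = UniqueP.filter⁺ _ (monos-unique m d)

    Ann-kills : ∀ {φ} → Ann U [] φ → ∀ d {p} → p ∈ idealDeg M 𝒢 F G d → pair φ p ≡ 0ℚ
    Ann-kills {φ} ann d p∈ =
      let (e , S , b , p≡ , _) = idealDeg⁻ d p∈
      in trans (cong (pair φ) p≡) (trans (pair-multiple φ e S b) (ann S (lookup-∈ U b) e))

    lookup-surj : ∀ {K} → K ∈ U → ∃ λ b → B b ≡ K
    lookup-surj K∈ = Data.List.Relation.Unary.Any.index K∈ , sym (lookup-index K∈)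
      where
      import Data.List.Relation.Unary.Any
      open import Data.List.Relation.Unary.Any.Properties using (lookup-index)

    -- A functional concentrated in degree d vanishes on homogeneous polynomials of any other
    -- degree, so the relations need testing only on the spanning family in degree d.
    kills-Ann : ∀ d φ → (∀ e → V.sum e ≢ d → φ e ≡ 0ℚ) → (∀ {p} → p ∈ idealDeg M 𝒢 F G d → pair φ p ≡ 0ℚ) → Ann U [] φ
    kills-Ann d φ off kills S {K} K∈ e =
      subst (λ K → ⟦ xS S ⟧ (⟦ lin (above U K) ^ᵒ exponent (pick U S ++ []) K ⟧ φ) e ≡ 0ℚ) (proj₂ (lookup-surj K∈))
        (trans (sym (pair-multiple φ e S b)) (go (V.sum e +ℕ degree S b ℕ.≟ d)))
      where
      b = proj₁ (lookup-surj K∈)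
      go : Dec (V.sum e +ℕ degree S b ≡ d) → pair φ (multiple e S b) ≡ 0ℚ
      go (yes eq) = kills (idealDeg⁺ d e S b eq)
      go (no ne) = Σ-0-∈ (multiple e S b) (λ {t} t∈ → trans
        (cong (proj₁ t *_) (off (proj₂ t) (λ eq → ne (trans (sym (All.lookup (multiple-homogeneous e S b) t∈)) eq)))) (ℚP.*-zeroʳ (proj₁ t)))

    nonstandard⁻ : ∀ d {e} → e ∈ nonstandard d → V.sum e ≡ d × ¬ T (std? e)
    nonstandard⁻ d e∈ = let (e∈′ , ¬st) = ∈-filter⁻ (λ e → ¬? (T? (std? e))) {xs = monos m d} e∈ in monos-sum m d e∈′ , ¬st

    nonstandard⁺ : ∀ d {e} → V.sum e ≡ d → ¬ T (std? e) → e ∈ nonstandard d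
    nonstandard⁺ d {e} refl ¬st = ∈-filter⁺ (λ e → ¬? (T? (std? e))) (∈-monos e) ¬st

    -- Without full rank on the nonstandard monomials there would be a nonzero functional supported
    -- on them that kills the ideal; it vanishes on the standard monomials, against `Ann-unique`.
    nonstandard≤rank : ∀ d r → IsRank (idealDeg M 𝒢 F G d) r → length (nonstandard d) ≤ r
    nonstandard≤rank d r (_ , max) =
      [ no-kernel , (λ (qs , qs⊑ , len , ind) → subst (_≤ r) len (max qs qs⊑ (λ cs len z → ind cs len (λ {e} _ → z e)))) ]′
        (kernel⊎fullRank _≟ᵐ_ coeffP (nonstandard d) (nonstandard-unique d) (idealDeg M 𝒢 F G d))
      where
      no-kernel : KernelVector coeffP (nonstandard d) (idealDeg M 𝒢 F G d) → length (nonstandard d) ≤ r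
      no-kernel (φ , off , (e , e∈ , φe≢0) , kills) = ⊥-elim (φe≢0 (Ann-unique U [] good
        (kills-Ann d φ (λ e ne → off (ne ∘ proj₁ ∘ nonstandard⁻ d))
          (λ {p} p∈ → trans (sym (pair-coeffP φ p (nonstandard d) (nonstandard-unique d) (λ _ → off))) (kills p∈)))
        (λ e st → off (λ e∈ → proj₂ (nonstandard⁻ d e∈) st)) e))

    -- Elimination on the transpose, with the nonstandard monomials as rows and the independent
    -- elements `qs` as columns. Full rank gives the bound. A kernel vector gives a combination `g`
    -- of the `qs` that vanishes on the nonstandard monomials; the functionals from `Ann-exists`
    -- make it vanish on the standard ones too, against independence.
    rank≤nonstandard : ∀ d r → IsRank (idealDeg M 𝒢 F G d) r → r ≤ length (nonstandard d)
    rank≤nonstandard d r ((qs , qs⊑ , len-qs , ind) , _) = subst (_≤ length (nonstandard d)) len-qs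
      ([ (λ (c , _ , (j , _ , cj≢0) , kills) → ⊥-elim (cj≢0 (no-relation c kills j)))
       , (λ (es , es⊑ , len , _) → subst (_≤ length (nonstandard d)) (trans len (ListP.length-tabulate id)) (SublistH.length-mono-≤ es⊑)) ]′
       (kernel⊎fullRank FinP._≟_ (λ e j → coeffP (q j) e) (allFin (length qs)) (UniqueP.allFin⁺ (length qs)) (nonstandard d)))
     where
     q : Fin (length qs) → Poly m
     q = List.lookup qs
     module _ (c : Fin (length qs) → ℚ)
              (kills : ∀ {e} → e ∈ nonstandard d → Σ (allFin (length qs)) (λ j → c j * coeffP (q j) e) ≡ 0ℚ) where
      All-tabulate⁻ : ∀ {k} {f : Fin k → ℚ} → All (_≡ 0ℚ) (tabulate f) → ∀ i → f i ≡ 0ℚ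
      All-tabulate⁻ = AllP.tabulate⁻
      g : Vec ℕ m → ℚ
      g e = Σ (allFin (length qs)) (λ j → c j * coeffP (q j) e)
      lincomb-g : ∀ e → lincomb (tabulate c) qs e ≡ g e
      lincomb-g e = go qs c
        where
        go : ∀ qs (c : Fin (length qs) → ℚ) → lincomb (tabulate c) qs e ≡ Σ (allFin (length qs)) (λ j → c j * coeffP (List.lookup qs j) e)
        go [] c = refl
        go (q ∷ qs) c = cong (λ z → c zero * coeffP q e + z) (trans (go qs (c ∘ suc))
          (trans (sym (Σ-map (allFin (length qs)) suc (λ j → c j * coeffP (List.lookup (q ∷ qs) j) e)))
                 (cong (λ L → Σ L (λ j → c j * coeffP (List.lookup (q ∷ qs) j) e)) (ListP.map-tabulate id suc))))
      q∈ : ∀ j → q j ∈ idealDeg M 𝒢 F G d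
      q∈ j = SublistP.Any-resp-⊆ qs⊑ (∈-lookup j)
      g-off : ∀ e → V.sum e ≢ d → g e ≡ 0ℚ
      g-off e ne = Σ-0-∈ (allFin (length qs)) (λ {j} _ → trans
        (cong (c j *_) (coeffP-off (q j) e (All.map (λ {t} h eq → ne (trans (cong V.sum (sym eq)) h)) (idealDeg-homogeneous d (q∈ j)))))
        (ℚP.*-zeroʳ (c j)))
      g-nonstandard : ∀ e → V.sum e ≡ d → ¬ T (std? e) → g e ≡ 0ℚ
      g-nonstandard e eq ¬st = kills (nonstandard⁺ d eq ¬st)
      -- The functional extending the indicator of s kills the ideal, so it reads off g s = 0.
      g-standard : ∀ s → V.sum s ≡ d → g s ≡ 0ℚ
      g-standard s eq = trans (sym picks) total
        where
        δ : Fun m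
        δ e = indicator (does (s ≟ᵐ e)) 1ℚ
        ext = Ann-exists U [] good δ
        φ = proj₁ ext
        total : Σ (monos m d) (λ e → φ e * g e) ≡ 0ℚ
        total = begin
          Σ (monos m d) (λ e → φ e * g e)
            ≡⟨ Σ-cong (monos m d) (λ e → trans (sym (Σ-*ˡ (allFin (length qs)) (φ e) (λ j → c j * coeffP (q j) e)))
                  (Σ-cong (allFin (length qs)) (λ j → lemma (φ e) (c j) (coeffP (q j) e)))) ⟩
          Σ (monos m d) (λ e → Σ (allFin (length qs)) (λ j → c j * (φ e * coeffP (q j) e)))
            ≡⟨ Σ-swap (monos m d) (allFin (length qs)) (λ e j → c j * (φ e * coeffP (q j) e)) ⟩
          Σ (allFin (length qs)) (λ j → Σ (monos m d) (λ e → c j * (φ e * coeffP (q j) e)))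
            ≡⟨ Σ-0-∈ (allFin (length qs)) (λ {j} _ → trans (Σ-*ˡ (monos m d) (c j) (λ e → φ e * coeffP (q j) e))
                 (trans (cong (c j *_) (trans (pair-coeffP φ (q j) (monos m d) (monos-unique m d)
                     (λ {t} t∈ t∉ → ⊥-elim (t∉ (subst (λ k → proj₂ t ∈ monos m k)
                       (All.lookup (idealDeg-homogeneous d (q∈ j)) t∈) (∈-monos (proj₂ t))))))
                   (Ann-kills (proj₁ (proj₂ ext)) d (q∈ j)))) (ℚP.*-zeroʳ (c j)))) ⟩
          0ℚ ∎
          where
          open ≡-Reasoning
          open import Tactic.RingSolver using (solve-∀)
          lemma : ∀ a b c → a * (b * c) ≡ b * (a * c)
          lemma = solve-∀ ℚ-ring
        -- On standard monomials φ is the indicator of `s`, and on the nonstandard ones of degree d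
        -- the factor `g e` is zero.
        picks : Σ (monos m d) (λ e → φ e * g e) ≡ g s
        picks = trans (Σ-cong-∈ (monos m d) (λ {e} e∈ → term e e∈ (Data.Bool.T? (std? e))))
          (Σ-point (monos m d) g s (monos-unique m d) (λ s∉ → ⊥-elim (s∉ (subst (λ k → s ∈ monos m k) eq (∈-monos s)))))
          where
          import Data.Bool
          indicator-* : ∀ b x → indicator b 1ℚ * x ≡ indicator b x
          indicator-* true x = ℚP.*-identityˡ x
          indicator-* false x = ℚP.*-zeroˡ x
          indicator-0 : ∀ b → indicator b 0ℚ ≡ 0ℚ
          indicator-0 true = refl
          indicator-0 false = refl
          term : ∀ e → e ∈ monos m d → Dec (T (std? e)) → φ e * g e ≡ indicator (does (s ≟ᵐ e)) (g e)
          term e e∈ (yes st) = trans (cong (_* g e) (proj₂ (proj₂ ext) e st)) (indicator-* (does (s ≟ᵐ e)) (g e))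
          term e e∈ (no ¬st) = trans (cong (φ e *_) z) (trans (ℚP.*-zeroʳ (φ e))
            (sym (trans (cong (indicator (does (s ≟ᵐ e))) z) (indicator-0 (does (s ≟ᵐ e))))))
            where z = g-nonstandard e (monos-sum m d e∈) ¬st
      g≡0 : ∀ e → g e ≡ 0ℚ
      g≡0 e = decide (V.sum e ℕ.≟ d)
        where
        decide : Dec (V.sum e ≡ d) → g e ≡ 0ℚ
        decide (yes eq) = g-standard e eq
        decide (no ne) = g-off e ne
      no-relation : ∀ j → c j ≡ 0ℚ
      no-relation = All-tabulate⁻ (ind (tabulate c) (ListP.length-tabulate c) (λ e → trans (lincomb-g e) (g≡0 e)))

    -- The two rank bounds meet at the number of nonstandard monomials, which leaves the standard
    -- ones for the quotient.
    hilbert-standard : ∀ h → IsChowHilbertSeries M 𝒢 F G h → ∀ d → h d ≡ length (standard d)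
    hilbert-standard h hs d =
      let (r , isRank , eq) = hs d
      in ℕP.+-cancelʳ-≡ r _ _ (trans eq (trans (sym (length-filter-¬ std? (monos m d)))
           (cong (length (standard d) +ℕ_) (ℕP.≤-antisym (nonstandard≤rank d r isRank) (rank≤nonstandard d r isRank)))))

-- Incidence algebra and Möbius inversion

module IncidenceAlgebras where
  open FiniteSums
  open LatticeOfFlats
  open BuildingSets using (⊊⇒∣<∣)
  open import Data.Integer as ℤ using (ℤ; +_)
  open import Data.Fin.Subset.Properties using (_⊆?_; ⊆-antisym; ∣p∣≤n)
  open import Data.List.Membership.Propositional using (_∈_)
  open import Data.List.Membership.Propositional.Properties using (∈-filter⁻)
  open import Data.List.Relation.Unary.AllPairs using (_∷_)
  import Relation.Binary.PropositionalEquality as ≡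

  open ≡ using (_≡_; _≢_)

  module Guards (R : CommutativeRing 0ℓ 0ℓ) where
    open CommutativeRing R
    open Sum R public
    open import Relation.Binary.Reasoning.Setoid setoid

    when : {P : Set} → Dec P → Carrier → Carrier
    when p x = if does p then x else 0#

    when-yes : {P : Set} (p : Dec P) {x : Carrier} → P → when p x ≈ x
    when-yes (yes _) _ = refl
    when-yes (no ¬p) p = ⊥-elim (¬p p)

    when-no : {P : Set} (p : Dec P) {x : Carrier} → ¬ P → when p x ≈ 0#
    when-no (yes p) ¬p = ⊥-elim (¬p p)
    when-no (no _) _ = refl

    when-⇔ : {P Q : Set} (p : Dec P) (q : Dec Q) {x : Carrier} → (P → Q) → (Q → P) → when p x ≈ when q x
    when-⇔ (yes p) q f g = sym (when-yes q (f p))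
    when-⇔ (no ¬p) q f g = sym (when-no q (¬p ∘ g))

    when-cong : {P : Set} (p : Dec P) {x y : Carrier} → (P → x ≈ y) → when p x ≈ when p y
    when-cong (yes p) f = f p
    when-cong (no _) f = refl

    when-when : {P Q : Set} (p : Dec P) (q : Dec Q) {x : Carrier} → when p (when q x) ≈ when (p ×-dec q) x
    when-when (yes _) (yes _) = refl
    when-when (yes _) (no _) = refl
    when-when (no _) q = refl

    when-Σ : {P A : Set} (p : Dec P) (L : List A) (f : A → Carrier) → when p (Σ L f) ≈ Σ L (λ x → when p (f x))
    when-Σ (yes _) L f = refl
    when-Σ (no _) L f = sym (Σ-0 L)

    when-* : {P : Set} (p : Dec P) {x y : Carrier} → when p x * y ≈ when p (x * y)
    when-* (yes _) = refl
    when-* (no _) = zeroˡ _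

    Σ-only : {A : Set} (_≟_ : (x y : A) → Dec (x ≡ y)) (L : List A) → Unique L → (y : A) → y ∈ L →
      (f : A → Carrier) → Σ L (λ x → when (y ≟ x) (f x)) ≈ f y
    Σ-only _≟_ (x ∷ L) (x∉ ∷ u) y (here ≡.refl) f = begin
      when (y ≟ y) (f y) + Σ L (λ x → when (y ≟ x) (f x))
        ≈⟨ +-cong (when-yes (y ≟ y) ≡.refl) (Σ-0-∈ L (λ {z} z∈ → when-no (y ≟ z) (λ { ≡.refl → All.lookup x∉ z∈ ≡.refl }))) ⟩
      f y + 0# ≈⟨ +-identityʳ (f y) ⟩
      f y ∎
    Σ-only _≟_ (x ∷ L) (x∉ ∷ u) y (there y∈) f = begin
      when (y ≟ x) (f x) + Σ L (λ x → when (y ≟ x) (f x))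
        ≈⟨ +-cong (when-no (y ≟ x) (λ { ≡.refl → All.lookup x∉ y∈ ≡.refl })) (Σ-only _≟_ L u y y∈ f) ⟩
      0# + f y ≈⟨ +-identityˡ (f y) ⟩
      f y ∎

    Σ-remove : {A : Set} (_≟_ : (x y : A) → Dec (x ≡ y)) (L : List A) → Unique L → (y : A) → y ∈ L →
      (f : A → Carrier) → (∀ {x} → x ∈ L → x ≢ y → f x ≈ 0#) → Σ L f ≈ f y
    Σ-remove _≟_ L u y y∈ f z = trans (Σ-cong-∈ L (λ {x} x∈ → go x x∈ (y ≟ x))) (Σ-only _≟_ L u y y∈ f)
      where
      go : ∀ x → x ∈ L → (d : Dec (y ≡ x)) → f x ≈ when d (f x)
      go x x∈ (yes _) = refl
      go x x∈ (no y≢x) = z x∈ (y≢x ∘ ≡.sym)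

  module Intervals {n : ℕ} (M : Polymatroid n) where
    open Flats M

    module Incidence (R : CommutativeRing 0ℓ 0ℓ) where
      open CommutativeRing R
      open Guards R public
      open import Relation.Binary.Reasoning.Setoid setoid

      Σ-interval : ∀ F G (f : Subset n → Carrier) →
        Σ (interval M F G) f ≈ Σ (flats M) (λ H → when ((F ⊆? H) ×-dec (H ⊆? G)) (f H))
      Σ-interval F G f = Σ-filter (λ H → (F ⊆? H) ×-dec (H ⊆? G)) (flats M) f

      -- Both sides run over the chains F ⊆ K ⊆ H ⊆ G; guarded sums over all flats make this a plain
      -- exchange.
      Σ-interval-swap : ∀ F G (f : Subset n → Subset n → Carrier) →
        Σ (interval M F G) (λ H → Σ (interval M F H) (λ K → f K H)) ≈
        Σ (interval M F G) (λ K → Σ (interval M K G) (λ H → f K H))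
      Σ-interval-swap F G f = begin
        Σ (interval M F G) (λ H → Σ (interval M F H) (λ K → f K H)) ≈⟨ expand F (λ H → H) (λ K H → f K H) ⟩
        Σ L (λ H → Σ L (λ K → when (in? F G H ×-dec in? F H K) (f K H))) ≈⟨ Σ-swap L L _ ⟩
        Σ L (λ K → Σ L (λ H → when (in? F G H ×-dec in? F H K) (f K H)))
          ≈⟨ Σ-cong L (λ K → Σ-cong L (λ H → when-⇔ (in? F G H ×-dec in? F H K) (in? F G K ×-dec in? K G H)
               (λ ((a , b) , (c , d)) → ((λ {x} → c {x}) , (λ {x} y → b (d {x} y))) , ((λ {x} → d {x}) , (λ {x} → b {x})))
               (λ ((a , b) , (c , d)) → ((λ {x} y → c (a {x} y)) , (λ {x} → d {x})) , ((λ {x} → a {x}) , (λ {x} → c {x}))))) ⟩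
        Σ L (λ K → Σ L (λ H → when (in? F G K ×-dec in? K G H) (f K H))) ≈⟨ expand′ ⟨
        Σ (interval M F G) (λ K → Σ (interval M K G) (λ H → f K H)) ∎
        where
        L = flats M
        in? : ∀ A B H → Dec (A ⊆ H × H ⊆ B)
        in? A B H = (A ⊆? H) ×-dec (H ⊆? B)
        expand : ∀ A (B : Subset n → Subset n) (g : Subset n → Subset n → Carrier) →
          Σ (interval M F G) (λ H → Σ (interval M A (B H)) (λ K → g K H)) ≈
          Σ L (λ H → Σ L (λ K → when (in? F G H ×-dec in? A (B H) K) (g K H)))
        expand A B g = trans (Σ-interval F G _) (Σ-cong L (λ H → trans (when-cong (in? F G H) (λ _ → Σ-interval A (B H) (λ K → g K H)))
          (trans (when-Σ (in? F G H) L _) (Σ-cong L (λ K → when-when (in? F G H) (in? A (B H) K))))))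
        expand′ : Σ (interval M F G) (λ K → Σ (interval M K G) (λ H → f K H)) ≈
          Σ L (λ K → Σ L (λ H → when (in? F G K ×-dec in? K G H) (f K H)))
        expand′ = trans (Σ-interval F G _) (Σ-cong L (λ K → trans (when-cong (in? F G K) (λ _ → Σ-interval K G (λ H → f K H)))
          (trans (when-Σ (in? F G K) L _) (Σ-cong L (λ H → when-when (in? F G K) (in? K G H))))))

      Inc : Set
      Inc = Subset n → Subset n → Carrier

      conv : Inc → Inc → Inc
      conv a b F G = Σ (interval M F G) (λ H → a F H * b H G)

      δ : Inc
      δ F G = when (F ≟ₛ G) 1#

      conv-assoc : ∀ a b c F G → Σ (interval M F G) (λ H → conv a b F H * c H G) ≈ Σ (interval M F G) (λ K → a F K * conv b c K G)
      conv-assoc a b c F G = begin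
        Σ (interval M F G) (λ H → conv a b F H * c H G)
          ≈⟨ Σ-cong (interval M F G) (λ H → trans (sym (Σ-*ʳ (interval M F H) (c H G) _)) (Σ-cong (interval M F H) (λ K → *-assoc _ _ _))) ⟩
        Σ (interval M F G) (λ H → Σ (interval M F H) (λ K → a F K * (b K H * c H G)))
          ≈⟨ Σ-interval-swap F G _ ⟩
        Σ (interval M F G) (λ K → Σ (interval M K G) (λ H → a F K * (b K H * c H G)))
          ≈⟨ Σ-cong (interval M F G) (λ K → Σ-*ˡ (interval M K G) (a F K) _) ⟩
        Σ (interval M F G) (λ K → a F K * conv b c K G) ∎

      conv-point : ∀ a b {F} → IsFlat M F → conv a b F F ≈ a F F * b F F
      conv-point a b {F} flatF = Σ-remove _≟ₛ_ (interval M F F) (interval-unique F F) F (interval⁺ flatF id id) _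
        (λ m ne → ⊥-elim (ne (let (_ , F⊆K , K⊆F) = interval⁻ m in ⊆-antisym K⊆F F⊆K)))

      -- A left inverse of b with unit diagonal is also a right inverse: in
      -- a = (a b) a = a (b a), all terms of a (b a) but the first are known by induction on
      -- the codimension of F.
      conv-inverse-comm : ∀ a b → (∀ {F} → IsFlat M F → a F F ≈ 1#) →
        (∀ {F G} → IsFlat M F → IsFlat M G → F ⊆ G → conv a b F G ≈ δ F G) →
        ∀ {F G} → IsFlat M F → IsFlat M G → F ⊆ G → conv b a F G ≈ δ F G
      conv-inverse-comm a b a-diag ab≈δ {F} {G} flatF flatG = go n F (ℕP.m≤n+m n ∣ F ∣) flatF
        where
        go : ∀ k F → n ≤ ∣ F ∣ ℕ.+ k → IsFlat M F → F ⊆ G → conv b a F G ≈ δ F G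
        go k F bound flatF F⊆G with F ≟ₛ G
        ... | yes ≡.refl = trans (conv-point b a flatF) (trans (*-comm _ _)
                (trans (sym (conv-point a b flatF)) (trans (ab≈δ flatF flatF id) (when-yes (F ≟ₛ F) ≡.refl))))
        ... | no F≢G = rest k bound
          where
          I = interval M F G
          left : Σ I (λ K → a F K * conv b a K G) ≈ a F G
          left = begin
            Σ I (λ K → a F K * conv b a K G) ≈⟨ conv-assoc a b a F G ⟨
            Σ I (λ H → conv a b F H * a H G)
              ≈⟨ Σ-cong-∈ I (λ {H} m → let (flatH , F⊆H , _) = interval⁻ m in
                   trans (*-congʳ (ab≈δ flatF flatH F⊆H)) (trans (when-* (F ≟ₛ H)) (when-cong (F ≟ₛ H) (λ _ → *-identityˡ _)))) ⟩
            Σ I (λ H → when (F ≟ₛ H) (a H G)) ≈⟨ Σ-only _≟ₛ_ I (interval-unique F G) F (interval⁺ flatF id F⊆G) _ ⟩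
            a F G ∎
          rest : ∀ k → n ≤ ∣ F ∣ ℕ.+ k → conv b a F G ≈ 0#
          rest zero bound = ⊥-elim (ℕP.<-irrefl ≡.refl (ℕP.<-≤-trans (⊊⇒∣<∣ ((λ {x} → F⊆G {x}) , F≢G))
            (ℕP.≤-trans (∣p∣≤n G) (≡.subst (n ≤_) (ℕP.+-identityʳ _) bound))))
          rest (suc k) bound = begin
            conv b a F G ≈⟨ *-identityˡ _ ⟨
            1# * conv b a F G ≈⟨ *-congʳ (a-diag flatF) ⟨
            a F F * conv b a F G ≈⟨ +-identityʳ _ ⟨
            a F F * conv b a F G + 0# ≈⟨ +-congˡ (-‿inverseʳ (a F G)) ⟨
            a F F * conv b a F G + (a F G + - a F G) ≈⟨ +-assoc _ _ _ ⟨
            (a F F * conv b a F G + a F G) + - a F G ≈⟨ +-congʳ split ⟨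
            Σ I (λ K → a F K * conv b a K G) + - a F G ≈⟨ +-congʳ left ⟩
            a F G + - a F G ≈⟨ -‿inverseʳ (a F G) ⟩
            0# ∎
            where
            -- By induction the factor `conv b a K G` of a term with K ≠ F is δ_{KG}, since K is
            -- larger than F; of these terms only K = G survives.
            split : Σ I (λ K → a F K * conv b a K G) ≈ a F F * conv b a F G + a F G
            split = begin
              Σ I (λ K → a F K * conv b a K G)
                ≈⟨ Σ-cong-∈ I (λ {K} m → term K m) ⟩
              Σ I (λ K → when (F ≟ₛ K) (a F K * conv b a K G) + when (G ≟ₛ K) (a F K))
                ≈⟨ Σ-+ I _ _ ⟩
              Σ I (λ K → when (F ≟ₛ K) (a F K * conv b a K G)) + Σ I (λ K → when (G ≟ₛ K) (a F K))
                ≈⟨ +-cong (Σ-only _≟ₛ_ I (interval-unique F G) F (interval⁺ flatF id F⊆G) _)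
                          (Σ-only _≟ₛ_ I (interval-unique F G) G (interval⁺ flatG F⊆G id) _) ⟩
              a F F * conv b a F G + a F G ∎
              where
              larger : ∀ K → F ⊆ K → F ≢ K → n ≤ ∣ K ∣ ℕ.+ k
              larger K F⊆K F≢K = ℕP.≤-trans bound
                (≡.subst (_≤ ∣ K ∣ ℕ.+ k) (≡.sym (ℕP.+-suc ∣ F ∣ k)) (ℕP.+-monoˡ-≤ k (⊊⇒∣<∣ ((λ {x} → F⊆K {x}) , F≢K))))
              term : ∀ K → K ∈ I → a F K * conv b a K G ≈ when (F ≟ₛ K) (a F K * conv b a K G) + when (G ≟ₛ K) (a F K)
              term K m with F ≟ₛ K
              ... | yes ≡.refl = sym (trans (+-congˡ (when-no (G ≟ₛ F) (F≢G ∘ ≡.sym))) (+-identityʳ _))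
              ... | no F≢K = let (flatK , F⊆K , K⊆G) = interval⁻ m in begin
                a F K * conv b a K G ≈⟨ *-congˡ (go k K (larger K F⊆K F≢K) flatK K⊆G) ⟩
                a F K * δ K G ≈⟨ *-comm _ _ ⟩
                δ K G * a F K ≈⟨ trans (when-* (K ≟ₛ G)) (when-cong (K ≟ₛ G) (λ _ → *-identityˡ _)) ⟩
                when (K ≟ₛ G) (a F K) ≈⟨ when-⇔ (K ≟ₛ G) (G ≟ₛ K) ≡.sym ≡.sym ⟩
                when (G ≟ₛ K) (a F K) ≈⟨ +-identityˡ _ ⟨
                0# + when (G ≟ₛ K) (a F K) ∎

    module Möbius where
      open Incidence ℤP.+-*-commutativeRing
      open ≡ using (refl; sym; trans; cong)

      mobiusFuel-same : ∀ k F H → F ≡ H → mobiusFuel M (suc k) F H ≡ + 1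
      mobiusFuel-same k F H eq with F ≟ₛ H
      ... | yes _ = refl
      ... | no ne = ⊥-elim (ne eq)

      mobiusFuel-step : ∀ k F H → F ≢ H →
        mobiusFuel M (suc k) F H ≡ ℤ.- sumℤ (map (mobiusFuel M k F) (filter (λ K → K ⊊? H) (interval M F H)))
      mobiusFuel-step k F H ne with F ≟ₛ H
      ... | yes eq = ⊥-elim (ne eq)
      ... | no _ = refl

      -- The recursion descends to proper subsets of `H`, so all fuels above the size of `H` give
      -- the same value.
      mobiusFuel-stable : ∀ j k F H → ∣ H ∣ < j → ∣ H ∣ < k → mobiusFuel M j F H ≡ mobiusFuel M k F H
      mobiusFuel-stable (suc j) (suc k) F H (s≤s hj) (s≤s hk) = go (F ≟ₛ H)
        where
        go : Dec (F ≡ H) → mobiusFuel M (suc j) F H ≡ mobiusFuel M (suc k) F H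
        go (yes eq) = trans (mobiusFuel-same j F H eq) (sym (mobiusFuel-same k F H eq))
        go (no ne) = trans (mobiusFuel-step j F H ne) (trans (cong ℤ.-_ (Σ-cong-∈ (filter (λ K → K ⊊? H) (interval M F H)) (λ {K} m →
            let K⊊H = proj₂ (∈-filter⁻ (λ K → K ⊊? H) {xs = interval M F H} m) in
            mobiusFuel-stable j k F K (ℕP.<-≤-trans (⊊⇒∣<∣ K⊊H) hj) (ℕP.<-≤-trans (⊊⇒∣<∣ K⊊H) hk))))
          (sym (mobiusFuel-step k F H ne)))

      μ-same : ∀ F → μ M F F ≡ + 1
      μ-same F = mobiusFuel-same n F F refl

      μ-step : ∀ F H → F ≢ H → μ M F H ≡ ℤ.- Σ (filter (λ K → K ⊊? H) (interval M F H)) (μ M F)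
      μ-step F H ne = trans (mobiusFuel-step n F H ne) (cong ℤ.-_ (Σ-cong-∈ (filter (λ K → K ⊊? H) (interval M F H)) (λ {K} m →
        let K⊊H = proj₂ (∈-filter⁻ (λ K → K ⊊? H) {xs = interval M F H} m) in
        mobiusFuel-stable n (suc n) F K (ℕP.<-≤-trans (⊊⇒∣<∣ K⊊H) (∣p∣≤n H)) (s≤s (∣p∣≤n K)))))

      ζ : Inc
      ζ _ _ = + 1

      μ-left : ∀ {F G} → IsFlat M F → IsFlat M G → F ⊆ G → conv (μ M) ζ F G ≡ δ F G
      μ-left {F} {G} flatF flatG F⊆G with F ≟ₛ G
      ... | yes refl = trans (conv-point (μ M) ζ flatF) (cong (ℤ._* + 1) (μ-same F))
      ... | no F≢G = begin
        conv (μ M) ζ F G ≡⟨ Σ-cong I (λ K → ℤP.*-identityʳ (μ M F K)) ⟩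
        Σ I (μ M F) ≡⟨ Σ-cong-∈ I (λ {K} m → term K m) ⟩
        Σ I (λ K → when (G ≟ₛ K) (μ M F K) ℤ.+ when (K ⊊? G) (μ M F K)) ≡⟨ Σ-+ I _ _ ⟩
        Σ I (λ K → when (G ≟ₛ K) (μ M F K)) ℤ.+ Σ I (λ K → when (K ⊊? G) (μ M F K))
          ≡⟨ ≡.cong₂ ℤ._+_ (trans (Σ-only _≟ₛ_ I (interval-unique F G) G (interval⁺ flatG F⊆G id) (μ M F)) (μ-step F G F≢G))
               (sym (Σ-filter (λ K → K ⊊? G) I (μ M F))) ⟩
        ℤ.- S ℤ.+ S ≡⟨ ℤP.+-inverseˡ S ⟩
        + 0 ∎
        where
        open ≡.≡-Reasoning
        I = interval M F G
        S = Σ (filter (λ K → K ⊊? G) I) (μ M F)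
        term : ∀ K → K ∈ I → μ M F K ≡ when (G ≟ₛ K) (μ M F K) ℤ.+ when (K ⊊? G) (μ M F K)
        term K m = go (G ≟ₛ K)
          where
          go : (d : Dec (G ≡ K)) → μ M F K ≡ when d (μ M F K) ℤ.+ when (K ⊊? G) (μ M F K)
          go (yes refl) = sym (trans (cong (λ z → μ M F K ℤ.+ z) (when-no (K ⊊? G) {μ M F K} (λ (_ , ne) → ne refl))) (ℤP.+-identityʳ _))
          go (no G≢K) = sym (trans (ℤP.+-identityˡ _) (when-yes (K ⊊? G) ((λ {x} → proj₂ (proj₂ (interval⁻ m)) {x}) , G≢K ∘ sym)))

      -- The recursive definition controls sums of μ over its upper argument; characteristic
      -- polynomials need sums over the lower one, which is the other side of the inverse.
      μ-right : ∀ {F G} → IsFlat M F → IsFlat M G → F ⊆ G → conv ζ (μ M) F G ≡ δ F G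
      μ-right = conv-inverse-comm (μ M) ζ (λ {F} _ → μ-same F) μ-left

-- The inversion identity

module WeightedCounts where
  open LatticeOfFlats
  open BuildingSets
  open IncidenceAlgebras
  open Annihilators using (module Tower)
  open import Data.Fin.Subset.Properties using (_⊆?_; ⊆-antisym; p∩q⊆p; p∩q⊆q)
  open import Data.List.Membership.Propositional using (_∈_)
  open import Data.List.Membership.Propositional.Properties using (∈-++⁻; ∈-++⁺ˡ; ∈-++⁺ʳ)
  open import Data.List.Relation.Unary.AllPairs using (AllPairs; []; _∷_)
  open import Data.List.Relation.Unary.All using (All; []; _∷_)
  import Relation.Binary.PropositionalEquality as ≡

  open ≡ using (_≡_; _≢_)

  module Combinatorics {n : ℕ} (M : Polymatroid n) (loopless : Loopless M)
    (𝒢 : Subset n → Bool) (building : IsBuildingSet M 𝒢)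
    (R : CommutativeRing 0ℓ 0ℓ) where

    open CommutativeRing R
    open Building M loopless 𝒢 building
    open Intervals M
    open Incidence R
    open import Relation.Binary.Reasoning.Setoid setoid

    private
      infixr 6 _∨ᴹ_
      _∨ᴹ_ : Subset n → Subset n → Subset n
      _∨ᴹ_ = _∨_ M
      Flat : Subset n → Set
      Flat = IsFlat M

    open import Algebra.Properties.CommutativeSemigroup *-commutativeSemigroup using () renaming (x∙yz≈y∙xz to swap-factors)
    open import Algebra.Properties.CommutativeSemigroup +-commutativeSemigroup using (interchange)

    factor-out : ∀ a x b c d → a * (x * b) + c * (x * d) ≈ x * (a * b + c * d)
    factor-out a x b c d = trans (+-cong (swap-factors a x b) (swap-factors c x d)) (sym (distribˡ x _ _))

    expand : ∀ a p g q y → (a * p + g * q) * y ≈ a * (p * y) + g * (q * y)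
    expand a p g q y = trans (distribʳ y _ _) (+-cong (*-assoc a p y) (*-assoc g q y))

    collect : ∀ l k r g → l * (k * r) + g * r ≈ (l * k + g) * r
    collect l k r g = trans (+-congʳ (sym (*-assoc l k r))) (sym (distribʳ r _ _))

    regroup : ∀ a l A k B g A′ B′ → a * (l * A + k * B) + g * (l * A′ + k * B′) ≈ l * (a * A + g * A′) + k * (a * B + g * B′)
    regroup a l A k B g A′ B′ = begin
      a * (l * A + k * B) + g * (l * A′ + k * B′) ≈⟨ +-cong (distribˡ a _ _) (distribˡ g _ _) ⟩
      (a * (l * A) + a * (k * B)) + (g * (l * A′) + g * (k * B′)) ≈⟨ interchange _ _ _ _ ⟩
      (a * (l * A) + g * (l * A′)) + (a * (k * B) + g * (k * B′)) ≈⟨ +-cong (factor-out a l A g A′) (factor-out a k B g B′) ⟩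
      l * (a * A + g * A′) + k * (a * B + g * B′) ∎

    -- For J ⊆ G and a factor `W` of G, the rank gained by joining `W` to `J`, as `rk-∨-gap` shows.
    gap : Subset n → Subset n → ℕ
    gap J W = rk W ∸ rk (J ∩ W)

    rk-∨-gap : ∀ {G W J} → Flat G → W ∈ factors G → Flat J → J ⊆ G → rk (J ∨ᴹ W) ≡ rk J ℕ.+ gap J W
    rk-∨-gap {G} {W} {J} flatG W∈ flatJ J⊆G = ≡.trans
      (≡.trans (≡.sym (ℕP.m+n∸n≡m (rk (J ∨ᴹ W)) (rk (J ∩ W)))) (≡.cong (_∸ rk (J ∩ W)) (rk-modular flatG W∈ flatJ J⊆G)))
      (ℕP.+-∸-assoc (rk J) (rk-mono (p∩q⊆q J W)))

    -- Joining another factor leaves the part of `J` inside `W` unchanged, by independence of the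
    -- factors.
    gap-∨ : ∀ {G W W′ J} → Flat G → W ∈ factors G → W′ ∈ factors G → W′ ≢ W → Flat J → J ⊆ G → gap (J ∨ᴹ W′) W ≡ gap J W
    gap-∨ {G} {W} {W′} {J} flatG W∈ W′∈ W′≢W flatJ J⊆G = ≡.cong (λ X → rk W ∸ rk X) (⊆-antisym
      (∩-greatest
        (factor-independent flatG W∈ (∩-flat (∨-flat J W′) (factor-flat W∈)) (p∩q⊆q (J ∨ᴹ W′) W) flatJ J⊆G
          (∨-least (∨-flat J (others G W)) (∨-upperˡ J (others G W)) (∨-upperʳ J (others G W) ∘ others-upper W′∈ W′≢W) ∘ p∩q⊆p (J ∨ᴹ W′) W))
        (p∩q⊆q (J ∨ᴹ W′) W))
      (∩-greatest (∨-upperˡ J W′ ∘ p∩q⊆p J W) (p∩q⊆q J W)))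

    ∨-swap : ∀ J W W′ → (J ∨ᴹ W) ∨ᴹ W′ ≡ (J ∨ᴹ W′) ∨ᴹ W
    ∨-swap J W W′ = ⊆-antisym (half W W′) (half W′ W)
      where
      half : ∀ W W′ → (J ∨ᴹ W) ∨ᴹ W′ ⊆ (J ∨ᴹ W′) ∨ᴹ W
      half W W′ = ∨-least flat (∨-least flat (∨-upperˡ (J ∨ᴹ W′) W ∘ ∨-upperˡ J W′) (∨-upperʳ (J ∨ᴹ W′) W)) (∨-upperˡ (J ∨ᴹ W′) W ∘ ∨-upperʳ J W′)
        where flat = ∨-flat (J ∨ᴹ W′) W

    ∨-idem : ∀ J W → (J ∨ᴹ W) ∨ᴹ W ≡ J ∨ᴹ W
    ∨-idem J W = ⊆-antisym (∨-least (∨-flat J W) id (∨-upperʳ J W)) (∨-upperˡ (J ∨ᴹ W) W)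

    module Weights (u v : Carrier) (u+v≈1 : u + v ≈ 1#)
      (xpow : ℕ → Carrier) (xpow-+ : ∀ j k → xpow (j ℕ.+ k) ≈ xpow j * xpow k)
      (χ : Inc) (G : Subset n) (flatG : Flat G)
      (Σχ : ∀ {J} → Flat J → J ⊆ G → Σ (interval M J G) (λ K → χ K G) ≈ xpow (rk G ∸ rk J)) where

      -- With u = 1/(1 - x) this is 1/(1 - x)^k, where k counts the entries of `ms` not below `K`.
      weight : List (Subset n) → Subset n → Carrier
      weight ms K = foldr (λ W w → (if does (W ⊆? K) then 1# else u) * w) 1# ms

      ρ : Subset n → List (Subset n) → Carrier
      ρ J ms = Σ (interval M J G) (λ K → χ K G * weight ms K)

      ρ-[] : ∀ {J} → Flat J → J ⊆ G → ρ J [] ≈ xpow (rk G ∸ rk J)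
      ρ-[] {J} flatJ J⊆G = trans (Σ-cong (interval M J G) (λ K → *-identityʳ _)) (Σχ flatJ J⊆G)

      -- As u + v = 1, the weight at `W` is u + v[W ⊆ K], and the flats above both `J` and `W` are
      -- those above J ∨ W.
      ρ-∷ : ∀ J W ms → ρ J (W ∷ ms) ≈ u * ρ J ms + v * ρ (J ∨ᴹ W) ms
      ρ-∷ J W ms = begin
        Σ I (λ K → χ K G * ((if does (W ⊆? K) then 1# else u) * weight ms K)) ≈⟨ Σ-cong I (λ K → term K (W ⊆? K)) ⟩
        Σ I (λ K → u * f K + v * when (W ⊆? K) (f K)) ≈⟨ Σ-+ I _ _ ⟩
        Σ I (λ K → u * f K) + Σ I (λ K → v * when (W ⊆? K) (f K)) ≈⟨ +-cong (Σ-*ˡ I u f) (Σ-*ˡ I v _) ⟩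
        u * ρ J ms + v * Σ I (λ K → when (W ⊆? K) (f K)) ≈⟨ +-congˡ (*-congˡ restrict) ⟩
        u * ρ J ms + v * ρ (J ∨ᴹ W) ms ∎
        where
        I = interval M J G
        f = λ K → χ K G * weight ms K
        term : ∀ K (d : Dec (W ⊆ K)) → χ K G * ((if does d then 1# else u) * weight ms K) ≈ u * f K + v * when d (f K)
        term K (yes _) = begin
          χ K G * (1# * weight ms K) ≈⟨ swap-factors _ _ _ ⟩
          1# * f K ≈⟨ *-congʳ u+v≈1 ⟨
          (u + v) * f K ≈⟨ distribʳ _ _ _ ⟩
          u * f K + v * f K ∎
        term K (no _) = trans (swap-factors _ _ _) (sym (trans (+-congˡ (zeroʳ v)) (+-identityʳ _)))
        in? : ∀ A K → Dec (A ⊆ K × K ⊆ G)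
        in? A K = (A ⊆? K) ×-dec (K ⊆? G)
        restrict : Σ I (λ K → when (W ⊆? K) (f K)) ≈ Σ (interval M (J ∨ᴹ W) G) f
        restrict = begin
          Σ I (λ K → when (W ⊆? K) (f K)) ≈⟨ Σ-interval J G _ ⟩
          Σ (flats M) (λ K → when (in? J K) (when (W ⊆? K) (f K)))
            ≈⟨ Σ-cong-∈ (flats M) (λ {K} m → trans (when-when (in? J K) (W ⊆? K)) (when-⇔ (in? J K ×-dec (W ⊆? K)) (in? (J ∨ᴹ W) K)
                 (λ ((J⊆K , K⊆G) , W⊆K) → (λ {x} → ∨-least (flats-flat m) J⊆K W⊆K {x}) , λ {x} → K⊆G {x})
                 (λ (sub , K⊆G) → ((λ {x} y → sub (∨-upperˡ J W {x} y)) , λ {x} → K⊆G {x}) , λ {x} y → sub (∨-upperʳ J W {x} y)))) ⟩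
          Σ (flats M) (λ K → when (in? (J ∨ᴹ W) K) (f K)) ≈⟨ Σ-interval (J ∨ᴹ W) G f ⟨
          Σ (interval M (J ∨ᴹ W) G) f ∎

      module _ {W : Subset n} (W∈ : W ∈ factors G) where
        private
          join⊆ : ∀ {J W′} → J ⊆ G → W′ ∈ factors G → J ∨ᴹ W′ ⊆ G
          join⊆ J⊆G W′∈ = ∨-least flatG J⊆G (factor-⊆ W′∈)

        -- For the empty list the power of x is the rank gained by joining `W`. The same power comes
        -- out of both branches of `ρ-∷`, because other factors do not change the gap.
        ρ-outside : ∀ ms → (∀ {W′} → W′ ∈ ms → W′ ∈ factors G × W′ ≢ W) → ∀ {J} → Flat J → J ⊆ G →
          ρ J ms ≈ xpow (gap J W) * ρ (J ∨ᴹ W) ms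
        ρ-outside [] p {J} flatJ J⊆G = begin
          ρ J [] ≈⟨ ρ-[] flatJ J⊆G ⟩
          xpow (rk G ∸ rk J) ≈⟨ reflexive (≡.cong xpow split) ⟩
          xpow (gap J W ℕ.+ (rk G ∸ rk (J ∨ᴹ W))) ≈⟨ xpow-+ _ _ ⟩
          xpow (gap J W) * xpow (rk G ∸ rk (J ∨ᴹ W)) ≈⟨ *-congˡ (ρ-[] (∨-flat J W) (join⊆ J⊆G W∈)) ⟨
          xpow (gap J W) * ρ (J ∨ᴹ W) [] ∎
          where
          split : rk G ∸ rk J ≡ gap J W ℕ.+ (rk G ∸ rk (J ∨ᴹ W))
          split = ≡.trans (≡.cong (_∸ rk J) (≡.sym (ℕP.m+[n∸m]≡n (rk-mono (join⊆ J⊆G W∈)))))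
            (≡.trans (≡.cong (λ r → r ℕ.+ (rk G ∸ rk (J ∨ᴹ W)) ∸ rk J) (rk-∨-gap flatG W∈ flatJ J⊆G))
              (≡.trans (≡.cong (_∸ rk J) (ℕP.+-assoc (rk J) (gap J W) _)) (ℕP.m+n∸m≡n (rk J) _)))
        ρ-outside (W′ ∷ ms) p {J} flatJ J⊆G = begin
          ρ J (W′ ∷ ms) ≈⟨ ρ-∷ J W′ ms ⟩
          u * ρ J ms + v * ρ (J ∨ᴹ W′) ms
            ≈⟨ +-cong (*-congˡ (ρ-outside ms (p ∘ there) flatJ J⊆G)) (*-congˡ (ρ-outside ms (p ∘ there) (∨-flat J W′) (join⊆ J⊆G W′∈))) ⟩
          u * (xpow (gap J W) * ρ (J ∨ᴹ W) ms) + v * (xpow (gap (J ∨ᴹ W′) W) * ρ ((J ∨ᴹ W′) ∨ᴹ W) ms)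
            ≈⟨ +-congˡ (*-congˡ (*-cong (reflexive (≡.cong xpow (gap-∨ flatG W∈ W′∈ W′≢W flatJ J⊆G)))
                 (reflexive (≡.cong (λ X → ρ X ms) (∨-swap J W′ W))))) ⟩
          u * (x * ρ (J ∨ᴹ W) ms) + v * (x * ρ ((J ∨ᴹ W) ∨ᴹ W′) ms) ≈⟨ factor-out u x _ v _ ⟩
          x * (u * ρ (J ∨ᴹ W) ms + v * ρ ((J ∨ᴹ W) ∨ᴹ W′) ms) ≈⟨ *-congˡ (ρ-∷ (J ∨ᴹ W) W′ ms) ⟨
          x * ρ (J ∨ᴹ W) (W′ ∷ ms) ∎
          where
          x = xpow (gap J W)
          W′∈ = proj₁ (p (here ≡.refl))
          W′≢W = proj₂ (p (here ≡.refl))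

        -- At `W` itself the branch that stays at `J` contributes the power of x from `ρ-outside`,
        -- while the other is already at J ∨ W; for u = 1/(1 - x) the coefficient is (x^c - x)/(1 -
        -- x) with c the gap. Above J ∨ W the weight of `W` is 1, so `W` can be put back into the
        -- list.
        ρ-inside : ∀ ms → Unique ms → (∀ {W′} → W′ ∈ ms → W′ ∈ factors G) → W ∈ ms → ∀ {J} → Flat J → J ⊆ G →
          ρ J ms ≈ (u * xpow (gap J W) + v) * ρ (J ∨ᴹ W) ms
        ρ-inside (_ ∷ ms) (W∉ ∷ _) p (here ≡.refl) {J} flatJ J⊆G = begin
          ρ J (W ∷ ms) ≈⟨ ρ-∷ J W ms ⟩
          u * ρ J ms + v * ρ (J ∨ᴹ W) ms ≈⟨ +-congʳ (*-congˡ (ρ-outside ms (λ m → p (there m) , λ eq → All.lookup W∉ m (≡.sym eq)) flatJ J⊆G)) ⟩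
          u * (x * r) + v * r ≈⟨ +-congʳ (*-assoc u x r) ⟨
          (u * x) * r + v * r ≈⟨ distribʳ r _ _ ⟨
          (u * x + v) * r ≈⟨ *-congˡ same ⟨
          (u * x + v) * ρ (J ∨ᴹ W) (W ∷ ms) ∎
          where
          x = xpow (gap J W)
          r = ρ (J ∨ᴹ W) ms
          same : ρ (J ∨ᴹ W) (W ∷ ms) ≈ r
          same = begin
            ρ (J ∨ᴹ W) (W ∷ ms) ≈⟨ ρ-∷ (J ∨ᴹ W) W ms ⟩
            u * r + v * ρ ((J ∨ᴹ W) ∨ᴹ W) ms ≈⟨ +-congˡ (*-congˡ (reflexive (≡.cong (λ X → ρ X ms) (∨-idem J W)))) ⟩
            u * r + v * r ≈⟨ distribʳ r u v ⟨
            (u + v) * r ≈⟨ *-congʳ u+v≈1 ⟩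
            1# * r ≈⟨ *-identityˡ r ⟩
            r ∎
        ρ-inside (W′ ∷ ms) (W′∉ ∷ unique) p (there W∈ms) {J} flatJ J⊆G = begin
          ρ J (W′ ∷ ms) ≈⟨ ρ-∷ J W′ ms ⟩
          u * ρ J ms + v * ρ (J ∨ᴹ W′) ms
            ≈⟨ +-cong (*-congˡ (ρ-inside ms unique (p ∘ there) W∈ms flatJ J⊆G))
                 (*-congˡ (ρ-inside ms unique (p ∘ there) W∈ms (∨-flat J W′) (join⊆ J⊆G (p (here ≡.refl))))) ⟩
          u * (k * ρ (J ∨ᴹ W) ms) + v * ((u * xpow (gap (J ∨ᴹ W′) W) + v) * ρ ((J ∨ᴹ W′) ∨ᴹ W) ms)
            ≈⟨ +-congˡ (*-congˡ (*-cong
                 (+-congʳ (*-congˡ (reflexive (≡.cong xpow (gap-∨ flatG W∈ (p (here ≡.refl)) (All.lookup W′∉ W∈ms) flatJ J⊆G)))))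
                                        (reflexive (≡.cong (λ X → ρ X ms) (∨-swap J W′ W))))) ⟩
          u * (k * ρ (J ∨ᴹ W) ms) + v * (k * ρ ((J ∨ᴹ W) ∨ᴹ W′) ms) ≈⟨ factor-out u k _ v _ ⟩
          k * (u * ρ (J ∨ᴹ W) ms + v * ρ ((J ∨ᴹ W) ∨ᴹ W′) ms) ≈⟨ *-congˡ (ρ-∷ (J ∨ᴹ W) W′ ms) ⟨
          k * ρ (J ∨ᴹ W) (W′ ∷ ms) ∎
          where
          k = u * xpow (gap J W) + v

    module Counting (F : Subset n) (flatF : Flat F) (low geo : ℕ → Carrier) where
      open Tower M F flatF

      -- Weighted count of standard monomials: low c and geo c are the generating functions of
      -- the exponents 0 and 1, …, c − 1 of a variable, and w weighs the support.
      Q : List (Subset n) → List (Subset n) → (List (Subset n) → Carrier) → Carrier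
      Q [] T w = w T
      Q (C ∷ U) T w = low (exponent T C) * Q U T w + geo (exponent T C) * Q U (C ∷ T) w

      Q-cong : ∀ U T {w w′} → (∀ T′ → w T′ ≈ w′ T′) → Q U T w ≈ Q U T w′
      Q-cong [] T p = p T
      Q-cong (C ∷ U) T p = +-cong (*-congˡ (Q-cong U T p)) (*-congˡ (Q-cong U (C ∷ T) p))

      Q-linear : ∀ {A : Set} (L : List A) U T (w : A → List (Subset n) → Carrier) (y : A → Carrier) →
        Σ L (λ K → Q U T (w K) * y K) ≈ Q U T (λ T′ → Σ L (λ K → w K T′ * y K))
      Q-linear L [] T w y = refl
      Q-linear L (C ∷ U) T w y = begin
        Σ L (λ K → (a * Q U T (w K) + g * Q U (C ∷ T) (w K)) * y K) ≈⟨ Σ-cong L (λ K → expand a _ g _ (y K)) ⟩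
        Σ L (λ K → a * (Q U T (w K) * y K) + g * (Q U (C ∷ T) (w K) * y K)) ≈⟨ Σ-+ L _ _ ⟩
        Σ L (λ K → a * (Q U T (w K) * y K)) + Σ L (λ K → g * (Q U (C ∷ T) (w K) * y K))
          ≈⟨ +-cong (trans (Σ-*ˡ L a _) (*-congˡ (Q-linear L U T w y))) (trans (Σ-*ˡ L g _) (*-congˡ (Q-linear L U (C ∷ T) w y))) ⟩
        a * Q U T (λ T′ → Σ L (λ K → w K T′ * y K)) + g * Q U (C ∷ T) (λ T′ → Σ L (λ K → w K T′ * y K)) ∎
        where
        a = low (exponent T C)
        g = geo (exponent T C)

      inside? : ∀ K T → Dec (bigJoin M F T ⊆ K)
      inside? K T = bigJoin M F T ⊆? K

      Q-outside : ∀ K U T {Y} → Y ∈ T → ¬ Y ⊆ K → Q U T (λ T′ → when (inside? K T′) 1#) ≈ 0#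
      Q-outside K [] T Y∈ Y⊈K = when-no (inside? K T) (λ sub → Y⊈K (sub ∘ bigJoin-upper Y∈))
      Q-outside K (C ∷ U) T Y∈ Y⊈K = trans
        (+-cong (trans (*-congˡ (Q-outside K U T Y∈ Y⊈K)) (zeroʳ _)) (trans (*-congˡ (Q-outside K U (C ∷ T) (there Y∈) Y⊈K)) (zeroʳ _)))
        (+-identityˡ 0#)

      -- Lets the counts for all `K` run over one list: a support with an element outside `K` has
      -- weight 0, so an element C outside `K` contributes only its exponent 0, with factor `low`.
      -- That factor is 1, since sup(T, C) lies in `K` and C does not.
      Q-restrict : (∀ c → low (suc c) ≈ 1#) → ∀ {K} → Flat K → F ⊆ K → ∀ U → (∀ {C} → C ∈ U → Flat C × F ⊆ C) →
        ∀ T → (∀ {Y} → Y ∈ T → Y ⊆ K) → Q (filter (_⊆? K) U) T (λ _ → 1#) ≈ Q U T (λ T′ → when (inside? K T′) 1#)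
      Q-restrict low≈1 {K} flatK F⊆K [] flats T below = sym (when-yes (inside? K T) (bigJoin-least T flatK F⊆K below))
      Q-restrict low≈1 {K} flatK F⊆K (C ∷ U) flats T below with C ⊆? K
      ... | yes C⊆K = +-cong (*-congˡ (Q-restrict low≈1 flatK F⊆K U (flats ∘ there) T below))
                             (*-congˡ (Q-restrict low≈1 flatK F⊆K U (flats ∘ there) (C ∷ T) (λ { (here ≡.refl) → C⊆K ; (there m) → below m })))
      ... | no C⊈K = begin
        Q (filter (_⊆? K) U) T (λ _ → 1#) ≈⟨ Q-restrict low≈1 flatK F⊆K U (flats ∘ there) T below ⟩
        Q U T w ≈⟨ *-identityˡ _ ⟨
        1# * Q U T w ≈⟨ +-identityʳ _ ⟨
        1# * Q U T w + 0# ≈⟨ +-cong (*-congʳ (sym (positive _ gap>0))) (sym (trans (*-congˡ (Q-outside K U (C ∷ T) (here ≡.refl) C⊈K)) (zeroʳ _))) ⟩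
        low (exponent T C) * Q U T w + geo (exponent T C) * Q U (C ∷ T) w ∎
        where
        w = λ T′ → when (inside? K T′) 1#
        positive : ∀ c → 0 < c → low c ≈ 1#
        positive (suc c) _ = low≈1 c
        flatC = proj₁ (flats (here ≡.refl))
        F⊆C : F ⊆ C
        F⊆C = proj₂ (flats (here ≡.refl))
        gap>0 : 0 < exponent T C
        gap>0 = ℕP.m<n⇒0<n∸m (rk-strict (sup-flat T C) (sup⊆ T flatC F⊆C)
          (λ C⊆sup → C⊈K (sup-least {T} {C} flatK F⊆K (λ m _ → below m) ∘ C⊆sup)))

      -- No C in `U` is strictly above `G₁`, so its exponent is the same with and without `G₁` in
      -- the support, and the linear combination passes through the recursion to the terminal
      -- weights.
      Q-insert : ∀ (a g : Carrier) (w : List (Subset n) → Carrier) G₁ T (P : Subset n → Set) →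
        (∀ X → (∀ {Y} → Y ∈ X → P Y) → a * w (X ++ T) + g * w (X ++ G₁ ∷ T) ≈ 0#) →
        ∀ U → (∀ {C} → C ∈ U → P C × ¬ G₁ ⊊ C) → ∀ X → (∀ {Y} → Y ∈ X → P Y) →
        a * Q U (X ++ T) w + g * Q U (X ++ G₁ ∷ T) w ≈ 0#
      Q-insert a g w G₁ T P terminal [] pU X pX = terminal X pX
      Q-insert a g w G₁ T P terminal (C ∷ U) pU X pX = begin
        a * (low c * A + geo c * B) + g * (low c′ * A′ + geo c′ * B′)
          ≈⟨ +-congˡ (*-congˡ (+-cong (*-congʳ (reflexive (≡.cong low c′≡c))) (*-congʳ (reflexive (≡.cong geo c′≡c))))) ⟩
        a * (low c * A + geo c * B) + g * (low c * A′ + geo c * B′) ≈⟨ regroup a (low c) A (geo c) B g A′ B′ ⟩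
        low c * (a * A + g * A′) + geo c * (a * B + g * B′)
          ≈⟨ +-cong (*-congˡ (Q-insert a g w G₁ T P terminal U (pU ∘ there) X pX))
                    (*-congˡ (Q-insert a g w G₁ T P terminal U (pU ∘ there) (C ∷ X)
                        (λ { (here ≡.refl) → proj₁ (pU (here ≡.refl)) ; (there m) → pX m }))) ⟩
        low c * 0# + geo c * 0# ≈⟨ +-cong (zeroʳ _) (zeroʳ _) ⟩
        0# + 0# ≈⟨ +-identityˡ 0# ⟩
        0# ∎
        where
        c = exponent (X ++ T) C
        c′ = exponent (X ++ G₁ ∷ T) C
        c′≡c : c′ ≡ c
        c′≡c = exponent-skip X T (proj₂ (pU (here ≡.refl)))
        A = Q U (X ++ T) w
        B = Q U (C ∷ X ++ T) w
        A′ = Q U (X ++ G₁ ∷ T) w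
        B′ = Q U (C ∷ X ++ G₁ ∷ T) w

    Sorted : List (Subset n) → Set
    Sorted = AllPairs (λ A B → ¬ B ⊆ A)

    filter-filter : {A : Set} {P Q S : A → Set} (P? : ∀ x → Dec (P x)) (Q? : ∀ x → Dec (Q x)) (S? : ∀ x → Dec (S x)) →
      (∀ {x} → P x → Q x → S x) → (∀ {x} → S x → P x × Q x) → ∀ L → filter P? (filter Q? L) ≡ filter S? L
    filter-filter P? Q? S? f g [] = ≡.refl
    filter-filter P? Q? S? f g (x ∷ L) with Q? x | S? x
    ... | no ¬q | yes s = ⊥-elim (¬q (proj₂ (g s)))
    ... | no _ | no _ = filter-filter P? Q? S? f g L
    ... | yes q | yes s = ≡.trans (ListP.filter-accept P? (proj₁ (g s))) (≡.cong (x ∷_) (filter-filter P? Q? S? f g L))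
    ... | yes q | no ¬s = ≡.trans (ListP.filter-reject P? (λ p → ¬s (f p q))) (filter-filter P? Q? S? f g L)

    module Vanishing (F G : Subset n) (flatF : Flat F) (flatG : Flat G) (F⊆G : F ⊆ G)
      (u v : Carrier) (u+v≈1 : u + v ≈ 1#)
      (xpow : ℕ → Carrier) (xpow-+ : ∀ j k → xpow (j ℕ.+ k) ≈ xpow j * xpow k)
      (χ : Inc) (Σχ : ∀ {J} → Flat J → J ⊆ G → Σ (interval M J G) (λ K → χ K G) ≈ xpow (rk G ∸ rk J))
      (low geo : ℕ → Carrier) (low-geo : ∀ c → low c * (u * xpow c + v) + geo c ≈ 0#)
      (induced-sorted : Sorted (induced M 𝒢 F G)) where

      open Weights u v u+v≈1 xpow xpow-+ χ G flatG Σχ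
      open Counting F flatF low geo
      open Tower M F flatF

      terminal : List (Subset n) → Carrier
      terminal T = ρ (bigJoin M F T) (factors G)

      module _ (W : Subset n) (W∈ : W ∈ factors G) (W⊈F : ¬ W ⊆ F) where
        G₁ : Subset n
        G₁ = W ∨ᴹ F

        maximal-G₁ : ∀ {B} → B ∈ induced M 𝒢 F G → ¬ G₁ ⊊ B
        maximal-G₁ B∈ G₁⊊B = ⊊⇒⊉ G₁⊊B (factor-∨-maximal flatF flatG F⊆G W∈ W⊈F B∈ (proj₁ G₁⊊B))

        module _ (T X : List (Subset n))
                 (T∈ : ∀ {Y} → Y ∈ T → Y ∈ induced M 𝒢 F G × Y ≢ G₁)
                 (X∈ : ∀ {Y} → Y ∈ X → Y ∈ induced M 𝒢 F G × ¬ Y ⊆ G₁) where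
          J = bigJoin M F (X ++ T)
          Y₀ = sup T G₁

          J-flat : Flat J
          J-flat = bigJoin-flat (X ++ T) flatF

          member⊆G : ∀ {Y} → Y ∈ induced M 𝒢 F G → Y ⊆ G
          member⊆G m = proj₂ (proj₂ (proj₁ (induced⁻ m)))

          J⊆G : J ⊆ G
          J⊆G = bigJoin-least (X ++ T) flatG F⊆G go
            where
            go : ∀ {Y} → Y ∈ X ++ T → Y ⊆ G
            go m with ∈-++⁻ X m
            ... | inj₁ m′ = member⊆G (proj₁ (X∈ m′))
            ... | inj₂ m′ = member⊆G (proj₁ (T∈ m′))

          G₁⊆G : G₁ ⊆ G
          G₁⊆G = ∨-least flatG (factor-⊆ W∈) F⊆G

          Y₀⊆G₁ : Y₀ ⊆ G₁
          Y₀⊆G₁ = sup⊆ T (∨-flat W F) (∨-upperʳ W F)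

          Y₀⊆J : Y₀ ⊆ J
          Y₀⊆J = sup-least {T} {G₁} J-flat (bigJoin-base (X ++ T)) (λ m _ → bigJoin-upper (∈-++⁺ʳ X m))

          -- An element with source in `W` is below `G₁`. It can come only from `T`, as members of
          -- `X` are not below `G₁`, and is then absorbed in `Y₀`. All others have their source in
          -- another factor.
          J⊆ : J ⊆ Y₀ ∨ᴹ others G W
          J⊆ = bigJoin-least (X ++ T) (∨-flat Y₀ (others G W)) (∨-upperˡ Y₀ (others G W) ∘ sup-base T G₁) go
            where
            classify : ∀ {Y} → Y ∈ induced M 𝒢 F G → (Y ⊊ G₁ → Y ⊆ Y₀) → Y ≢ G₁ → Y ⊆ Y₀ ∨ᴹ others G W
            classify {Y} m p Y≢G₁ =
              let (_ , i) = induced⁻ m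
                  (W′ , W′∈ , H⊆W′) = factor-above (Induced.source-𝒢 i) (Induced.source⊆ i)
              in decide i W′ W′∈ H⊆W′
              where
              decide : (i : Induced F G Y) → ∀ W′ → W′ ∈ factors G → Induced.source i ⊆ W′ → Y ⊆ Y₀ ∨ᴹ others G W
              decide i W′ W′∈ H⊆W′ with W′ ≟ₛ W
              ... | yes ≡.refl = ∨-upperˡ Y₀ (others G W) ∘ p ((λ {x} → Y⊆G₁ {x}) , Y≢G₁)
                where
                Y⊆G₁ : Y ⊆ G₁
                Y⊆G₁ = ≡.subst (_⊆ G₁) (Induced.source-∨ i) (∨-least (∨-flat W F) (∨-upperˡ W F ∘ H⊆W′) (∨-upperʳ W F))
              ... | no W′≢W = ≡.subst (_⊆ Y₀ ∨ᴹ others G W) (Induced.source-∨ i)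
                  (∨-least (∨-flat Y₀ (others G W)) (∨-upperʳ Y₀ (others G W) ∘ others-upper W′∈ W′≢W ∘ H⊆W′)
                    (∨-upperˡ Y₀ (others G W) ∘ sup-base T G₁))
            go : ∀ {Y} → Y ∈ X ++ T → Y ⊆ Y₀ ∨ᴹ others G W
            go m with ∈-++⁻ X m
            ... | inj₁ m′ = classify (proj₁ (X∈ m′)) (λ Y⊊ → ⊥-elim (proj₂ (X∈ m′) (proj₁ Y⊊))) (λ { ≡.refl → proj₂ (X∈ m′) id })
            ... | inj₂ m′ = classify (proj₁ (T∈ m′)) (sup-upper m′) (proj₂ (T∈ m′))

          Y₀∩W≡J∩W : Y₀ ∩ W ≡ J ∩ W
          Y₀∩W≡J∩W = ⊆-antisym (∩-greatest (Y₀⊆J ∘ p∩q⊆p Y₀ W) (p∩q⊆q Y₀ W))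
            (∩-greatest (factor-independent flatG W∈ (∩-flat J-flat (factor-flat W∈)) (p∩q⊆q J W) (sup-flat T G₁) (G₁⊆G ∘ Y₀⊆G₁) (J⊆ ∘ p∩q⊆p J W))
                        (p∩q⊆q J W))

          Y₀∨W≡G₁ : Y₀ ∨ᴹ W ≡ G₁
          Y₀∨W≡G₁ = ⊆-antisym (∨-least (∨-flat W F) Y₀⊆G₁ (∨-upperˡ W F))
            (∨-least (∨-flat Y₀ W) (∨-upperʳ Y₀ W) (∨-upperˡ Y₀ W ∘ sup-base T G₁))

          -- The exponent is fixed when `G₁` is reached and sees only `T`, whereas the terminal
          -- weight also involves the elements `X` chosen later. These do not change the part inside
          -- `W`, so the two numbers agree.
          exponent≡gap : exponent T G₁ ≡ gap J W
          exponent≡gap = ≡.trans (≡.cong (λ Z → rk Z ∸ rk Y₀) (≡.sym Y₀∨W≡G₁))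
            (≡.trans (≡.cong (_∸ rk Y₀) (rk-∨-gap flatG W∈ (sup-flat T G₁) (G₁⊆G ∘ Y₀⊆G₁)))
              (≡.trans (ℕP.m+n∸m≡n (rk Y₀) (gap Y₀ W)) (≡.cong (λ Z → rk W ∸ rk Z) Y₀∩W≡J∩W)))

          join-insert : bigJoin M F (X ++ G₁ ∷ T) ≡ J ∨ᴹ W
          join-insert = ⊆-antisym
            (bigJoin-least (X ++ G₁ ∷ T) (∨-flat J W) (∨-upperˡ J W ∘ bigJoin-base (X ++ T)) to)
            (∨-least big-flat
              (bigJoin-least (X ++ T) big-flat (bigJoin-base (X ++ G₁ ∷ T)) from)
              (bigJoin-upper (∈-++⁺ʳ X (here ≡.refl)) ∘ ∨-upperˡ W F))
            where
            big-flat = bigJoin-flat (X ++ G₁ ∷ T) flatF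
            to : ∀ {Y} → Y ∈ X ++ G₁ ∷ T → Y ⊆ J ∨ᴹ W
            to m with ∈-++⁻ X m
            ... | inj₁ m′ = ∨-upperˡ J W ∘ bigJoin-upper (∈-++⁺ˡ m′)
            ... | inj₂ (here ≡.refl) = ∨-least (∨-flat J W) (∨-upperʳ J W) (∨-upperˡ J W ∘ bigJoin-base (X ++ T))
            ... | inj₂ (there m′) = ∨-upperˡ J W ∘ bigJoin-upper (∈-++⁺ʳ X m′)
            from : ∀ {Y} → Y ∈ X ++ T → Y ⊆ bigJoin M F (X ++ G₁ ∷ T)
            from m with ∈-++⁻ X m
            ... | inj₁ m′ = bigJoin-upper (∈-++⁺ˡ m′)
            ... | inj₂ m′ = bigJoin-upper (∈-++⁺ʳ X (there m′))

          terminal-cancels : low (exponent T G₁) * terminal (X ++ T) + geo (exponent T G₁) * terminal (X ++ G₁ ∷ T) ≈ 0#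
          terminal-cancels = begin
            low c * ρ J ms + geo c * terminal (X ++ G₁ ∷ T)
              ≈⟨ +-cong (*-congˡ (ρ-inside W∈ ms (factors-unique G) id W∈ J-flat J⊆G)) (*-congˡ (reflexive (≡.cong (λ Z → ρ Z ms) join-insert))) ⟩
            low c * ((u * xpow (gap J W) + v) * r) + geo c * r
              ≈⟨ +-congʳ (*-congˡ (*-congʳ (+-congʳ (*-congˡ (reflexive (≡.cong xpow (≡.sym exponent≡gap))))))) ⟩
            low c * ((u * xpow c + v) * r) + geo c * r ≈⟨ collect (low c) (u * xpow c + v) r (geo c) ⟩
            (low c * (u * xpow c + v) + geo c) * r ≈⟨ *-congʳ (low-geo c) ⟩
            0# * r ≈⟨ zeroˡ r ⟩
            0# ∎
            where
            ms = factors G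
            c = exponent T G₁
            r = ρ (J ∨ᴹ W) ms

        -- Before `G₁` both branches of the recursion still have `G₁` ahead and vanish by induction.
        -- At `G₁` they form the combination of `Q-insert`; the elements after it are not below it
        -- in the sorted list, as required of `X`.
        Q-vanishes : ∀ U → Sorted U → (∀ {C} → C ∈ U → C ∈ induced M 𝒢 F G) → G₁ ∈ U →
          ∀ T → (∀ {Y} → Y ∈ T → Y ∈ induced M 𝒢 F G × Y ≢ G₁) → Q U T terminal ≈ 0#
        Q-vanishes (C ∷ U) (C≤ ∷ sorted) U⊆ (here ≡.refl) T T∈ =
          Q-insert (low (exponent T G₁)) (geo (exponent T G₁)) terminal G₁ T (λ Y → Y ∈ induced M 𝒢 F G × ¬ Y ⊆ G₁)
            (λ X X∈ → terminal-cancels T X T∈ X∈) U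
            (λ m → (U⊆ (there m) , All.lookup C≤ m) , maximal-G₁ (U⊆ (there m))) [] (λ ())
        Q-vanishes (C ∷ U) (C≤ ∷ sorted) U⊆ (there m) T T∈ = trans
          (+-cong (trans (*-congˡ (Q-vanishes U sorted (U⊆ ∘ there) m T T∈)) (zeroʳ _))
                  (trans (*-congˡ (Q-vanishes U sorted (U⊆ ∘ there) m (C ∷ T) (λ
                    { (here ≡.refl) → U⊆ (here ≡.refl) , λ eq → All.lookup C≤ m (≡.subst (_⊆ C) eq id)
                    ; (there m′) → T∈ m′ }))) (zeroʳ _)))
          (+-identityˡ 0#)

      -- `G` is a join of flats below its factors, so it would lie in `F` if all of them did.
      factor-outside : ¬ G ⊆ F → ∃ λ W → W ∈ factors G × ¬ W ⊆ F
      factor-outside G⊈F = go (factors G) id λ all → G⊈F (decomposed all)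
        where
        decomposed : (∀ {W} → W ∈ factors G → W ⊆ F) → G ⊆ F
        decomposed all with decompose flatG flatG id
        ... | s , eq , below = ≡.subst (_⊆ F) eq (bigJoin-least (map s (factors G)) flatF (λ x∈ → ⊥-elim (∉⊥ x∈)) part)
          where
          open import Data.Fin.Subset.Properties using (∉⊥)
          open import Data.List.Membership.Propositional.Properties using (∈-map⁻)
          part : ∀ {K} → K ∈ map s (factors G) → K ⊆ F
          part m with ∈-map⁻ s m
          ... | W , W∈ , ≡.refl = all W∈ ∘ proj₁ (proj₂ (below W∈))
        go : ∀ L → (∀ {W} → W ∈ L → W ∈ factors G) → ¬ (∀ {W} → W ∈ L → W ⊆ F) → ∃ λ W → W ∈ factors G × ¬ W ⊆ F
        go [] p ¬all = ⊥-elim (¬all λ ())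
        go (W ∷ L) p ¬all with W ⊆? F
        ... | no W⊈F = W , p (here ≡.refl) , W⊈F
        ... | yes W⊆F = go L (p ∘ there) (λ all → ¬all λ { (here ≡.refl) → W⊆F ; (there m) → all m })

      Q-induced-vanishes : ¬ G ⊆ F → Q (induced M 𝒢 F G) [] terminal ≈ 0#
      Q-induced-vanishes G⊈F = let (W , W∈ , W⊈F) = factor-outside G⊈F in
        Q-vanishes W W∈ W⊈F (induced M 𝒢 F G) induced-sorted id (induced⁺ flatG F⊆G (factor-𝒢 W∈) (factor-⊆ W∈) W⊈F) [] (λ ())

      -- A source H is below `K` exactly when H ∨ F is. Equality of lists, order included, is what
      -- allows `Q`, a recursion on the list, to be rewritten.
      induced-restrict : ∀ {K} → Flat K → F ⊆ K → K ⊆ G → induced M 𝒢 F K ≡ filter (_⊆? K) (induced M 𝒢 F G)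
      induced-restrict {K} flatK F⊆K K⊆G = ≡.trans (filter-filter (inInduced? M 𝒢 F K) (in? K) both? _,_ id (flats M))
        (≡.sym (≡.trans (≡.cong (filter (_⊆? K)) (filter-filter (inInduced? M 𝒢 F G) (in? G) both′? _,_ id (flats M)))
          (filter-filter (_⊆? K) both′? both?
            (λ {x} A⊆K (ind , F⊆A , _) → restrict ind A⊆K , (λ {y} → F⊆A {y}) , λ {y} → A⊆K {y})
            (λ {x} (ind , F⊆A , A⊆K) → (λ {y} → A⊆K {y}) , extend ind , (λ {y} → F⊆A {y}) , λ {y} z → K⊆G (A⊆K {y} z)) (flats M))))
        where
        open import Data.List.Relation.Unary.Any as Any using (Any)
        in? : ∀ B A → Dec (F ⊆ A × A ⊆ B)
        in? B A = (F ⊆? A) ×-dec (A ⊆? B)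
        both? : ∀ A → Dec (InInduced M 𝒢 F K A × (F ⊆ A × A ⊆ K))
        both? A = inInduced? M 𝒢 F K A ×-dec in? K A
        both′? : ∀ A → Dec (InInduced M 𝒢 F G A × (F ⊆ A × A ⊆ G))
        both′? A = inInduced? M 𝒢 F G A ×-dec in? G A
        restrict : ∀ {A} → InInduced M 𝒢 F G A → A ⊆ K → InInduced M 𝒢 F K A
        restrict {A} ind A⊆K = Any.map (λ {H} (H∈ , _ , H⊈F , eq) → H∈ , (λ {y} z → A⊆K (≡.subst (H ⊆_) eq (∨-upperˡ H F) {y} z)) , H⊈F , eq) ind
        extend : ∀ {A} → InInduced M 𝒢 F K A → InInduced M 𝒢 F G A
        extend ind = Any.map (λ {H} (H∈ , H⊆K , H⊈F , eq) → H∈ , (λ {y} z → K⊆G (H⊆K {y} z)) , H⊈F , eq) ind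

      inverse-identity : (∀ c → low (suc c) ≈ 1#) → ¬ G ⊆ F →
        Σ (interval M F G) (λ K → Q (induced M 𝒢 F K) [] (λ _ → 1#) * (χ K G * weight (factors G) K)) ≈ 0#
      inverse-identity low≈1 G⊈F = begin
        Σ I (λ K → Q (induced M 𝒢 F K) [] (λ _ → 1#) * y K)
          ≈⟨ Σ-cong-∈ I (λ {K} m → let (flatK , F⊆K , K⊆G) = interval⁻ m in *-congʳ (trans
               (reflexive (≡.cong (λ L → Q L [] (λ _ → 1#)) (induced-restrict flatK F⊆K K⊆G)))
               (Q-restrict low≈1 flatK F⊆K (induced M 𝒢 F G) (λ m → let (fl , sub , _) = proj₁ (induced⁻ m) in fl , λ {x} → sub {x}) [] (λ ())))) ⟩
        Σ I (λ K → Q (induced M 𝒢 F G) [] (λ T → when (inside? K T) 1#) * y K)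
          -- The sum over K moves into the weight of a support `T`, where the guard restricts it to
          -- the K above the join of `T`.
          ≈⟨ Q-linear I (induced M 𝒢 F G) [] (λ K T → when (inside? K T) 1#) y ⟩
        Q (induced M 𝒢 F G) [] (λ T → Σ I (λ K → when (inside? K T) 1# * y K))
          ≈⟨ Q-cong (induced M 𝒢 F G) [] terms ⟩
        Q (induced M 𝒢 F G) [] terminal ≈⟨ Q-induced-vanishes G⊈F ⟩
        0# ∎
        where
        I = interval M F G
        y = λ K → χ K G * weight (factors G) K
        in? : ∀ A K → Dec (A ⊆ K × K ⊆ G)
        in? A K = (A ⊆? K) ×-dec (K ⊆? G)
        terms : ∀ T → Σ I (λ K → when (inside? K T) 1# * y K) ≈ terminal T
        terms T = begin
          Σ I (λ K → when (inside? K T) 1# * y K) ≈⟨ Σ-cong I (λ K → trans (when-* (inside? K T)) (when-cong (inside? K T) (λ _ → *-identityˡ _))) ⟩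
          Σ I (λ K → when (inside? K T) (y K)) ≈⟨ Σ-interval F G _ ⟩
          Σ (flats M) (λ K → when (in? F K) (when (inside? K T) (y K)))
            ≈⟨ Σ-cong (flats M) (λ K → trans (when-when (in? F K) (inside? K T)) (when-⇔ (in? F K ×-dec inside? K T) (in? (bigJoin M F T) K)
                 (λ ((_ , K⊆G) , J⊆K) → (λ {x} → J⊆K {x}) , λ {x} → K⊆G {x})
                 (λ (J⊆K , K⊆G) → ((λ {x} z → J⊆K (bigJoin-base T {x} z)) , λ {x} → K⊆G {x}) , λ {x} → J⊆K {x}))) ⟩
          Σ (flats M) (λ K → when (in? (bigJoin M F T) K) (y K)) ≈⟨ Σ-interval (bigJoin M F T) G y ⟨
          terminal T ∎

-- Specialisation to power series, and the two inverse identities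

module Inversion where
  open LatticeOfFlats
  open BuildingSets
  open IncidenceAlgebras
  open PowerSeries
  open WeightedCounts
  open HilbertSeries using (module Hilbert)
  open Annihilators using (module Tower)
  open import Data.Integer as ℤ using (ℤ; +_)
  open import Data.Fin.Subset.Properties using (_⊆?_; ⊆-antisym)
  open import Data.Vec using ([]; _∷_)
  open import Data.List.Membership.Propositional using (_∈_)
  open import Data.List.Relation.Unary.AllPairs using ([]; _∷_)
  open import Data.Unit using (tt)
  open import Relation.Binary.PropositionalEquality hiding (J)

  module P = CommutativeRing PS-ring
  module PG = Guards PS-ring
  module ℤG = Guards ℤP.+-*-commutativeRing

  -- 1/(1 − x) and −x/(1 − x)
  u v : PS
  u _ = + 1
  v = 1ₚ +ₚ (-ₚ u)

  xpow : ℕ → PS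
  xpow k d = if k ≡ᵇ d then + 1 else + 0

  low geo : ℕ → PS
  low zero = 0ₚ
  low (suc _) = 1ₚ
  geo c zero = + 0
  geo c (suc d) = if suc d <ᵇ c then + 1 else + 0

  u+v≈1 : u +ₚ v ≈ 1ₚ
  u+v≈1 d = trans (ℤP.+-comm (+ 1) (1ₚ d ℤ.+ ℤ.- + 1)) (trans (ℤP.+-assoc (1ₚ d) (ℤ.- + 1) (+ 1)) (ℤP.+-identityʳ (1ₚ d)))

  xpow-zero : xpow 0 ≈ 1ₚ
  xpow-zero zero = refl
  xpow-zero (suc d) = refl

  xpow-zero-* : ∀ b → xpow 0 *ₚ b ≈ b
  xpow-zero-* b = P.trans (P.*-congʳ {b} xpow-zero) (1ₚ-*ₚ b)

  xpow-suc-* : ∀ k b d → (xpow (suc k) *ₚ b) (suc d) ≡ (xpow k *ₚ b) d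
  xpow-suc-* k b d = trans (*-suc (xpow (suc k)) b d) (ℤP.+-identityˡ _)

  xpow-+ : ∀ j k → xpow (j ℕ.+ k) ≈ xpow j *ₚ xpow k
  xpow-+ zero k d = sym (xpow-zero-* (xpow k) d)
  xpow-+ (suc j) k zero = refl
  xpow-+ (suc j) k (suc d) = trans (xpow-+ j k d) (sym (xpow-suc-* j (xpow k) d))

  -- For c ≥ 1 this is (x^c - x)/(1 - x) + (x + ⋯ + x^(c-1)) = 0; for c = 0 both `low` and `geo`
  -- vanish.
  low-geo : ∀ c → (low c *ₚ ((u *ₚ xpow c) +ₚ v)) +ₚ geo c ≈ 0ₚ
  low-geo zero d = trans (cong₂ ℤ._+_ (0ₚ-*ₚ ((u *ₚ xpow 0) +ₚ v) d) (geo-zero d)) refl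
    where
    geo-zero : ∀ d → geo 0 d ≡ + 0
    geo-zero zero = refl
    geo-zero (suc d) = refl
  low-geo (suc c) d = trans (cong (λ z → z ℤ.+ geo (suc c) d) (trans (1ₚ-*ₚ ((u *ₚ xpow (suc c)) +ₚ v) d)
    (cong (λ z → z ℤ.+ v d) (*ₚ-comm u (xpow (suc c)) d)))) (go c d)
    where
    -- The coefficients of x^c/(1 - x) and of 1 + ⋯ + x^(c-1) are complementary.
    tail-sum : ∀ c d → (xpow c *ₚ u) d ℤ.+ (if d <ᵇ c then + 1 else + 0) ≡ + 1
    tail-sum zero d = trans (ℤP.+-identityʳ _) (xpow-zero-* u d)
    tail-sum (suc c) zero = refl
    tail-sum (suc c) (suc d) = trans (cong (λ z → z ℤ.+ (if d <ᵇ c then + 1 else + 0)) (xpow-suc-* c u d)) (tail-sum c d)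
    go : ∀ c d → (xpow (suc c) *ₚ u) d ℤ.+ v d ℤ.+ geo (suc c) d ≡ + 0
    go c zero = refl
    go c (suc d) = begin
      (xpow (suc c) *ₚ u) (suc d) ℤ.+ v (suc d) ℤ.+ b ≡⟨ cong (λ z → z ℤ.+ v (suc d) ℤ.+ b) (xpow-suc-* c u d) ⟩
      a ℤ.+ v (suc d) ℤ.+ b ≡⟨ ℤP.+-assoc a (v (suc d)) b ⟩
      a ℤ.+ (v (suc d) ℤ.+ b) ≡⟨ cong (λ z → a ℤ.+ z) (ℤP.+-comm (v (suc d)) b) ⟩
      a ℤ.+ (b ℤ.+ v (suc d)) ≡⟨ ℤP.+-assoc a b (v (suc d)) ⟨
      a ℤ.+ b ℤ.+ v (suc d) ≡⟨ cong (λ z → z ℤ.+ v (suc d)) (tail-sum c d) ⟩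
      + 0 ∎
      where
      open ≡-Reasoning
      a = (xpow c *ₚ u) d
      b = if d <ᵇ c then + 1 else + 0

  invOneMinusXPow-suc : ∀ k → invOneMinusXPow (suc k) ≈ u *ₚ invOneMinusXPow k
  invOneMinusXPow-suc k d = trans (ℤΣ.Σ-cong (upTo (suc d)) (λ i → sym (ℤP.*-identityʳ (invOneMinusXPow k i))))
    (*ₚ-comm (invOneMinusXPow k) u d)

  invOneMinusXPow-count : {A : Set} {P : A → Set} (P? : ∀ x → Dec (P x)) (L : List A) →
    invOneMinusXPow (length (filter (λ x → ¬? (P? x)) L)) ≈ foldr (λ x w → (if does (P? x) then 1ₚ else u) *ₚ w) 1ₚ L
  invOneMinusXPow-count P? [] = P.refl
  invOneMinusXPow-count P? (x ∷ L) with P? x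
  ... | yes _ = P.trans (invOneMinusXPow-count P? L) (P.sym (P.*-identityˡ _))
  ... | no _ = P.trans (invOneMinusXPow-suc (length (filter (λ x → ¬? (P? x)) L))) (P.*-congˡ {u} (invOneMinusXPow-count P? L))

  Σ-at : {A : Set} (L : List A) (f : A → PS) (d : ℕ) → PG.Σ L f d ≡ ℤΣ.Σ L (λ x → f x d)
  Σ-at [] f d = refl
  Σ-at (x ∷ L) f d = cong (λ z → f x d ℤ.+ z) (Σ-at L f d)

  Σ-neg : {A : Set} (L : List A) (f : A → PS) → PG.Σ L (λ x → -ₚ f x) ≈ -ₚ PG.Σ L f
  Σ-neg [] f d = refl
  Σ-neg (x ∷ L) f d = trans (cong (λ z → ℤ.- f x d ℤ.+ z) (Σ-neg L f d)) (sym (ℤP.neg-distrib-+ (f x d) (PG.Σ L f d)))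

  *ₚ-negʳ : ∀ a b → a *ₚ (-ₚ b) ≈ -ₚ (a *ₚ b)
  *ₚ-negʳ a b d = sym (-‿distribʳ-* a b d)
    where open import Algebra.Properties.Ring P.ring using (-‿distribʳ-*)

  bit : Bool → ℤ
  bit b = if b then + 1 else + 0

  length-filter-bit : {A : Set} (p : A → Bool) (L : List A) → + length (filter (λ x → T? (p x)) L) ≡ ℤΣ.Σ L (λ x → bit (p x))
  length-filter-bit p [] = refl
  length-filter-bit p (x ∷ L) with p x
  ... | true = trans (ℤP.pos-+ 1 (length (filter (λ x → T? (p x)) L))) (cong (λ z → + 1 ℤ.+ z) (length-filter-bit p L))
  ... | false = trans (length-filter-bit p L) (sym (ℤP.+-identityˡ _))

  if-yes : {A P : Set} (p : Dec P) {x y : A} → P → (if does p then x else y) ≡ x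
  if-yes (yes _) _ = refl
  if-yes (no ¬p) p = ⊥-elim (¬p p)

  if-no : {A P : Set} (p : Dec P) {x y : A} → ¬ P → (if does p then x else y) ≡ y
  if-no (yes p) ¬p = ⊥-elim (¬p p)
  if-no (no _) _ = refl

  module Count {n : ℕ} (M : Polymatroid n) (loopless : Loopless M) (𝒢 : Subset n → Bool) (building : IsBuildingSet M 𝒢)
               (F : Subset n) (flatF : IsFlat M F) where
    open Combinatorics M loopless 𝒢 building PS-ring using (module Counting)
    open Counting F flatF low geo
    open Tower M F flatF

    bit-∧ : ∀ b b′ → bit (b ∧ b′) ≡ bit b ℤ.* bit b′
    bit-∧ true b′ = sym (ℤP.*-identityˡ (bit b′))
    bit-∧ false b′ = sym (ℤP.*-zeroˡ (bit b′))

    low-* : ∀ c a d → (low c *ₚ a) d ≡ bit (0 <ᵇ c) ℤ.* a d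
    low-* zero a d = trans (0ₚ-*ₚ a d) (sym (ℤP.*-zeroˡ (a d)))
    low-* (suc c) a d = trans (1ₚ-*ₚ a d) (sym (ℤP.*-identityˡ (a d)))

    -- Sorting monomials by the exponent of the first variable reproduces the recursion of `Q`:
    -- exponent 0 keeps `T`, and the exponents 1, ..., c - 1 add `C` to it.
    count-standard : ∀ U T d → ℤΣ.Σ (monos (length U) d) (λ e → bit (Std U T e)) ≡ Q U T (λ _ → 1ₚ) d
    count-standard [] T zero = refl
    count-standard [] T (suc d) = refl
    count-standard (C ∷ U) T d = begin
      ℤΣ.Σ (concatMap (λ k → map (k ∷_) (monos m (d ∸ k))) (upTo (suc d))) (λ e → bit (Std (C ∷ U) T e))
        ≡⟨ ℤΣ.Σ-concatMap (upTo (suc d)) (λ k → map (k ∷_) (monos m (d ∸ k))) (λ e → bit (Std (C ∷ U) T e)) ⟩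
      ℤΣ.Σ (upTo (suc d)) (λ k → ℤΣ.Σ (map (k ∷_) (monos m (d ∸ k))) (λ e → bit (Std (C ∷ U) T e)))
        ≡⟨ ℤΣ.Σ-cong (upTo (suc d)) (λ k → ℤΣ.Σ-map (monos m (d ∸ k)) (k ∷_) (λ e → bit (Std (C ∷ U) T e))) ⟩
      ℤΣ.Σ (upTo (suc d)) f
        ≡⟨ cong sumℤ (map-upTo-suc f d) ⟩
      f 0 ℤ.+ ℤΣ.Σ (upTo d) (f ∘ suc)
        ≡⟨ cong₂ ℤ._+_ first (ℤΣ.Σ-cong (upTo d) rest) ⟩
      (low c *ₚ A) d ℤ.+ ℤΣ.Σ (upTo d) (λ k → geo c (suc k) ℤ.* B (d ∸ suc k))
        ≡⟨ cong (λ z → (low c *ₚ A) d ℤ.+ z) (trans (cong sumℤ (map-upTo-suc (λ k → geo c k ℤ.* B (d ∸ k)) d)) (ℤP.+-identityˡ _)) ⟨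
      (low c *ₚ A) d ℤ.+ (geo c *ₚ B) d ∎
      where
      open ≡-Reasoning
      m = length U
      c = exponent T C
      A = Q U T (λ _ → 1ₚ)
      B = Q U (C ∷ T) (λ _ → 1ₚ)
      f : ℕ → ℤ
      f k = ℤΣ.Σ (monos m (d ∸ k)) (λ e → bit (Std (C ∷ U) T (k ∷ e)))
      first : f 0 ≡ (low c *ₚ A) d
      first = trans (ℤΣ.Σ-cong (monos m d) (λ e → bit-∧ (0 <ᵇ c) (Std U T e)))
        (trans (ℤΣ.Σ-*ˡ (monos m d) (bit (0 <ᵇ c)) (λ e → bit (Std U T e)))
          (trans (cong (λ z → bit (0 <ᵇ c) ℤ.* z) (count-standard U T d)) (sym (low-* c A d))))
      rest : ∀ k → f (suc k) ≡ geo c (suc k) ℤ.* B (d ∸ suc k)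
      rest k = trans (ℤΣ.Σ-cong (monos m (d ∸ suc k)) (λ e → bit-∧ (suc k <ᵇ c) (Std U (C ∷ T) e)))
        (trans (ℤΣ.Σ-*ˡ (monos m (d ∸ suc k)) (bit (suc k <ᵇ c)) (λ e → bit (Std U (C ∷ T) e)))
          (cong (λ z → bit (suc k <ᵇ c) ℤ.* z) (count-standard U (C ∷ T) (d ∸ suc k))))

  module CharPoly {n : ℕ} (M : Polymatroid n) where
    open Flats M
    open Intervals M
    open Möbius
    module ℤI = Incidence ℤP.+-*-commutativeRing

    -- After the exchange of sums the inner one runs over the lower argument of μ, which leaves only
    -- H = J.
    Σ-charPoly : ∀ {J G} → IsFlat M J → IsFlat M G → J ⊆ G →
      PG.Σ (interval M J G) (λ K → charPoly M K G) ≈ xpow (rk G ∸ rk J)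
    Σ-charPoly {J} {G} flatJ flatG J⊆G d = begin
      PG.Σ I (λ K → charPoly M K G) d ≡⟨ Σ-at I (λ K → charPoly M K G) d ⟩
      ℤΣ.Σ I (λ K → ℤΣ.Σ (interval M K G) (λ H → if (rk G ∸ rk H) ≡ᵇ d then μ M K H else + 0))
        ≡⟨ ℤI.Σ-interval-swap J G (λ K H → if (rk G ∸ rk H) ≡ᵇ d then μ M K H else + 0) ⟨
      ℤΣ.Σ I (λ H → ℤΣ.Σ (interval M J H) (λ K → if (rk G ∸ rk H) ≡ᵇ d then μ M K H else + 0))
        ≡⟨ ℤΣ.Σ-cong-∈ I (λ {H} m → inner H m) ⟩
      ℤΣ.Σ I (λ H → ℤG.when (J ≟ₛ H) (xpow (rk G ∸ rk H) d))
        ≡⟨ ℤG.Σ-only _≟ₛ_ I (interval-unique J G) J (interval⁺ flatJ id J⊆G) (λ H → xpow (rk G ∸ rk H) d) ⟩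
      xpow (rk G ∸ rk J) d ∎
      where
      open ≡-Reasoning
      I = interval M J G
      pull : ∀ b H → ℤΣ.Σ (interval M J H) (λ K → if b then μ M K H else + 0) ≡ (if b then ℤΣ.Σ (interval M J H) (λ K → μ M K H) else + 0)
      pull true H = refl
      pull false H = ℤΣ.Σ-0 (interval M J H)
      exchange : ∀ b {H} (p : Dec (J ≡ H)) → (if b then ℤG.when p (+ 1) else + 0) ≡ ℤG.when p (if b then + 1 else + 0)
      exchange true p = refl
      exchange false (yes _) = refl
      exchange false (no _) = refl
      inner : ∀ H → H ∈ I → ℤΣ.Σ (interval M J H) (λ K → if (rk G ∸ rk H) ≡ᵇ d then μ M K H else + 0) ≡ ℤG.when (J ≟ₛ H) (xpow (rk G ∸ rk H) d)
      inner H m = let (flatH , J⊆H , _) = interval⁻ m ; b = (rk G ∸ rk H) ≡ᵇ d in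
        trans (pull b H) (trans (cong (λ z → if b then z else + 0)
          (trans (ℤΣ.Σ-cong (interval M J H) (λ K → sym (ℤP.*-identityˡ (μ M K H)))) (μ-right flatJ flatH J⊆H)))
          (exchange b (J ≟ₛ H)))

  module Inversion {n : ℕ} (M : Polymatroid n) (loopless : Loopless M) (𝒢 : Subset n → Bool) (building : IsBuildingSet M 𝒢) where
    open Building M loopless 𝒢 building
    open Intervals M
    open Incidence PS-ring
    module C = Combinatorics M loopless 𝒢 building PS-ring
    open import Relation.Binary.Reasoning.Setoid P.setoid

    induced-sorted : ∀ F G → C.Sorted (induced M 𝒢 F G)
    induced-sorted F G = AllPairsP.filter⁺ _ (AllPairsP.filter⁺ _ (AllPairsP.filter⁺ _ (allSubsets-sorted n)))

    -- Tails of the sorted list are upward closed in the induced building set, so the joins provided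
    -- by `induced-∨` stay in the tail.
    good-induced : ∀ {F G} (flatF : IsFlat M F) → IsFlat M G → F ⊆ G → Tower.Good M F flatF (induced M 𝒢 F G)
    good-induced {F} {G} flatF flatG F⊆G = go (induced M 𝒢 F G) (induced-sorted F G) id (λ D∈ _ _ → D∈)
      where
      go : ∀ U → C.Sorted U → (∀ {H} → H ∈ U → H ∈ induced M 𝒢 F G) →
        (∀ {D H} → D ∈ induced M 𝒢 F G → H ∈ U → H ⊆ D → D ∈ U) → Tower.Good M F flatF U
      go [] _ _ _ = tt
      go (C ∷ U) (C≤ ∷ sorted) U⊆ upward =
        (let (flatC , F⊆C , _) = proj₁ (induced⁻ (U⊆ (here refl))) in flatC , λ {x} → F⊆C {x}) ,
        All.lookup C≤ ,
        (λ {H₁} {H₂} H₁∈ H₂∈ C⊆H₁ C⊆H₂ → later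
          (induced-∨ flatF flatG F⊆G (U⊆ (here refl)) (U⊆ (there H₁∈)) (U⊆ (there H₂∈)) C⊆H₁ C⊆H₂) H₁∈ (∨-upperˡ H₁ H₂)) ,
        go U sorted (U⊆ ∘ there) later
        where
        later : ∀ {D H} → D ∈ induced M 𝒢 F G → H ∈ U → H ⊆ D → D ∈ U
        later {D} {H} D∈ H∈ H⊆D = strip (upward D∈ (there H∈) H⊆D)
          where
          strip : D ∈ C ∷ U → D ∈ U
          strip (here refl) = ⊥-elim (All.lookup C≤ H∈ H⊆D)
          strip (there m) = m

    empty : {A : Set} (L : List A) → (∀ {x} → ¬ x ∈ L) → L ≡ []
    empty [] p = refl
    empty (x ∷ L) p = ⊥-elim (p (here refl))

    induced-empty : ∀ F → induced M 𝒢 F F ≡ []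
    induced-empty F = empty (induced M 𝒢 F F) (λ m → let (_ , i) = induced⁻ m in Induced.source⊈ i (Induced.source⊆ i))

    module _ {G : Subset n} (flatG : IsFlat M G) where
      private module W = C.Weights u v u+v≈1 xpow xpow-+ (charPoly M) G flatG
                           (λ flatJ J⊆G → CharPoly.Σ-charPoly M flatJ flatG J⊆G)

      -- A formula for -χ̄ that needs no case distinction: `χ̄≈-Y` shows that the value prescribed
      -- on the diagonal fits it.
      Y : Subset n → PS
      Y K = charPoly M K G *ₚ W.weight (factors G) K

      unnormalised : ∀ {K} → IsFlat M K → K ⊆ G → charPoly M K G *ₚ invOneMinusXPow (length (maximals M (induced M 𝒢 K G))) ≈ Y K
      unnormalised {K} flatK K⊆G = P.*-congˡ {charPoly M K G} (P.trans
        (P.reflexive (cong invOneMinusXPow (maximals-induced flatK flatG K⊆G))) (invOneMinusXPow-count (_⊆? K) (factors G)))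

      charPoly-same : charPoly M G G ≈ 1ₚ
      charPoly-same = begin
        charPoly M G G ≈⟨ Σ-remove _≟ₛ_ (interval M G G) (interval-unique G G) G (interval⁺ flatG id id) (λ K → charPoly M K G)
                            (λ m ne → ⊥-elim (ne (let (_ , G⊆K , K⊆G) = interval⁻ m in ⊆-antisym K⊆G G⊆K))) ⟨
        PG.Σ (interval M G G) (λ K → charPoly M K G) ≈⟨ CharPoly.Σ-charPoly M flatG flatG id ⟩
        xpow (rk G ∸ rk G) ≈⟨ P.trans (P.reflexive (cong xpow (ℕP.n∸n≡0 (rk G)))) xpow-zero ⟩
        1ₚ ∎

      Y-same : Y G ≈ 1ₚ
      Y-same = begin
        Y G ≈⟨ unnormalised flatG id ⟨
        charPoly M G G *ₚ invOneMinusXPow (length (maximals M (induced M 𝒢 G G)))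
          ≈⟨ P.*-cong charPoly-same (P.reflexive (cong (λ L → invOneMinusXPow (length (maximals M L))) (induced-empty G))) ⟩
        1ₚ *ₚ 1ₚ ≈⟨ P.*-identityˡ 1ₚ ⟩
        1ₚ ∎

      χ̄-same : χ̄ M 𝒢 G G ≡ constPS (ℤ.- + 1)
      χ̄-same = if-yes (G ≟ₛ G) refl

      χ̄-differ : ∀ {K} → K ≢ G →
        χ̄ M 𝒢 K G ≡ -ₚ (charPoly M K G *ₚ invOneMinusXPow (length (maximals M (induced M 𝒢 K G))))
      χ̄-differ {K} K≢G = if-no (K ≟ₛ G) K≢G

      χ̄≈-Y : ∀ {K} → IsFlat M K → K ⊆ G → χ̄ M 𝒢 K G ≈ -ₚ Y K
      χ̄≈-Y {K} flatK K⊆G = go (K ≟ₛ G)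
        where
        go : Dec (K ≡ G) → χ̄ M 𝒢 K G ≈ -ₚ Y K
        go (yes refl) = begin
          χ̄ M 𝒢 G G ≈⟨ P.reflexive χ̄-same ⟩
          constPS (ℤ.- + 1) ≈⟨ (λ { zero → refl ; (suc d) → refl }) ⟩
          -ₚ 1ₚ ≈⟨ P.-‿cong Y-same ⟨
          -ₚ Y G ∎
        go (no K≢G) = P.trans (P.reflexive (χ̄-differ K≢G)) (P.-‿cong (unnormalised flatK K⊆G))

    module _ (h : Subset n → Subset n → ℕ → ℕ)
             (hilbert : ∀ F G → IsFlat M F → IsFlat M G → F ⊊ G → IsChowHilbertSeries M 𝒢 F G (h F G)) where

      chow-same : ∀ F → chowFun M h F F ≡ 1ₚ
      chow-same F = if-yes (F ≟ₛ F) refl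

      chow-differ : ∀ {F K} → F ≢ K → chowFun M h F K ≡ (λ d → + h F K d)
      chow-differ {F} {K} F≢K = if-no (F ≟ₛ K) F≢K

      -- The Hilbert series counts standard monomials, and `Q` with trivial weight is their
      -- generating function. On the diagonal there are no variables, and the value 1 agrees with
      -- the convention.
      chow-count : ∀ {F K} (flatF : IsFlat M F) → IsFlat M K → F ⊆ K →
        chowFun M h F K ≈ C.Counting.Q F flatF low geo (induced M 𝒢 F K) [] (λ _ → 1ₚ)
      chow-count {F} {K} flatF flatK F⊆K = go (F ≟ₛ K)
        where
        go : Dec (F ≡ K) → chowFun M h F K ≈ C.Counting.Q F flatF low geo (induced M 𝒢 F K) [] (λ _ → 1ₚ)
        go (yes refl) = P.trans (P.reflexive (chow-same F))
          (P.reflexive (sym (cong (λ U → C.Counting.Q F flatF low geo U [] (λ _ → 1ₚ)) (induced-empty F))))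
        go (no F≢K) = P.trans (P.reflexive (chow-differ F≢K)) λ d →
          trans (cong +_ (Hilbert.hilbert-standard M 𝒢 F K flatF (good-induced flatF flatK F⊆K) (h F K)
              (hilbert F K flatF flatK ((λ {x} → F⊆K {x}) , F≢K)) d))
            (trans (length-filter-bit (Tower.Std M F flatF (induced M 𝒢 F K) []) (monos (length (induced M 𝒢 F K)) d))
              (Count.count-standard M loopless 𝒢 building F flatF (induced M 𝒢 F K) [] d))

      chow-diagonal : ∀ {F} → IsFlat M F → chowFun M h F F ≈ 1ₚ
      chow-diagonal {F} flatF = P.trans (chow-count flatF flatF id)
        (P.reflexive (cong (λ U → C.Counting.Q F flatF low geo U [] (λ _ → 1ₚ)) (induced-empty F)))

      -χ̄ : Inc
      -χ̄ K G = -ₚ χ̄ M 𝒢 K G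

      left-inverse : ∀ {F G} → IsFlat M F → IsFlat M G → F ⊆ G → conv (chowFun M h) -χ̄ F G ≈ δ F G
      left-inverse {F} {G} flatF flatG F⊆G = P.trans to-Y (go (F ≟ₛ G))
        where
        I = interval M F G
        to-Y : conv (chowFun M h) -χ̄ F G ≈ PG.Σ I (λ K → chowFun M h F K *ₚ Y flatG K)
        to-Y = Σ-cong-∈ I (λ {K} m → let (flatK , _ , K⊆G) = interval⁻ m in
          P.*-congˡ {chowFun M h F K} (P.trans (P.-‿cong (χ̄≈-Y flatG flatK K⊆G)) (λ d → ℤP.neg-involutive (Y flatG K d))))
        go : (p : Dec (F ≡ G)) → PG.Σ I (λ K → chowFun M h F K *ₚ Y flatG K) ≈ PG.when p 1ₚ
        go (yes refl) = begin
          PG.Σ I (λ K → chowFun M h F K *ₚ Y flatG K) ≈⟨ conv-point (chowFun M h) (λ K _ → Y flatG K) flatF ⟩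
          chowFun M h F F *ₚ Y flatG F ≈⟨ P.*-cong (chow-diagonal flatF) (Y-same flatG) ⟩
          1ₚ *ₚ 1ₚ ≈⟨ P.*-identityˡ 1ₚ ⟩
          1ₚ ∎
        go (no F≢G) = P.trans
          (Σ-cong-∈ I (λ {K} m → let (flatK , F⊆K , _) = interval⁻ m in P.*-congʳ {Y flatG K} (chow-count flatF flatK F⊆K)))
          (C.Vanishing.inverse-identity F G flatF flatG F⊆G u v u+v≈1 xpow xpow-+ (charPoly M)
            (λ flatJ J⊆G → CharPoly.Σ-charPoly M flatJ flatG J⊆G) low geo low-geo (induced-sorted F G)
            (λ _ → P.refl) (λ G⊆F → F≢G (⊆-antisym F⊆G G⊆F)))

      -- The combinatorics gives one product only; the other follows in the incidence algebra
      -- because the diagonal of `chowFun` is 1.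
      right-inverse : ∀ {F G} → IsFlat M F → IsFlat M G → F ⊆ G → conv -χ̄ (chowFun M h) F G ≈ δ F G
      right-inverse = conv-inverse-comm (chowFun M h) -χ̄ chow-diagonal left-inverse

      negate : ∀ F G → -ₚ δ F G ≈ minusδ M F G
      negate F G = go (F ≟ₛ G)
        where
        go : (p : Dec (F ≡ G)) → -ₚ PG.when p 1ₚ ≈ (if does p then constPS (ℤ.- + 1) else λ _ → + 0)
        go (yes _) zero = refl
        go (yes _) (suc d) = refl
        go (no _) d = refl

      product-at : ∀ a b F G d → _·ᵢ_ M a b F G d ≡ conv a b F G d
      product-at a b F G d = sym (Σ-at (interval M F G) (λ H → a F H *ₚ b H G) d)

      conv-negʳ : ∀ a b F G → conv a b F G ≈ -ₚ conv a (λ K G → -ₚ b K G) F G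
      conv-negʳ a b F G = begin
        conv a b F G ≈⟨ (λ d → sym (ℤP.neg-involutive (conv a b F G d))) ⟩
        -ₚ (-ₚ conv a b F G) ≈⟨ P.-‿cong (Σ-neg (interval M F G) (λ H → a F H *ₚ b H G)) ⟨
        -ₚ PG.Σ (interval M F G) (λ H → -ₚ (a F H *ₚ b H G)) ≈⟨ P.-‿cong (Σ-cong (interval M F G) (λ H → *ₚ-negʳ (a F H) (b H G))) ⟨
        -ₚ conv a (λ K G → -ₚ b K G) F G ∎

      conv-negˡ : ∀ a b F G → conv a b F G ≈ -ₚ conv (λ K G → -ₚ a K G) b F G
      conv-negˡ a b F G = begin
        conv a b F G ≈⟨ (λ d → sym (ℤP.neg-involutive (conv a b F G d))) ⟩
        -ₚ (-ₚ conv a b F G) ≈⟨ P.-‿cong (Σ-neg (interval M F G) (λ H → a F H *ₚ b H G)) ⟨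
        -ₚ PG.Σ (interval M F G) (λ H → -ₚ (a F H *ₚ b H G))
          ≈⟨ P.-‿cong (Σ-cong (interval M F G) (λ H → P.trans (P.*-comm (-ₚ a F H) (b H G))
               (P.trans (*ₚ-negʳ (b H G) (a F H)) (P.-‿cong (P.*-comm (b H G) (a F H)))))) ⟨
        -ₚ conv (λ K G → -ₚ a K G) b F G ∎

      chow-χ̄-inverse : ∀ F G → IsFlat M F → IsFlat M G → F ⊆ G → ∀ d →
        (_·ᵢ_ M (chowFun M h) (χ̄ M 𝒢) F G d ≡ minusδ M F G d) × (_·ᵢ_ M (χ̄ M 𝒢) (chowFun M h) F G d ≡ minusδ M F G d)
      chow-χ̄-inverse F G flatF flatG F⊆G d =
        trans (product-at (chowFun M h) (χ̄ M 𝒢) F G d)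
          (trans (conv-negʳ (chowFun M h) (χ̄ M 𝒢) F G d) (trans (cong ℤ.-_ (left-inverse flatF flatG F⊆G d)) (negate F G d))) ,
        trans (product-at (χ̄ M 𝒢) (chowFun M h) F G d)
          (trans (conv-negˡ (χ̄ M 𝒢) (chowFun M h) F G d) (trans (cong ℤ.-_ (right-inverse flatF flatG F⊆G d)) (negate F G d)))

theorem3p6 : ∀ {n} (M : Polymatroid n) → Loopless M →
    (𝒢 : Subset n → Bool) → IsBuildingSet M 𝒢 →
    (h : Subset n → Subset n → ℕ → ℕ) →
    (∀ F G → IsFlat M F → IsFlat M G → F ⊊ G → IsChowHilbertSeries M 𝒢 F G (h F G)) →
    ∀ F G → IsFlat M F → IsFlat M G → F ⊆ G → ∀ d →
    (_·ᵢ_ M (chowFun M h) (χ̄ M 𝒢) F G d ≡ minusδ M F G d)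
    × (_·ᵢ_ M (χ̄ M 𝒢) (chowFun M h) F G d ≡ minusδ M F G d)
theorem3p6 M loopless 𝒢 building = Inversion.Inversion.chow-χ̄-inverse M loopless 𝒢 building
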